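{- For every integer $n \geq 141$, among all triangle-free graphs on $n$ vertices, the balanced complete bipartite graph $K_{\lfloor n/2\rfloor, \lceil n/2\rceil}$ is the triangle-free graph with the largest number of cycles.
   Context: Graphs are finite and simple. A cycle in a graph is a subgraph isomorphic to $C_m$ for some $m\geq 3$; the number of cycles of a graph $G$ is the number of such subgraphs. A graph is triangle-free if it contains no cycle of length $3$. $K_{a,b}$ denotes the complete bipartite graph with parts of sizes $a$ and $b$. -}

module Defs where

open import Data.Bool using (Bool; true; false; _∧_; _∨_; not; if_then_else_)
open import Data.Nat using (ℕ; zero; suc; _≤ᵇ_; _<ᵇ_; _/_)
open import Data.Fin using (Fin; toℕ; _≟_)
open import Data.List using (List; []; _∷_; [_]; _++_; map; concatMap; allFin; upTo; length; filterᵇ)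
open import Data.Bool.ListAction using (any; all)
open import Data.Vec using (Vec; lookup) renaming ([] to []ᵥ; _∷_ to _∷ᵥ_)
open import Data.Product using (Σ; _×_; _,_; ∃-syntax)
open import Data.Empty using (⊥)
open import Relation.Nullary using (¬_; does)
open import Relation.Binary.PropositionalEquality using (_≡_; refl)
open import Data.Fin.Permutation using (Permutation′; _⟨$⟩ʳ_)

record SimpleGraph (n : ℕ) : Set where
  field
    adj    : Fin n → Fin n → Bool
    sym    : ∀ i j → adj i j ≡ adj j i
    irrefl : ∀ i → adj i i ≡ false
open SimpleGraph public

-- no three mutually adjacent vertices (they are automatically distinct by irrefl)
TriangleFree : ∀ {n} → SimpleGraph n → Set
TriangleFree G = ¬ (∃[ a ] ∃[ b ] ∃[ c ]
  (adj G a b ≡ true × adj G b c ≡ true × adj G a c ≡ true))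

_≅_ : ∀ {n} → SimpleGraph n → SimpleGraph n → Set
_≅_ {n} G H = Σ (Permutation′ n) λ σ → ∀ i j → adj G i j ≡ adj H (σ ⟨$⟩ʳ i) (σ ⟨$⟩ʳ j)

xorB : Bool → Bool → Bool
xorB true  b = not b
xorB false b = b

private
  xor-comm : ∀ a b → xorB a b ≡ xorB b a
  xor-comm true  true  = refl
  xor-comm true  false = refl
  xor-comm false true  = refl
  xor-comm false false = refl

  xor-self : ∀ a → xorB a a ≡ false
  xor-self true  = refl
  xor-self false = refl

balancedK : (n : ℕ) → SimpleGraph n
balancedK n = record
  { adj    = λ i j → xorB (inA i) (inA j)
  ; sym    = λ i j → xor-comm (inA i) (inA j)
  ; irrefl = λ i → xor-self (inA i)
  }
  where
  inA : Fin n → Bool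
  inA i = toℕ i <ᵇ (n / 2)

-- Counting cycles.
-- A cycle of G is a subgraph isomorphic to C_m (m ≥ 3).  Such a subgraph
-- is determined by its edge set (its vertices are the ends of its edges),
-- so we count edge sets H (symmetric 0/1 matrices) with H ⊆ E(G) such that
-- H is exactly the edge set of the cycle v₀ v₁ … v_{m-1} v₀ for some list of
-- m ≥ 3 pairwise distinct vertices.

eqF : ∀ {n} → Fin n → Fin n → Bool
eqF i j = does (i ≟ j)

eqB : Bool → Bool → Bool
eqB a b = not (xorB a b)

allLists : ∀ {A : Set} → ℕ → List A → List (List A)
allLists zero    xs = [ [] ]
allLists (suc m) xs = concatMap (λ x → map (x ∷_) (allLists m xs)) xs

allVecs : ∀ {A : Set} → (m : ℕ) → List A → List (Vec A m)
allVecs zero    xs = [ []ᵥ ]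
allVecs (suc m) xs = concatMap (λ x → map (x ∷ᵥ_) (allVecs m xs)) xs

Matrix : ℕ → Set
Matrix n = Vec (Vec Bool n) n

allMatrices : (n : ℕ) → List (Matrix n)
allMatrices n = allVecs n (allVecs n (true ∷ false ∷ []))

entry : ∀ {n} → Matrix n → Fin n → Fin n → Bool
entry H i j = lookup (lookup H i) j

distinctB : ∀ {n} → List (Fin n) → Bool
distinctB []      = true
distinctB (x ∷ r) = not (any (eqF x) r) ∧ distinctB r

pairs : ∀ {A : Set} → List A → List (A × A)
pairs (x ∷ y ∷ r) = (x , y) ∷ pairs (y ∷ r)
pairs _           = []

cycPairs : ∀ {A : Set} → List A → List (A × A)
cycPairs []      = []
cycPairs (x ∷ r) = pairs ((x ∷ r) ++ [ x ])

cycAdj : ∀ {n} → List (Fin n) → Fin n → Fin n → Bool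
cycAdj vs i j = any (λ { (a , b) → (eqF a i ∧ eqF b j) ∨ (eqF a j ∧ eqF b i) }) (cycPairs vs)

allPairsB : ∀ {n} → (Fin n → Fin n → Bool) → Bool
allPairsB {n} p = all (λ i → all (λ j → p i j) (allFin n)) (allFin n)

subB : ∀ {n} → Matrix n → SimpleGraph n → Bool
subB H G = allPairsB (λ i j → not (entry H i j) ∨ adj G i j)

isCycleOn : ∀ {n} → Matrix n → List (Fin n) → Bool
isCycleOn H vs = distinctB vs ∧ allPairsB (λ i j → eqB (entry H i j) (cycAdj vs i j))

isCycleB : ∀ {n} → Matrix n → Bool
isCycleB {n} H =
  any (λ m → (3 ≤ᵇ m) ∧ any (isCycleOn H) (allLists m (allFin n))) (upTo (suc n))

numCycles : ∀ {n} → SimpleGraph n → ℕ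
numCycles {n} G = length (filterᵇ (λ H → subB H G ∧ isCycleB H) (allMatrices n))

{-# OPTIONS --safe #-}
-- Twice the number of cycles through a vertex x is the number of closed vertex sequences starting at x,
-- and cycles are counted by deleting the vertices one at a time. In a triangle-free graph two
-- consecutive vertices of a path have disjoint neighbourhoods, so that a path with k unused vertices
-- has at most ⌊k²/4⌋ choices for its next two vertices; in complete bipartite graphs this is exact.
-- If some vertex has degree at most 2n/5, the resulting bound on the cycles through it is smaller, by
-- a factor of roughly 16/25, than the bound for a vertex of degree n/2, which the balanced complete
-- bipartite graph nearly attains. Otherwise the graph is bipartite (Andrásfai): it contains no closed
-- 5-walk, hence having a common neighbour is an equivalence relation, with at most two classes. Among
-- complete bipartite graphs, moving a vertex to the smaller class increases the number of cycles.
module Submission where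

open import Defs
open import Data.Bool using (Bool; true; false; _∧_; _∨_; not; if_then_else_)
open import Data.Bool.ListAction using (any; all)
open import Data.Bool.Properties using (∧-conicalˡ; ∧-conicalʳ; ∧-comm; ∧-assoc; ∧-zeroʳ; ∨-comm; ∨-zeroʳ; not-involutive; T?; T-≡)
open import Data.Empty using (⊥; ⊥-elim)
open import Data.Fin using (Fin; zero; suc; _≟_; toℕ; punchIn)
open import Data.Fin.Permutation as Perm using (Permutation′; _⟨$⟩ʳ_)
open import Data.Fin.Properties using (any?)
open import Data.List using (List; []; _∷_; [_]; _++_; _∷ʳ_; map; concatMap; allFin; upTo; length; filterᵇ; reverse; initLast; _∷ʳ′_)
import Data.List as List
open import Data.List.Membership.Propositional using (_∈_; _∉_)
open import Data.List.Membership.Propositional.Properties using (∈-map⁺; ∈-map⁻; ∈-++⁺ˡ; ∈-++⁺ʳ; ∈-++⁻; ∈-filter⁺; ∈-filter⁻; ∈-∃++; ∈-allFin; ∈-upTo⁺)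
open import Data.List.Properties using (length-tabulate; length-++; length-map; length-reverse; length-++-comm; reverse-++; unfold-reverse; reverse-involutive; ++-assoc; ++-identityʳ; ∷ʳ-injectiveˡ; ∷-injectiveˡ)
open import Data.List.Relation.Unary.All as All using (All; []; _∷_)
open import Data.List.Relation.Unary.AllPairs using ([]; _∷_)
open import Data.List.Relation.Unary.Any using (here; there)
open import Data.List.Relation.Unary.Any.Properties using (reverse⁻)
open import Data.List.Relation.Unary.Unique.Propositional using (Unique)
import Data.List.Relation.Unary.Unique.Propositional.Properties as Unique
open import Data.Nat using (ℕ; zero; suc; _+_; _*_; _∸_; _≤_; _<_; _≤ᵇ_; _<ᵇ_; _/_; _!; >-nonZero; z≤n; s≤s; ⌊_/2⌋; ⌈_/2⌉)
open import Data.Nat.DivMod using (m*n/n≡m; m/n≡1+[m∸n]/n)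
open import Data.Nat.Properties hiding (_≟_)
open import Data.Nat.Tactic.RingSolver using (solve-∀)
open import Data.Product using (Σ; _×_; _,_; ∃-syntax; proj₁; proj₂)
open import Data.Sum using (_⊎_; inj₁; inj₂; [_,_]′; swap)
open import Data.Vec using (Vec; lookup; tabulate) renaming ([] to []ᵥ; _∷_ to _∷ᵥ_)
open import Data.Vec.Properties using (lookup∘tabulate; ∷-injective)
open import Function using (_∘_; id; Equivalence)
open import Relation.Binary.PropositionalEquality using (_≡_; _≢_; refl; trans; cong; cong₂; subst; module ≡-Reasoning) renaming (sym to ≡-sym)
open import Relation.Nullary using (¬_; yes; no; contradiction)
open import Algebra.Properties.Semiring.Sum +-*-semiring using (sum; sum-cong-≗; ∑-distrib-+; ∑-comm; *-distribʳ-sum; sum-replicate-zero; sum-remove)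

-- The comparison is tight for odd n. `F` bounds paths between arbitrary ends; for an even number of
-- interior vertices it is close to the count between opposite classes of a complete bipartite
-- graph. The two neighbours of a vertex on a cycle lie in one class, however, where the count is
-- `S`. For even n the number of interior vertices is odd, `S` and `F` coincide, and the margin is
-- 9/25. All these constants are values at the smallest arguments divided by products of factorials:
-- both recurrences multiply by the same products and add only lower-order terms. Cycles avoiding
-- the first deleted vertex need no degree information: the bound `T` for them is smaller than the
-- main term by a factor of order n.

private
  variable
    n : ℕ

-- Sums over vertex sets

∧-intro : ∀ {a b} → a ≡ true → b ≡ true → a ∧ b ≡ true
∧-intro refl refl = refl

∧-fst : ∀ {a b} → a ∧ b ≡ true → a ≡ true
∧-fst {a} {b} = ∧-conicalˡ a b

∧-snd : ∀ {a b} → a ∧ b ≡ true → b ≡ true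
∧-snd {a} {b} = ∧-conicalʳ a b

true≢false : ∀ {a : Bool} → a ≡ true → a ≡ false → ⊥
true≢false refl ()

bool-ext : ∀ {a b} → (a ≡ true → b ≡ true) → (b ≡ true → a ≡ true) → a ≡ b
bool-ext {true}  {true}  _ _ = refl
bool-ext {true}  {false} f _ = ≡-sym (f refl)
bool-ext {false} {true}  _ g = g refl
bool-ext {false} {false} _ _ = refl

bool-cases : ∀ a → a ≡ true ⊎ a ≡ false
bool-cases true  = inj₁ refl
bool-cases false = inj₂ refl

not-true : ∀ {a} → a ≡ false → not a ≡ true
not-true refl = refl

not-true⁻ : ∀ {a} → not a ≡ true → a ≡ false
not-true⁻ {false} _ = refl

eqF-refl : (i : Fin n) → eqF i i ≡ true
eqF-refl i with i ≟ i
... | yes _ = refl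
... | no ne = contradiction refl ne

eqF-true : {i j : Fin n} → eqF i j ≡ true → i ≡ j
eqF-true {i = i} {j} e with i ≟ j
... | yes p = p

eqF-false : {i j : Fin n} → i ≢ j → eqF i j ≡ false
eqF-false {i = i} {j} ne with i ≟ j
... | yes p = contradiction p ne
... | no _ = refl

eqF-false⁻ : {i j : Fin n} → eqF i j ≡ false → i ≢ j
eqF-false⁻ {i = i} e refl = true≢false (eqF-refl i) e

VSet : ℕ → Set
VSet n = Fin n → Bool

infixl 7 _∖_
infixl 6 _∩_

_∖_ : VSet n → Fin n → VSet n
(U ∖ x) i = U i ∧ not (eqF i x)

_∩_ : VSet n → VSet n → VSet n
(U ∩ V) i = U i ∧ V i

full : VSet n
full _ = true

∖-in : (U : VSet n) {x i : Fin n} → U i ≡ true → i ≢ x → (U ∖ x) i ≡ true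
∖-in U u ne = ∧-intro u (not-true (eqF-false ne))

∖-⊆ : (U : VSet n) {x i : Fin n} → (U ∖ x) i ≡ true → U i ≡ true
∖-⊆ U = ∧-fst

∖-≢ : (U : VSet n) {x i : Fin n} → (U ∖ x) i ≡ true → i ≢ x
∖-≢ U {x} {i} e = eqF-false⁻ (not-true⁻ (∧-snd {U i} e))

⟦_⟧ : Bool → ℕ
⟦ b ⟧ = if b then 1 else 0

infix 5 Σ[_]_

opaque
  Σ[_]_ : VSet n → (Fin n → ℕ) → ℕ
  Σ[ U ] f = sum (λ i → if U i then f i else 0)

  #_ : VSet n → ℕ
  # U = Σ[ U ] (λ _ → 1)

sum-mono : {f g : Fin n → ℕ} → (∀ i → f i ≤ g i) → sum f ≤ sum g
sum-mono {zero}  h = z≤n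
sum-mono {suc n} h = +-mono-≤ (h zero) (sum-mono (h ∘ suc))

opaque
  unfolding Σ[_]_ #_

  Σ-sum : (U : VSet n) (f : Fin n → ℕ) → Σ[ U ] f ≡ sum (λ i → if U i then f i else 0)
  Σ-sum U f = refl

  Σ-cong : (U : VSet n) {f g : Fin n → ℕ} → (∀ i → U i ≡ true → f i ≡ g i) → Σ[ U ] f ≡ Σ[ U ] g
  Σ-cong U {f} {g} h = sum-cong-≗ λ i → aux i (U i) refl
    where
    aux : ∀ i b → U i ≡ b → (if b then f i else 0) ≡ (if b then g i else 0)
    aux i true  e = h i e
    aux i false _ = refl

  Σ-congˡ : {U V : VSet n} → (∀ i → U i ≡ V i) → (f : Fin n → ℕ) → Σ[ U ] f ≡ Σ[ V ] f
  Σ-congˡ h f = sum-cong-≗ λ i → cong (λ b → if b then f i else 0) (h i)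

  Σ-⊆-mono : {U V : VSet n} {f g : Fin n → ℕ} → (∀ i → U i ≡ true → V i ≡ true) →
             (∀ i → U i ≡ true → f i ≤ g i) → Σ[ U ] f ≤ Σ[ V ] g
  Σ-⊆-mono {U = U} {V} {f} {g} s h = sum-mono λ i → aux i (U i) refl
    where
    aux : ∀ i b → U i ≡ b → (if b then f i else 0) ≤ (if V i then g i else 0)
    aux i true  e rewrite s i e = h i e
    aux i false _ = z≤n

  Σ-mono : (U : VSet n) {f g : Fin n → ℕ} → (∀ i → U i ≡ true → f i ≤ g i) → Σ[ U ] f ≤ Σ[ U ] g
  Σ-mono U = Σ-⊆-mono {U = U} {V = U} (λ _ e → e)

  #-mono : {U V : VSet n} → (∀ i → U i ≡ true → V i ≡ true) → # U ≤ # V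
  #-mono s = Σ-⊆-mono s (λ _ _ → ≤-refl)

  #-cong : {U V : VSet n} → (∀ i → U i ≡ V i) → # U ≡ # V
  #-cong h = Σ-congˡ h (λ _ → 1)

  Σ-const : (U : VSet n) (c : ℕ) → Σ[ U ] (λ _ → c) ≡ # U * c
  Σ-const U c = trans (sum-cong-≗ (λ i → aux (U i))) (≡-sym (*-distribʳ-sum c (λ i → if U i then 1 else 0)))
    where
    aux : ∀ b → (if b then c else 0) ≡ (if b then 1 else 0) * c
    aux true  = ≡-sym (+-identityʳ c)
    aux false = refl

  Σ-≤-const : (U : VSet n) {f : Fin n → ℕ} {c : ℕ} → (∀ i → U i ≡ true → f i ≤ c) → Σ[ U ] f ≤ # U * c
  Σ-≤-const U {f} {c} h = ≤-trans (Σ-mono U h) (≤-reflexive (Σ-const U c))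

  Σ-≡-const : (U : VSet n) {f : Fin n → ℕ} {c : ℕ} → (∀ i → U i ≡ true → f i ≡ c) → Σ[ U ] f ≡ # U * c
  Σ-≡-const U {f} {c} h = trans (Σ-cong U h) (Σ-const U c)

  Σ-+ : (U : VSet n) (f g : Fin n → ℕ) → Σ[ U ] (λ i → f i + g i) ≡ (Σ[ U ] f) + (Σ[ U ] g)
  Σ-+ U f g = trans (sum-cong-≗ (λ i → aux i (U i)))
    (∑-distrib-+ (λ i → if U i then f i else 0) (λ i → if U i then g i else 0))
    where
    aux : ∀ i b → (if b then f i + g i else 0) ≡ (if b then f i else 0) + (if b then g i else 0)
    aux i true  = refl
    aux i false = refl

  -- An indicator replaces the dependent inner range, so that the exchange of two sums over all
  -- vertices applies.
  Σ-nest : (U : VSet n) (V : Fin n → VSet n) (f : Fin n → Fin n → ℕ) →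
           Σ[ U ] (λ i → Σ[ V i ] f i) ≡ sum (λ i → sum (λ j → if U i ∧ V i j then f i j else 0))
  Σ-nest {n} U V f = sum-cong-≗ λ i → aux i (U i)
    where
    aux : ∀ i b → (if b then (Σ[ V i ] f i) else 0) ≡ sum (λ j → if b ∧ V i j then f i j else 0)
    aux i true  = refl
    aux i false = ≡-sym (sum-replicate-zero n)

  Σ-swap : (A : VSet n) (B : Fin n → VSet n) (C : VSet n) (D : Fin n → VSet n)
           (f g : Fin n → Fin n → ℕ) →
           (∀ i j → A i ∧ B i j ≡ C j ∧ D j i) →
           (∀ i j → A i ∧ B i j ≡ true → f i j ≡ g j i) →
           Σ[ A ] (λ i → Σ[ B i ] f i) ≡ Σ[ C ] (λ j → Σ[ D j ] g j)
  Σ-swap A B C D f g h e = begin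
    Σ[ A ] (λ i → Σ[ B i ] f i)
      ≡⟨ Σ-nest A B f ⟩
    sum (λ i → sum (λ j → if A i ∧ B i j then f i j else 0))
      ≡⟨ ∑-comm (λ i j → if A i ∧ B i j then f i j else 0) ⟩
    sum (λ j → sum (λ i → if A i ∧ B i j then f i j else 0))
      ≡⟨ sum-cong-≗ (λ j → sum-cong-≗ (λ i → aux i j (A i ∧ B i j) refl)) ⟩
    sum (λ j → sum (λ i → if C j ∧ D j i then g j i else 0))
      ≡⟨ ≡-sym (Σ-nest C D g) ⟩
    Σ[ C ] (λ j → Σ[ D j ] g j) ∎
    where
    open ≡-Reasoning
    aux : ∀ i j b → A i ∧ B i j ≡ b → (if A i ∧ B i j then f i j else 0) ≡ (if C j ∧ D j i then g j i else 0)
    aux i j true  p rewrite ≡-sym (h i j) | p = e i j p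
    aux i j false p rewrite ≡-sym (h i j) | p = refl

  Σ-split : (U P : VSet n) (f : Fin n → ℕ) → Σ[ U ] f ≡ (Σ[ U ∩ P ] f) + (Σ[ U ∩ (not ∘ P) ] f)
  Σ-split U P f = trans (sum-cong-≗ (λ i → aux (U i) (P i) (f i)))
    (∑-distrib-+ (λ i → if U i ∧ P i then f i else 0) (λ i → if U i ∧ not (P i) then f i else 0))
    where
    aux : ∀ u p x → (if u then x else 0) ≡ (if u ∧ p then x else 0) + (if u ∧ not p then x else 0)
    aux true  true  x = ≡-sym (+-identityʳ x)
    aux true  false x = refl
    aux false _     x = refl

  #-split : (U P : VSet n) → # U ≡ # (U ∩ P) + # (U ∩ (not ∘ P))
  #-split U P = Σ-split U P (λ _ → 1)

  sum-single : (x : Fin n) (f : Fin n → ℕ) → sum (λ i → if eqF i x then f i else 0) ≡ f x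
  sum-single {suc n} zero    f = trans (cong (f zero +_) (sum-replicate-zero n)) (+-identityʳ _)
  sum-single {suc n} (suc x) f = trans (sum-cong-≗ (λ i → cong (λ b → if b then f (suc i) else 0) (aux i))) (sum-single x (f ∘ suc))
    where
    aux : ∀ i → eqF (suc i) (suc x) ≡ eqF i x
    aux i = refl

  Σ-remove : (U : VSet n) {x : Fin n} → U x ≡ true → (f : Fin n → ℕ) → Σ[ U ] f ≡ f x + (Σ[ U ∖ x ] f)
  Σ-remove U {x} u f = trans (Σ-split U (λ i → eqF i x) f)
    (cong (_+ (Σ[ U ∖ x ] f)) (trans (Σ-congˡ aux f) (sum-single x f)))
    where
    aux : ∀ i → (U ∩ (λ j → eqF j x)) i ≡ eqF i x
    aux i = bool-ext (∧-snd {U i}) (λ e → ∧-intro (subst (λ k → U k ≡ true) (≡-sym (eqF-true e)) u) e)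

  #-remove : (U : VSet n) {x : Fin n} → U x ≡ true → # U ≡ suc (# (U ∖ x))
  #-remove U u = Σ-remove U u (λ _ → 1)

  #-remove′ : (U : VSet n) {x : Fin n} {k : ℕ} → U x ≡ true → # U ≡ suc k → # (U ∖ x) ≡ k
  #-remove′ U u e = suc-injective (trans (≡-sym (#-remove U u)) e)

  #-disjoint : {U V W : VSet n} → (∀ i → U i ≡ true → W i ≡ true) → (∀ i → V i ≡ true → W i ≡ true) →
               (∀ i → U i ≡ true → V i ≡ true → ⊥) → # U + # V ≤ # W
  #-disjoint {U = U} {V} {W} u v d = begin
    # U + # V                               ≤⟨ +-mono-≤ (#-mono {U = U} {V = W ∩ U} (λ i e → ∧-intro (u i e) e))
                                                  (#-mono {U = V} {V = W ∩ (not ∘ U)} (λ i e → ∧-intro (v i e) (not-true (aux i e (bool-cases (U i)))))) ⟩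
    # (W ∩ U) + # (W ∩ (not ∘ U))           ≡⟨ ≡-sym (Σ-split W U (λ _ → 1)) ⟩
    # W                                     ∎
    where
    open ≤-Reasoning
    aux : ∀ i → V i ≡ true → U i ≡ true ⊎ U i ≡ false → U i ≡ false
    aux i e (inj₁ t) = ⊥-elim (d i t e)
    aux i e (inj₂ f) = f

  #-full : # (full {n}) ≡ n
  #-full {zero}  = refl
  #-full {suc n} = cong suc #-full

  #-≤n : (U : VSet n) → # U ≤ n
  #-≤n U = ≤-trans (#-mono {U = U} {V = full} (λ _ _ → refl)) (≤-reflexive (#-full))

  #-suc : (U : VSet (suc n)) → # U ≡ ⟦ U zero ⟧ + # (U ∘ suc)
  #-suc U = refl

  #-punchIn : (U : VSet (suc n)) (j : Fin (suc n)) → # U ≡ ⟦ U j ⟧ + # (U ∘ punchIn j)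
  #-punchIn U j = sum-remove {i = j} (λ i → ⟦ U i ⟧)

  #-zero : (U : VSet n) → # U ≡ 0 → ∀ i → U i ≡ false
  #-zero U e i with U i in eq
  ... | false = refl
  ... | true  = contradiction (trans (≡-sym e) (#-remove U eq)) λ ()

  Σ-zero : (U : VSet n) → # U ≡ 0 → (f : Fin n → ℕ) → Σ[ U ] f ≡ 0
  Σ-zero {n} U e f = trans (sum-cong-≗ (λ i → cong (λ b → if b then f i else 0) (#-zero U e i))) (sum-replicate-zero n)

  #-pos : (U : VSet n) → 0 < # U → ∃[ i ] U i ≡ true
  #-pos {suc n} U l with U zero in eq
  ... | true  = zero , eq
  ... | false with #-pos (U ∘ suc) l
  ...   | i , e = suc i , e

-- Paths in triangle-free graphs

-- The number of paths from v to z of length at most k + 1 whose interior vertices lie in U.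
paths : SimpleGraph n → Fin n → ℕ → Fin n → VSet n → ℕ
paths G z zero    v U = ⟦ adj G v z ⟧
paths G z (suc k) v U = ⟦ adj G v z ⟧ + (Σ[ U ∩ adj G v ] λ w → paths G z k w (U ∖ w))

∖-cong : {U V : VSet n} (w : Fin n) → (∀ i → U i ≡ V i) → ∀ i → (U ∖ w) i ≡ (V ∖ w) i
∖-cong w e i = cong (_∧ not (eqF i w)) (e i)

-- Vertex sets are Boolean functions and are compared pointwise; sets that differ only in the order
-- of deletions agree in this sense.
paths-cong : (G : SimpleGraph n) (z : Fin n) (k : ℕ) (v : Fin n) {U V : VSet n} →
             (∀ i → U i ≡ V i) → paths G z k v U ≡ paths G z k v V
paths-cong G z zero    v e = refl
paths-cong G z (suc k) v {U} {V} e = cong (⟦ adj G v z ⟧ +_) (trans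
  (Σ-cong (U ∩ adj G v) (λ w _ → paths-cong G z k w (∖-cong w e)))
  (Σ-congˡ (λ i → cong (_∧ adj G v i) (e i)) _))

∖-comm : (U : VSet n) (w z i : Fin n) → (U ∖ w ∖ z) i ≡ (U ∖ z ∖ w) i
∖-comm U w z i = trans (∧-assoc (U i) _ _)
  (trans (cong (U i ∧_) (∧-comm (not (eqF i w)) (not (eqF i z)))) (≡-sym (∧-assoc (U i) _ _)))

Σ-⟦⟧ : (U : VSet n) (P : Fin n → Bool) → (Σ[ U ] λ i → ⟦ P i ⟧) ≡ # (U ∩ P)
Σ-⟦⟧ U P = begin
  (Σ[ U ] λ i → ⟦ P i ⟧)
    ≡⟨ Σ-split U P _ ⟩
  (Σ[ U ∩ P ] λ i → ⟦ P i ⟧) + (Σ[ U ∩ (not ∘ P) ] λ i → ⟦ P i ⟧)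
    ≡⟨ cong₂ _+_
         (Σ-≡-const (U ∩ P) (λ i e → cong ⟦_⟧ (∧-snd {U i} e)))
         (Σ-≡-const (U ∩ (not ∘ P)) (λ i e → cong ⟦_⟧ (not-true⁻ (∧-snd {U i} e)))) ⟩
  # (U ∩ P) * 1 + # (U ∩ (not ∘ P)) * 0
    ≡⟨ cong₂ _+_ (*-identityʳ _) (*-zeroʳ (# (U ∩ (not ∘ P)))) ⟩
  # (U ∩ P) + 0
    ≡⟨ +-identityʳ _ ⟩
  # (U ∩ P) ∎
  where open ≡-Reasoning

-- Both sides count the paths from `v` to `x` with exactly one interior vertex, taken in `U`.
common-nbrs : (G : SimpleGraph n) (x v : Fin n) (U : VSet n) →
              (Σ[ U ∩ adj G v ] λ w → ⟦ adj G w x ⟧) ≡ (Σ[ U ∩ adj G x ] λ z → ⟦ adj G v z ⟧)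
common-nbrs G x v U = begin
  (Σ[ U ∩ adj G v ] λ w → ⟦ adj G w x ⟧)     ≡⟨ Σ-⟦⟧ (U ∩ adj G v) (λ w → adj G w x) ⟩
  # (U ∩ adj G v ∩ (λ w → adj G w x))        ≡⟨ #-cong aux ⟩
  # (U ∩ adj G x ∩ adj G v)                  ≡⟨ ≡-sym (Σ-⟦⟧ (U ∩ adj G x) (adj G v)) ⟩
  (Σ[ U ∩ adj G x ] λ z → ⟦ adj G v z ⟧)     ∎
  where
  open ≡-Reasoning
  aux : ∀ i → (U i ∧ adj G v i) ∧ adj G i x ≡ (U i ∧ adj G x i) ∧ adj G v i
  aux i rewrite SimpleGraph.sym G i x = trans (∧-assoc (U i) _ _)
    (trans (cong (U i ∧_) (∧-comm (adj G v i) (adj G x i))) (≡-sym (∧-assoc (U i) _ _)))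

-- A path may be read from its far end: the induction exchanges the choice of the first interior
-- vertex `w` with that of the last one `z`. This makes both neighbours of `x` on a cycle visible at
-- once.
paths-last : (G : SimpleGraph n) (x : Fin n) (k : ℕ) (v : Fin n) (U : VSet n) →
             paths G x (suc k) v U ≡ ⟦ adj G v x ⟧ + (Σ[ U ∩ adj G x ] λ z → paths G z k v (U ∖ z))
paths-last G x zero v U = cong (⟦ adj G v x ⟧ +_) (common-nbrs G x v U)
paths-last G x (suc k) v U = cong (⟦ adj G v x ⟧ +_) (begin
  (Σ[ U ∩ adj G v ] λ w → paths G x (suc k) w (U ∖ w))
    ≡⟨ Σ-cong (U ∩ adj G v) (λ w _ → paths-last G x k w (U ∖ w)) ⟩
  (Σ[ U ∩ adj G v ] λ w → ⟦ adj G w x ⟧ + (Σ[ (U ∖ w) ∩ adj G x ] λ z → paths G z k w (U ∖ w ∖ z)))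
    ≡⟨ Σ-+ (U ∩ adj G v) _ _ ⟩
  (Σ[ U ∩ adj G v ] λ w → ⟦ adj G w x ⟧) +
  (Σ[ U ∩ adj G v ] λ w → Σ[ (U ∖ w) ∩ adj G x ] λ z → paths G z k w (U ∖ w ∖ z))
    ≡⟨ cong₂ _+_ (common-nbrs G x v U)
         (Σ-swap (U ∩ adj G v) (λ w → (U ∖ w) ∩ adj G x) (U ∩ adj G x) (λ z → (U ∖ z) ∩ adj G v)
            (λ w z → paths G z k w (U ∖ w ∖ z)) (λ z w → paths G z k w (U ∖ z ∖ w)) aux
            (λ w z _ → paths-cong G z k w (∖-comm U w z))) ⟩
  (Σ[ U ∩ adj G x ] λ z → ⟦ adj G v z ⟧) +
  (Σ[ U ∩ adj G x ] λ z → Σ[ (U ∖ z) ∩ adj G v ] λ w → paths G z k w (U ∖ z ∖ w))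
    ≡⟨ ≡-sym (Σ-+ (U ∩ adj G x) _ _) ⟩
  (Σ[ U ∩ adj G x ] λ z → paths G z (suc k) v (U ∖ z)) ∎)
  where
  open ≡-Reasoning
  -- Stated for two ends `p` and `q`, so that exchanging `v` and `x` yields the converse.
  half : ∀ p q i j → (U i ∧ adj G p i) ∧ ((U ∖ i) j ∧ adj G q j) ≡ true →
         (U j ∧ adj G q j) ∧ ((U ∖ j) i ∧ adj G p i) ≡ true
  half p q i j e =
    let ij = ∧-fst {U i ∧ adj G p i} e ; r = ∧-snd {U i ∧ adj G p i} e
        u = ∧-fst {(U ∖ i) j} r
    in ∧-intro (∧-intro (∖-⊆ U u) (∧-snd {(U ∖ i) j} r))
       (∧-intro (∖-in U (∧-fst {U i} ij) (λ eq → ∖-≢ U u (≡-sym eq))) (∧-snd {U i} ij))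
  aux : ∀ i j → (U i ∧ adj G v i) ∧ ((U ∖ i) j ∧ adj G x j) ≡ (U j ∧ adj G x j) ∧ ((U ∖ j) i ∧ adj G v i)
  aux i j = bool-ext (half v x i j) (half x v j i)

-- The continuations beyond `w` with at least one more interior vertex, kept apart from the paths
-- that go from `w` straight to `z`.
inner : SimpleGraph n → Fin n → ℕ → Fin n → VSet n → ℕ
inner G z k w U = Σ[ (U ∖ w) ∩ adj G w ] λ w' → paths G z k w' (U ∖ w ∖ w')

-- An equality once `k` is at least 2. For smaller `k` the right-hand side only has additional
-- terms, and the truncated `k ∸ 2` does no harm.
paths-two-steps : (G : SimpleGraph n) (z : Fin n) (k : ℕ) (v : Fin n) (U : VSet n) →
  paths G z k v U ≤ ⟦ adj G v z ⟧ + (Σ[ U ∩ adj G v ] λ w → ⟦ adj G w z ⟧ + inner G z (k ∸ 2) w U)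
paths-two-steps G z zero          v U = m≤m+n _ _
paths-two-steps G z (suc zero)    v U = +-monoʳ-≤ ⟦ adj G v z ⟧ (Σ-mono (U ∩ adj G v) (λ _ _ → m≤m+n _ _))
paths-two-steps G z (suc (suc k)) v U = ≤-refl

paths-empty : (G : SimpleGraph n) (z : Fin n) (k : ℕ) (v : Fin n) (U : VSet n) → # U ≡ 0 →
              paths G z k v U ≡ ⟦ adj G v z ⟧
paths-empty G z zero    v U e = refl
paths-empty G z (suc k) v U e = trans (cong (⟦ adj G v z ⟧ +_)
  (Σ-zero (U ∩ adj G v) (n≤0⇒n≡0 (≤-trans (#-mono {U = U ∩ adj G v} {V = U} (λ i → ∧-fst {U i})) (≤-reflexive e))) _))
  (+-identityʳ _)

⟦⟧≤1 : ∀ b → ⟦ b ⟧ ≤ 1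
⟦⟧≤1 true  = ≤-refl
⟦⟧≤1 false = z≤n

no-triangle : (G : SimpleGraph n) → TriangleFree G → ∀ {a b c} →
              adj G a b ≡ true → adj G a c ≡ true → adj G b c ≡ false
no-triangle G tf {a} {b} {c} p q with adj G b c in e
... | false = refl
... | true  = ⊥-elim (tf (a , b , c , p , e , q))

adj-sym : (G : SimpleGraph n) → ∀ {a b} → adj G a b ≡ true → adj G b a ≡ true
adj-sym G {a} {b} e = trans (SimpleGraph.sym G b a) e

-- F s bounds the number of paths between two given vertices of a triangle-free graph through s others.
-- The general recurrence would allow F 4 = 10, too much for the final comparison when n is odd.
F : ℕ → ℕ
F 0 = 1
F 1 = 1
F 2 = 2
F 3 = 4
F 4 = 9
F (suc (suc (suc (suc (suc k))))) = ⌊ 5 + k /2⌋ * ⌈ 5 + k /2⌉ * F (suc (suc (suc k))) + ⌈ 5 + k /2⌉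

-- Lowering both factors by one lowers the product by the sum of the new factors plus one. Floor and
-- ceiling have the same sum, so the gap between the two sides does not change.
product≤ : ∀ a b s → a + b ≡ s → a * b ≤ ⌊ s /2⌋ * ⌈ s /2⌉
product≤ zero    b       s e = z≤n
product≤ (suc a) zero    s e = ≤-trans (≤-reflexive (*-zeroʳ a)) z≤n
product≤ (suc a) (suc b) s e with trans (cong suc (≡-sym (+-suc a b))) e
... | refl = begin
  suc a * suc b                              ≡⟨ expand a b ⟩
  a * b + suc (a + b)                        ≤⟨ +-monoˡ-≤ _ (product≤ a b (a + b) refl) ⟩
  ⌊ s′ /2⌋ * ⌈ s′ /2⌉ + suc s′               ≡⟨ cong (λ t → ⌊ s′ /2⌋ * ⌈ s′ /2⌉ + suc t) (≡-sym (⌊n/2⌋+⌈n/2⌉≡n s′)) ⟩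
  ⌊ s′ /2⌋ * ⌈ s′ /2⌉ + suc (⌊ s′ /2⌋ + ⌈ s′ /2⌉)  ≡⟨ ≡-sym (expand ⌊ s′ /2⌋ ⌈ s′ /2⌉) ⟩
  suc ⌊ s′ /2⌋ * suc ⌈ s′ /2⌉                ∎
  where
  open ≤-Reasoning
  s′ = a + b
  expand : ∀ x y → suc x * suc y ≡ x * y + suc (x + y)
  expand = solve-∀

-- With `f = suc g` the left-hand side is `a * b * g + a * suc b`: two products with factor sums `s`
-- and `suc s`, both maximal for `a` the ceiling and `b` the floor of half of `s`.
branch-bound : ∀ a b s f → a + b ≡ s → 1 ≤ f → a * (b * f) + a ≤ ⌊ s /2⌋ * ⌈ s /2⌉ * f + ⌈ s /2⌉
branch-bound a b s (suc g) e _ = begin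
  a * (b * suc g) + a                          ≡⟨ regroup a b g ⟩
  a * b * g + a * suc b                        ≤⟨ +-mono-≤ (*-monoˡ-≤ g (product≤ a b s e))
                                                    (product≤ a (suc b) (suc s) (trans (+-suc a b) (cong suc e))) ⟩
  ⌊ s /2⌋ * ⌈ s /2⌉ * g + ⌈ s /2⌉ * suc ⌊ s /2⌋  ≡⟨ ≡-sym (regroup′ ⌊ s /2⌋ ⌈ s /2⌉ g) ⟩
  ⌊ s /2⌋ * ⌈ s /2⌉ * suc g + ⌈ s /2⌉          ∎
  where
  open ≤-Reasoning
  regroup : ∀ a b g → a * (b * suc g) + a ≡ a * b * g + a * suc b
  regroup = solve-∀
  regroup′ : ∀ h c g → h * c * suc g + c ≡ h * c * g + c * suc h
  regroup′ = solve-∀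

1≤F : ∀ k → 1 ≤ F k
1≤F 0 = s≤s z≤n
1≤F 1 = s≤s z≤n
1≤F 2 = s≤s z≤n
1≤F 3 = s≤s z≤n
1≤F 4 = s≤s z≤n
1≤F (suc (suc (suc (suc (suc k))))) = ≤-trans (s≤s z≤n) (m≤n+m ⌈ 5 + k /2⌉ _)

module _ (G : SimpleGraph n) (tf : TriangleFree G) (z : Fin n) where

  private
    -- Otherwise `v`, one of its neighbours and `z` would form a triangle.
    end-or-middle : ∀ v (U : VSet n) → adj G v z ≡ true → # (U ∩ adj G v ∩ (λ w → adj G w z)) ≡ 0
    end-or-middle v U e = n≤0⇒n≡0 (≮⇒≥ λ l → let (w , p) = #-pos _ l in
      true≢false (∧-snd {(U ∩ adj G v) w} p)
        (no-triangle G tf (∧-snd {U w} (∧-fst {(U ∩ adj G v) w} p)) e))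

  nbrs-in : Fin n → VSet n → ℕ
  nbrs-in v U = # (U ∩ adj G v)

  others-in : Fin n → VSet n → ℕ
  others-in v U = # (U ∩ (not ∘ adj G v))

  nbrs+others : ∀ v U → nbrs-in v U + others-in v U ≡ # U
  nbrs+others v U = ≡-sym (#-split U (adj G v))

  -- A common neighbour of `v` and `w` would close a triangle. This is the source of the product of
  -- `nbrs-in` and `others-in`, and so of the quarter of a square in `F`.
  second-nbrs≤ : ∀ v w (U : VSet n) → adj G v w ≡ true → # ((U ∖ w) ∩ adj G w) ≤ others-in v U
  second-nbrs≤ v w U e = #-mono λ i p → ∧-intro (∖-⊆ U (∧-fst {(U ∖ w) i} p))
    (not-true (no-triangle G tf (adj-sym G e) (∧-snd {(U ∖ w) i} p)))

  -- The paths with at most one interior vertex.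
  ends : Fin n → VSet n → ℕ
  ends v U = ⟦ adj G v z ⟧ + # (U ∩ adj G v ∩ (λ w → adj G w z))

  -- If `v` is adjacent to `z`, the edge between them is the only such path, and the hypothesis pays
  -- for it; otherwise each such path uses its own neighbour of `v`.
  ends≤ : ∀ v U → 1 ≤ nbrs-in v U → ends v U ≤ nbrs-in v U
  ends≤ v U l with adj G v z in e
  ... | true  rewrite end-or-middle v U e = l
  ... | false = #-mono λ i → ∧-fst {(U ∩ adj G v) i}

  ends-true : ∀ v U → adj G v z ≡ true → ends v U ≡ 1
  ends-true v U e rewrite end-or-middle v U e | e = refl

  inner≤ : ∀ k v w (U : VSet n) c → adj G v w ≡ true →
    (∀ w' → (U ∖ w) w' ≡ true → paths G z k w' (U ∖ w ∖ w') ≤ c) →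
    inner G z k w U ≤ others-in v U * c
  inner≤ k v w U c e h = ≤-trans (Σ-≤-const ((U ∖ w) ∩ adj G w) (λ i p → h i (∧-fst {(U ∖ w) i} p)))
    (*-monoˡ-≤ c (second-nbrs≤ v w U e))

  paths≤ends+inner : ∀ k v (U : VSet n) → paths G z k v U ≤ ends v U + (Σ[ U ∩ adj G v ] λ w → inner G z (k ∸ 2) w U)
  paths≤ends+inner k v U = begin
    paths G z k v U
      ≤⟨ paths-two-steps G z k v U ⟩
    ⟦ adj G v z ⟧ + (Σ[ A ] λ w → ⟦ adj G w z ⟧ + inner G z (k ∸ 2) w U)
      ≡⟨ cong (⟦ adj G v z ⟧ +_) (Σ-+ A _ _) ⟩
    ⟦ adj G v z ⟧ + ((Σ[ A ] λ w → ⟦ adj G w z ⟧) + (Σ[ A ] λ w → inner G z (k ∸ 2) w U))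
      ≡⟨ cong (λ t → ⟦ adj G v z ⟧ + (t + (Σ[ A ] λ w → inner G z (k ∸ 2) w U))) (Σ-⟦⟧ A (λ w → adj G w z)) ⟩
    ⟦ adj G v z ⟧ + (# (A ∩ (λ w → adj G w z)) + (Σ[ A ] λ w → inner G z (k ∸ 2) w U))
      ≡⟨ ≡-sym (+-assoc ⟦ adj G v z ⟧ _ _) ⟩
    ends v U + (Σ[ A ] λ w → inner G z (k ∸ 2) w U) ∎
    where
    open ≤-Reasoning
    A = U ∩ adj G v

  paths≤ends : ∀ k v (U : VSet n) c →
    (∀ w w' → U w ≡ true → (U ∖ w) w' ≡ true → paths G z (k ∸ 2) w' (U ∖ w ∖ w') ≤ c) →
    paths G z k v U ≤ ends v U + nbrs-in v U * (others-in v U * c)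
  paths≤ends k v U c h = ≤-trans (paths≤ends+inner k v U) (+-monoʳ-≤ (ends v U)
    (Σ-≤-const (U ∩ adj G v) λ w p →
      inner≤ (k ∸ 2) v w U c (∧-snd {U w} p) (λ w' q → h w w' (∧-fst {U w} p) q)))

  private
    no-nbrs : ∀ k v (U : VSet n) → nbrs-in v U ≡ 0 → paths G z k v U ≤ 1
    no-nbrs zero    v U e = ⟦⟧≤1 (adj G v z)
    no-nbrs (suc k) v U e = ≤-trans (≤-reflexive (trans (cong (⟦ adj G v z ⟧ +_) (Σ-zero (U ∩ adj G v) e _)) (+-identityʳ _)))
                              (⟦⟧≤1 (adj G v z))

  -- With `a` neighbours and `b` others of `v` in `U`, there are at most `a * b` choices for the
  -- next two vertices and at most `a` paths ending earlier; `branch-bound` removes the dependence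
  -- on `a`.
  paths-step : ∀ k v (U : VSet n) s f → # U ≡ s → 1 ≤ s → 1 ≤ f →
    (∀ w w' → U w ≡ true → (U ∖ w) w' ≡ true → paths G z (k ∸ 2) w' (U ∖ w ∖ w') ≤ f) →
    paths G z k v U ≤ ⌊ s /2⌋ * ⌈ s /2⌉ * f + ⌈ s /2⌉
  paths-step k v U s@(suc s′) f e _ 1≤f h with nbrs-in v U in a≡
  -- Without neighbours the edge from `v` to `z` may still be present, which `ends≤` does not cover;
  -- the ceiling is at least 1.
  ... | zero = ≤-trans (no-nbrs k v U a≡) (≤-trans (s≤s z≤n) (m≤n+m ⌈ s /2⌉ _))
  ... | suc a = begin
    paths G z k v U
      ≤⟨ paths≤ends k v U f h ⟩
    ends v U + nbrs-in v U * (others-in v U * f)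
      ≤⟨ +-monoˡ-≤ _ (ends≤ v U (≤-trans (s≤s z≤n) (≤-reflexive (≡-sym a≡)))) ⟩
    nbrs-in v U + nbrs-in v U * (others-in v U * f)
      ≡⟨ +-comm (nbrs-in v U) _ ⟩
    nbrs-in v U * (others-in v U * f) + nbrs-in v U
      ≤⟨ branch-bound (nbrs-in v U) (others-in v U) s f (trans (nbrs+others v U) e) 1≤f ⟩
    ⌊ s /2⌋ * ⌈ s /2⌉ * f + ⌈ s /2⌉ ∎
    where open ≤-Reasoning

  #-remove₂ : (U : VSet n) {k : ℕ} → # U ≡ suc (suc k) → ∀ w w' → U w ≡ true → (U ∖ w) w' ≡ true → # (U ∖ w ∖ w') ≡ k
  #-remove₂ U e w w' p q = #-remove′ (U ∖ w) q (#-remove′ U p e)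

  paths≤F₁ : ∀ k v (U : VSet n) → # U ≡ 1 → paths G z k v U ≤ 1
  paths≤F₁ k v U e = paths-step k v U 1 1 e ≤-refl ≤-refl
    λ w w' p q → contradiction (trans (≡-sym (#-remove (U ∖ w) q)) (#-remove′ U p e)) λ ()

  paths≤F₂ : ∀ k v (U : VSet n) → # U ≡ 2 → paths G z k v U ≤ 2
  paths≤F₂ k v U e = paths-step k v U 2 1 e (s≤s z≤n) ≤-refl λ w w' p q →
    ≤-trans (≤-reflexive (paths-empty G z (k ∸ 2) w' _ (#-remove₂ U e w w' p q))) (⟦⟧≤1 (adj G w' z))

  paths≤F₃ : ∀ k v (U : VSet n) → # U ≡ 3 → paths G z k v U ≤ 4
  paths≤F₃ k v U e = paths-step k v U 3 1 e (s≤s z≤n) ≤-refl λ w w' p q →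
    paths≤F₁ (k ∸ 2) w' _ (#-remove₂ U e w w' p q)

  -- Two paths through a pair U from a vertex v not adjacent to z would need all of U adjacent to z.
  paths≤1 : ∀ k v u (U : VSet n) → # U ≡ 2 → adj G v z ≡ false → U u ≡ true → adj G u z ≡ false →
    paths G z k v U ≤ 1
  paths≤1 k v u U e vz Uu uz = begin
    paths G z k v U
      ≤⟨ paths-two-steps G z k v U ⟩
    ⟦ adj G v z ⟧ + (Σ[ A ] λ w → ⟦ adj G w z ⟧ + inner G z (k ∸ 2) w U)
      ≡⟨ cong (λ b → ⟦ b ⟧ + (Σ[ A ] λ w → ⟦ adj G w z ⟧ + inner G z (k ∸ 2) w U)) vz ⟩
    (Σ[ A ] λ w → ⟦ adj G w z ⟧ + inner G z (k ∸ 2) w U)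
      ≤⟨ case-split (nbrs-in v U) (others-in v U) refl refl (trans (nbrs+others v U) e) ⟩
    1 ∎
    where
    open ≤-Reasoning
    A = U ∩ adj G v
    inner≤1 : ∀ w → A w ≡ true → inner G z (k ∸ 2) w U ≤ others-in v U * 1
    inner≤1 w p = inner≤ (k ∸ 2) v w U 1 (∧-snd {U w} p) λ w' q →
      ≤-trans (≤-reflexive (paths-empty G z (k ∸ 2) w' _ (#-remove₂ U e w w' (∧-fst {U w} p) q))) (⟦⟧≤1 (adj G w' z))
    inner-zero : ∀ w → A w ≡ true → adj G w z ≡ true → inner G z (k ∸ 2) w U ≤ 0
    inner-zero w p wz = ≤-trans (Σ-≤-const ((U ∖ w) ∩ adj G w) λ w' q → ≤-reflexive
        (trans (paths-empty G z (k ∸ 2) w' _ (#-remove₂ U e w w' (∧-fst {U w} p) (∧-fst {(U ∖ w) w'} q)))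
               (cong ⟦_⟧ (no-triangle G tf (∧-snd {(U ∖ w) w'} q) wz))))
      (≤-reflexive (*-zeroʳ (# ((U ∖ w) ∩ adj G w))))
    -- A vertex adjacent to `z` ends the path but, by `inner-zero`, has no continuation; any other
    -- vertex has at most one continuation.
    term≤1 : others-in v U ≡ 1 → ∀ w → A w ≡ true → ⟦ adj G w z ⟧ + inner G z (k ∸ 2) w U ≤ 1
    term≤1 b≡ w p with adj G w z in wz
    ... | true  = s≤s (inner-zero w p wz)
    ... | false = ≤-trans (inner≤1 w p) (≤-reflexive (cong (_* 1) b≡))
    case-split : ∀ a b → nbrs-in v U ≡ a → others-in v U ≡ b → a + b ≡ 2 →
      (Σ[ A ] λ w → ⟦ adj G w z ⟧ + inner G z (k ∸ 2) w U) ≤ 1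
    case-split 0 b a≡ b≡ s = ≤-trans (≤-reflexive (Σ-zero A a≡ _)) z≤n
    case-split 1 1 a≡ b≡ s = ≤-trans (Σ-≤-const A (term≤1 b≡)) (≤-reflexive (cong (_* 1) a≡))
    -- No vertex remains outside the neighbourhood of `v`, so every path ends after one interior
    -- vertex, and this cannot be `u`.
    case-split 2 0 a≡ b≡ s = begin
      (Σ[ A ] λ w → ⟦ adj G w z ⟧ + inner G z (k ∸ 2) w U)
        ≤⟨ Σ-mono A (λ w p → ≤-trans (+-monoʳ-≤ ⟦ adj G w z ⟧ (≤-trans (inner≤1 w p) (≤-reflexive (cong (_* 1) b≡))))
                                     (≤-reflexive (+-identityʳ _))) ⟩
      (Σ[ A ] λ w → ⟦ adj G w z ⟧)
        ≡⟨ Σ-⟦⟧ A (λ w → adj G w z) ⟩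
      # (A ∩ (λ w → adj G w z))
        ≤⟨ #-mono (λ i p → ∖-in U (∧-fst {U i} (∧-fst {A i} p))
             (λ i≡u → true≢false (∧-snd {A i} p) (subst (λ t → adj G t z ≡ false) (≡-sym i≡u) uz))) ⟩
      # (U ∖ u)
        ≡⟨ #-remove′ U Uu e ⟩
      1 ∎
    case-split 1 0 a≡ b≡ ()
    case-split 1 (suc (suc b)) a≡ b≡ ()
    case-split 2 (suc b) a≡ b≡ ()
    case-split (suc (suc (suc a))) b a≡ b≡ ()

  private
    -- Two neighbours of w, besides w itself adjacent to z, are both non-adjacent to z.
    inner≤2 : ∀ k w (U : VSet n) → # U ≡ 4 → U w ≡ true → adj G w z ≡ true →
      ∀ c → # ((U ∖ w) ∩ adj G w) ≡ c → c ≤ 2 → inner G z k w U ≤ 2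
    inner≤2 k w U e p wz 0 c≡ _ = ≤-trans (≤-reflexive (Σ-zero _ c≡ _)) z≤n
    inner≤2 k w U e p wz 1 c≡ _ = ≤-trans (Σ-≤-const ((U ∖ w) ∩ adj G w) λ w' q →
        paths≤F₂ k w' _ (#-remove₂ U e w w' p (∧-fst {(U ∖ w) w'} q)))
      (≤-reflexive (cong (_* 2) c≡))
    inner≤2 k w U e p wz 2 c≡ _ = ≤-trans (Σ-≤-const B λ w' q →
        let (u , r) = #-pos (B ∖ w') (≤-reflexive (≡-sym (#-remove′ B q c≡)))
            Bu = ∖-⊆ B r
        in paths≤1 k w' u _ (#-remove₂ U e w w' p (∧-fst {(U ∖ w) w'} q))
             (no-triangle G tf (∧-snd {(U ∖ w) w'} q) wz)
             (∖-in (U ∖ w) (∧-fst {(U ∖ w) u} Bu) (∖-≢ B r))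
             (no-triangle G tf (∧-snd {(U ∖ w) u} Bu) wz))
      (≤-reflexive (cong (_* 1) c≡))
      where B = (U ∖ w) ∩ adj G w
    inner≤2 k w U e p wz (suc (suc (suc c))) c≡ (s≤s (s≤s ()))

  -- The general count exceeds 9 only for two neighbours and two others of `v`, with `v` not
  -- adjacent to `z` but both neighbours adjacent to it. Then each neighbour has at most 2
  -- continuations by `inner≤2`, and the total is at most 2 + 2 * 2.
  paths≤F₄ : ∀ k v (U : VSet n) → # U ≡ 4 → paths G z k v U ≤ 9
  paths≤F₄ k v U e = case-split (nbrs-in v U) (others-in v U) refl refl (trans (nbrs+others v U) e)
    where
    open ≤-Reasoning
    A = U ∩ adj G v
    s = # (A ∩ (λ w → adj G w z))
    bound : paths G z k v U ≤ ends v U + nbrs-in v U * (others-in v U * 2)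
    bound = paths≤ends k v U 2 λ w w' p q → paths≤F₂ (k ∸ 2) w' _ (#-remove₂ U e w w' p q)
    via : ∀ a b t → nbrs-in v U ≡ a → others-in v U ≡ b → ends v U ≤ t → paths G z k v U ≤ t + a * (b * 2)
    via a b t refl refl l = ≤-trans bound (+-monoˡ-≤ _ l)
    ends≤a : ∀ a → nbrs-in v U ≡ suc a → ends v U ≤ suc a
    ends≤a a a≡ = ≤-trans (ends≤ v U (≤-trans (s≤s z≤n) (≤-reflexive (≡-sym a≡)))) (≤-reflexive a≡)
    all-ends : others-in v U ≡ 2 → s ≡ nbrs-in v U → ∀ w → A w ≡ true → inner G z (k ∸ 2) w U ≤ 2
    all-ends b≡ s≡ w p = inner≤2 (k ∸ 2) w U e (∧-fst {U w} p) wz _ refl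
        (≤-trans (second-nbrs≤ v w U (∧-snd {U w} p)) (≤-reflexive b≡))
      where
      wz : adj G w z ≡ true
      wz with adj G w z in q
      ... | true = refl
      ... | false = contradiction (begin
        suc (nbrs-in v U)   ≡⟨ cong suc (≡-sym s≡) ⟩
        suc s               ≤⟨ s≤s (#-mono (λ i r → ∖-in A (∧-fst {A i} r)
                                 (λ i≡w → true≢false (∧-snd {A i} r) (subst (λ t → adj G t z ≡ false) (≡-sym i≡w) q)))) ⟩
        suc (# (A ∖ w))     ≡⟨ ≡-sym (#-remove A p) ⟩
        nbrs-in v U         ∎) (<⇒≱ ≤-refl)
    half-case : nbrs-in v U ≡ 2 → others-in v U ≡ 2 → ∀ b → adj G v z ≡ b → ∀ t → s ≡ t → paths G z k v U ≤ 9
    half-case a≡ b≡ true  vz t st = via 2 2 1 a≡ b≡ (≤-reflexive (ends-true v U vz))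
    half-case a≡ b≡ false vz 0 st = ≤-trans (via 2 2 0 a≡ b≡ (≤-reflexive (cong₂ _+_ (cong ⟦_⟧ vz) st))) (n≤1+n 8)
    half-case a≡ b≡ false vz 1 st = via 2 2 1 a≡ b≡ (≤-reflexive (cong₂ _+_ (cong ⟦_⟧ vz) st))
    half-case a≡ b≡ false vz 2 st = begin
      paths G z k v U
        ≤⟨ paths≤ends+inner k v U ⟩
      ends v U + (Σ[ A ] λ w → inner G z (k ∸ 2) w U)
        ≤⟨ +-mono-≤ (≤-reflexive (cong₂ _+_ (cong ⟦_⟧ vz) st)) (Σ-≤-const A (all-ends b≡ (trans st (≡-sym a≡)))) ⟩
      2 + # A * 2
        ≡⟨ cong (λ t → 2 + t * 2) a≡ ⟩
      6 ≤⟨ m≤m+n 6 3 ⟩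
      9 ∎
    half-case a≡ b≡ false vz (suc (suc (suc t))) st = contradiction
      (≤-trans (≤-reflexive (≡-sym st)) (≤-trans (#-mono (λ i → ∧-fst {A i})) (≤-reflexive a≡))) λ { (s≤s (s≤s ())) }
    case-split : ∀ a b → nbrs-in v U ≡ a → others-in v U ≡ b → a + b ≡ 4 → paths G z k v U ≤ 9
    case-split 0 b a≡ b≡ s = ≤-trans (no-nbrs k v U a≡) (s≤s z≤n)
    case-split 1 3 a≡ b≡ s = ≤-trans (via 1 3 1 a≡ b≡ (ends≤a 0 a≡)) (m≤m+n 7 2)
    case-split 2 2 a≡ b≡ s = half-case a≡ b≡ _ refl _ refl
    case-split 3 1 a≡ b≡ s = via 3 1 3 a≡ b≡ (ends≤a 2 a≡)
    case-split 4 0 a≡ b≡ s = ≤-trans (via 4 0 4 a≡ b≡ (ends≤a 3 a≡)) (m≤m+n 4 5)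
    case-split 1 (suc (suc (suc (suc b)))) a≡ b≡ ()
    case-split 2 (suc (suc (suc b))) a≡ b≡ ()
    case-split 3 (suc (suc b)) a≡ b≡ ()
    case-split 4 (suc b) a≡ b≡ ()
    case-split (suc (suc (suc (suc (suc a))))) b a≡ b≡ ()

  paths≤F : ∀ s k v (U : VSet n) → # U ≡ s → paths G z k v U ≤ F s
  paths≤F 0 k v U e = ≤-trans (≤-reflexive (paths-empty G z k v U e)) (⟦⟧≤1 (adj G v z))
  paths≤F 1 = paths≤F₁
  paths≤F 2 = paths≤F₂
  paths≤F 3 = paths≤F₃
  paths≤F 4 = paths≤F₄
  paths≤F (suc (suc (suc (suc (suc s))))) k v U e = paths-step k v U _ _ e (s≤s z≤n) (1≤F (3 + s)) λ w w' p q →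
    paths≤F (suc (suc (suc s))) (k ∸ 2) w' _ (#-remove₂ U e w w' p q)

-- Lists and enumerations

private
  variable
    A B : Set

∉⇒All : {x : A} {xs : List A} → x ∉ xs → All (x ≢_) xs
∉⇒All nx = All.tabulate λ y∈ x≡y → nx (subst (_∈ _) (≡-sym x≡y) y∈)

All⇒∉ : {x : A} {xs : List A} → All (x ≢_) xs → x ∉ xs
All⇒∉ a x∈ = All.lookup a x∈ refl

unique-length≤ : {xs : List A} (ys : List A) → Unique xs → (∀ {x} → x ∈ xs → x ∈ ys) → length xs ≤ length ys
unique-length≤ {xs = []}     ys _        _   = z≤n
unique-length≤ {xs = x ∷ xs} ys (a ∷ u) sub with ∈-∃++ (sub (here refl))
... | as , bs , refl = ≤-trans (s≤s (unique-length≤ (as ++ bs) u λ {y} y∈ → drop-mid y∈ (∈-++⁻ as (sub (there y∈)))))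
    (≤-reflexive (trans (cong suc (length-++ as)) (≡-sym (trans (length-++ as) (+-suc (length as) (length bs))))))
  where
  drop-mid : ∀ {y} → y ∈ xs → y ∈ as ⊎ y ∈ x ∷ bs → y ∈ as ++ bs
  drop-mid _  (inj₁ p)            = ∈-++⁺ˡ p
  drop-mid y∈ (inj₂ (here refl))  = ⊥-elim (All⇒∉ a y∈)
  drop-mid _  (inj₂ (there p))    = ∈-++⁺ʳ as p

∈-filterᵇ⁺ : (p : A → Bool) {xs : List A} {x : A} → x ∈ xs → p x ≡ true → x ∈ filterᵇ p xs
∈-filterᵇ⁺ p x∈ e = ∈-filter⁺ (T? ∘ p) x∈ (Equivalence.from T-≡ e)

∈-filterᵇ⁻ : (p : A → Bool) {xs : List A} {x : A} → x ∈ filterᵇ p xs → x ∈ xs × p x ≡ true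
∈-filterᵇ⁻ p {xs} x∈ = let (m , t) = ∈-filter⁻ (T? ∘ p) {xs = xs} x∈ in m , Equivalence.to T-≡ t

filterᵇ-split : (p q : A → Bool) (xs : List A) →
  length (filterᵇ p xs) ≡ length (filterᵇ (λ x → p x ∧ q x) xs) + length (filterᵇ (λ x → p x ∧ not (q x)) xs)
filterᵇ-split p q [] = refl
filterᵇ-split p q (x ∷ xs) with p x | q x
... | true  | true  = cong suc (filterᵇ-split p q xs)
... | true  | false = trans (cong suc (filterᵇ-split p q xs)) (≡-sym (+-suc _ _))
... | false | _     = filterᵇ-split p q xs

filterᵇ-cong : {p q : A → Bool} → (∀ x → p x ≡ q x) → (xs : List A) → length (filterᵇ p xs) ≡ length (filterᵇ q xs)
filterᵇ-cong e [] = refl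
filterᵇ-cong {p = p} {q} e (x ∷ xs) with p x | q x | e x
... | true  | .true  | refl = cong suc (filterᵇ-cong e xs)
... | false | .false | refl = filterᵇ-cong e xs

filterᵇ-mono : {p q : A → Bool} → (∀ x → p x ≡ true → q x ≡ true) → (xs : List A) →
  length (filterᵇ p xs) ≤ length (filterᵇ q xs)
filterᵇ-mono h [] = z≤n
filterᵇ-mono {p = p} {q} h (x ∷ xs) with p x in px | q x in qx
... | true  | true  = s≤s (filterᵇ-mono h xs)
... | true  | false = ⊥-elim (true≢false (h x px) qx)
... | false | true  = ≤-trans (filterᵇ-mono h xs) (n≤1+n _)
... | false | false = filterᵇ-mono h xs

filterᵇ-mono-< : {p q : A → Bool} → (∀ x → p x ≡ true → q x ≡ true) → (xs : List A) →
  ∀ {x} → x ∈ xs → q x ≡ true → ¬ (p x ≡ true) → length (filterᵇ p xs) < length (filterᵇ q xs)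
filterᵇ-mono-< {p = p} {q} h (x ∷ xs) (here refl) qx npx with p x | q x
... | true  | true  = ⊥-elim (npx refl)
... | false | true  = s≤s (filterᵇ-mono h xs)
filterᵇ-mono-< {p = p} {q} h (x ∷ xs) (there x∈) qy npy with p x in px | q x in qx
... | true  | true  = s≤s (filterᵇ-mono-< h xs x∈ qy npy)
... | true  | false = ⊥-elim (true≢false (h x px) qx)
... | false | true  = ≤-trans (filterᵇ-mono-< h xs x∈ qy npy) (n≤1+n _)
... | false | false = filterᵇ-mono-< h xs x∈ qy npy

-- One preimage `x` is chosen for each `y`, and `x` and `r x` are listed together. The resulting
-- list and `xs` have no repetitions and the same members, hence the same length.
two-to-one : (f : A → B) (r : A → A) (xs : List A) (ys : List B) → Unique xs → Unique ys →
  (∀ {x} → x ∈ xs → f x ∈ ys) → (∀ {y} → y ∈ ys → ∃[ x ] (x ∈ xs × f x ≡ y)) →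
  (∀ {x} → x ∈ xs → r x ∈ xs × f (r x) ≡ f x × r x ≢ x) →
  (∀ {x x'} → x ∈ xs → x' ∈ xs → f x ≡ f x' → x' ≡ x ⊎ x' ≡ r x) →
  length xs ≡ 2 * length ys
two-to-one {A} {B} f r xs ys ux uy into onto rev fib =
  let (zs , len , uz , z⊆ , ⊆z) = build ys uy onto
  in trans (≤-antisym (unique-length≤ zs ux (λ x∈ → ⊆z x∈ (into x∈))) (unique-length≤ xs uz (λ z∈ → proj₁ (z⊆ z∈)))) len
  where
  build : (ys : List B) → Unique ys → (∀ {y} → y ∈ ys → ∃[ x ] (x ∈ xs × f x ≡ y)) →
    ∃[ zs ] (length zs ≡ 2 * length ys × Unique zs × (∀ {z} → z ∈ zs → z ∈ xs × f z ∈ ys) ×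
             (∀ {z} → z ∈ xs → f z ∈ ys → z ∈ zs))
  build [] _ _ = [] , refl , [] , (λ ()) , λ _ ()
  build (y ∷ ys) (a ∷ u) onto with onto (here refl) | build ys u (onto ∘ there)
  ... | x , x∈ , refl | zs , len , uz , z⊆ , ⊆z =
      x ∷ r x ∷ zs ,
      trans (cong (2 +_) len) (≡-sym (*-distribˡ-+ 2 1 (length ys))) ,
      ((λ e → rx≢x (≡-sym e)) ∷ ∉⇒All (λ x∈zs → fx∉ (proj₂ (z⊆ x∈zs)))) ∷
        ∉⇒All (λ rx∈zs → fx∉ (subst (_∈ ys) frx (proj₂ (z⊆ rx∈zs)))) ∷ uz ,
      sub , sup
    where
    rx∈ = proj₁ (rev x∈)
    frx = proj₁ (proj₂ (rev x∈))
    rx≢x = proj₂ (proj₂ (rev x∈))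
    fx∉ : f x ∉ ys
    fx∉ = All⇒∉ a
    sub : ∀ {z} → z ∈ x ∷ r x ∷ zs → z ∈ xs × f z ∈ f x ∷ ys
    sub (here refl)         = x∈ , here refl
    sub (there (here refl)) = rx∈ , here frx
    sub (there (there z∈))  = proj₁ (z⊆ z∈) , there (proj₂ (z⊆ z∈))
    sup : ∀ {z} → z ∈ xs → f z ∈ f x ∷ ys → z ∈ x ∷ r x ∷ zs
    sup z∈ (there p) = there (there (⊆z z∈ p))
    sup z∈ (here e) with fib x∈ z∈ (≡-sym e)
    ... | inj₁ refl = here refl
    ... | inj₂ refl = there (here refl)

any⁺ : (p : A → Bool) {xs : List A} {x : A} → x ∈ xs → p x ≡ true → any p xs ≡ true
any⁺ p (here refl) e rewrite e = refl
any⁺ p {y ∷ ys} (there x∈) e = trans (cong (p y ∨_) (any⁺ p x∈ e)) (∨-zeroʳ (p y))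

any⁻ : (p : A → Bool) (xs : List A) → any p xs ≡ true → ∃[ x ] (x ∈ xs × p x ≡ true)
any⁻ p (x ∷ xs) e with p x in q
... | true  = x , here refl , q
... | false = let (y , y∈ , py) = any⁻ p xs e in y , there y∈ , py

all⁺ : (p : A → Bool) (xs : List A) → (∀ {x} → x ∈ xs → p x ≡ true) → all p xs ≡ true
all⁺ p []       h = refl
all⁺ p (x ∷ xs) h = ∧-intro (h (here refl)) (all⁺ p xs (h ∘ there))

all⁻ : (p : A → Bool) {xs : List A} → all p xs ≡ true → ∀ {x} → x ∈ xs → p x ≡ true
all⁻ p {x ∷ xs} e (here refl) = ∧-fst e
all⁻ p {x ∷ xs} e (there y∈)  = all⁻ p (∧-snd {p x} e) y∈

allPairsB⁺ : (p : Fin n → Fin n → Bool) → (∀ i j → p i j ≡ true) → allPairsB p ≡ true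
allPairsB⁺ {n} p h = all⁺ _ (allFin n) λ {i} _ → all⁺ _ (allFin n) λ {j} _ → h i j

allPairsB⁻ : (p : Fin n → Fin n → Bool) → allPairsB p ≡ true → ∀ i j → p i j ≡ true
allPairsB⁻ {n} p e i j = all⁻ (p i) (all⁻ (λ i → all (p i) (allFin n)) e (∈-allFin i)) (∈-allFin j)

∈-concatMap⁺ : (f : A → List B) {xs : List A} {x : A} {y : B} → x ∈ xs → y ∈ f x → y ∈ concatMap f xs
∈-concatMap⁺ f (here refl) y∈ = ∈-++⁺ˡ y∈
∈-concatMap⁺ f {x ∷ xs} (there x∈) y∈ = ∈-++⁺ʳ (f x) (∈-concatMap⁺ f x∈ y∈)

∈-concatMap⁻ : (f : A → List B) (xs : List A) {y : B} → y ∈ concatMap f xs → ∃[ x ] (x ∈ xs × y ∈ f x)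
∈-concatMap⁻ f (x ∷ xs) y∈ with ∈-++⁻ (f x) y∈
... | inj₁ p = x , here refl , p
... | inj₂ p = let (x' , x∈ , q) = ∈-concatMap⁻ f xs p in x' , there x∈ , q

unique-concatMap : (f : A → List B) {xs : List A} → Unique xs → (∀ x → Unique (f x)) →
  (∀ {x x' y} → y ∈ f x → y ∈ f x' → x ≡ x') → Unique (concatMap f xs)
unique-concatMap f []      uf d = []
unique-concatMap f {x ∷ xs} (a ∷ u) uf d = Unique.++⁺ (uf x) (unique-concatMap f u uf d) λ (p , q) →
  let (x' , x'∈ , q') = ∈-concatMap⁻ f xs q in All⇒∉ a (subst (_∈ xs) (≡-sym (d p q')) x'∈)

∈-allVecs : {xs : List A} {m : ℕ} (v : Vec A m) → (∀ i → lookup v i ∈ xs) → v ∈ allVecs m xs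
∈-allVecs []ᵥ       h = here refl
∈-allVecs (x ∷ᵥ v) h = ∈-concatMap⁺ _ (h zero) (∈-map⁺ (x ∷ᵥ_) (∈-allVecs v (h ∘ suc)))

unique-allVecs : {xs : List A} → Unique xs → (m : ℕ) → Unique (allVecs m xs)
unique-allVecs u zero    = [] ∷ []
unique-allVecs u (suc m) = unique-concatMap _ u
  (λ x → Unique.map⁺ (proj₂ ∘ ∷-injective) (unique-allVecs u m))
  λ p q → same-head (∈-map⁻ _ p) (∈-map⁻ _ q)
  where
  same-head : ∀ {x x' y} {vs ws : List (Vec _ m)} → ∃[ v ] (v ∈ vs × y ≡ x ∷ᵥ v) → ∃[ w ] (w ∈ ws × y ≡ x' ∷ᵥ w) → x ≡ x'
  same-head (_ , _ , refl) (_ , _ , e) = proj₁ (∷-injective e)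

∈-allMatrices : (H : Matrix n) → H ∈ allMatrices n
∈-allMatrices H = ∈-allVecs H λ i → ∈-allVecs (lookup H i) λ j → bool∈ (lookup (lookup H i) j)
  where
  bool∈ : ∀ b → b ∈ true ∷ false ∷ []
  bool∈ true  = here refl
  bool∈ false = there (here refl)

unique-allMatrices : ∀ n → Unique (allMatrices n)
unique-allMatrices n = unique-allVecs (unique-allVecs (((λ ()) ∷ []) ∷ [] ∷ []) n) n

∈-allLists : {xs : List A} (l : List A) → (∀ {x} → x ∈ l → x ∈ xs) → l ∈ allLists (length l) xs
∈-allLists []      h = here refl
∈-allLists (x ∷ l) h = ∈-concatMap⁺ _ (h (here refl)) (∈-map⁺ (x ∷_) (∈-allLists l (h ∘ there)))

allLists-length : {xs : List A} (m : ℕ) {l : List A} → l ∈ allLists m xs → length l ≡ m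
allLists-length zero (here refl) = refl
allLists-length {xs = xs} (suc m) l∈ with ∈-concatMap⁻ _ xs l∈
... | x , _ , p with ∈-map⁻ (x ∷_) p
...   | l' , q , refl = cong suc (allLists-length m q)

vec-ext : {m : ℕ} {v w : Vec A m} → (∀ i → lookup v i ≡ lookup w i) → v ≡ w
vec-ext {v = []ᵥ}      {[]ᵥ}      h = refl
vec-ext {v = x ∷ᵥ v} {y ∷ᵥ w} h = cong₂ _∷ᵥ_ (h zero) (vec-ext (h ∘ suc))

matrix-ext : {H K : Matrix n} → (∀ i j → entry H i j ≡ entry K i j) → H ≡ K
matrix-ext h = vec-ext λ i → vec-ext λ j → h i j

distinctB⁻ : (l : List (Fin n)) → distinctB l ≡ true → Unique l
distinctB⁻ []      _ = []
distinctB⁻ (x ∷ l) e = ∉⇒All (λ x∈ → true≢false (any⁺ (eqF x) x∈ (eqF-refl x)) (not-true⁻ (∧-fst e)))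
  ∷ distinctB⁻ l (∧-snd {not (any (eqF x) l)} e)

distinctB⁺ : {l : List (Fin n)} → Unique l → distinctB l ≡ true
distinctB⁺ [] = refl
distinctB⁺ {l = x ∷ l} (a ∷ u) = ∧-intro (not-true none) (distinctB⁺ u)
  where
  none : any (eqF x) l ≡ false
  none with any (eqF x) l in e
  ... | false = refl
  ... | true  = let (y , y∈ , p) = any⁻ (eqF x) l e in
    ⊥-elim (All⇒∉ a (subst (_∈ l) (≡-sym (eqF-true p)) y∈))

-- Cycles as vertex sequences

EdgeIn : List (A × A) → A → A → Set
EdgeIn ps i j = (i , j) ∈ ps ⊎ (j , i) ∈ ps

cycAdj⁻ : (vs : List (Fin n)) {i j : Fin n} → cycAdj vs i j ≡ true → EdgeIn (cycPairs vs) i j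
cycAdj⁻ vs {i} {j} e with any⁻ _ (cycPairs vs) e
... | (a , b) , p∈ , q with eqF a i in ai | eqF b j in bj | eqF a j in aj | eqF b i in bi
...   | true  | true  | _    | _    = inj₁ (subst (_∈ cycPairs vs) (cong₂ _,_ (eqF-true ai) (eqF-true bj)) p∈)
...   | true  | false | true | true = inj₂ (subst (_∈ cycPairs vs) (cong₂ _,_ (eqF-true aj) (eqF-true bi)) p∈)
...   | false | _     | true | true = inj₂ (subst (_∈ cycPairs vs) (cong₂ _,_ (eqF-true aj) (eqF-true bi)) p∈)

cycAdj⁺ : (vs : List (Fin n)) {i j : Fin n} → EdgeIn (cycPairs vs) i j → cycAdj vs i j ≡ true
cycAdj⁺ vs {i} {j} (inj₁ p) = any⁺ _ p (subst (λ b → b ∨ (eqF i j ∧ eqF j i) ≡ true)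
  (≡-sym (∧-intro (eqF-refl i) (eqF-refl j))) refl)
cycAdj⁺ vs {i} {j} (inj₂ p) = any⁺ _ p (trans (∨-comm _ (eqF j j ∧ eqF i i)) (subst (λ b → b ∨ (eqF j i ∧ eqF i j) ≡ true)
  (≡-sym (∧-intro (eqF-refl j) (eqF-refl i))) refl))

cycAdj-cong : (vs ws : List (Fin n)) → (∀ {i j} → EdgeIn (cycPairs vs) i j → EdgeIn (cycPairs ws) i j) →
  (∀ {i j} → EdgeIn (cycPairs ws) i j → EdgeIn (cycPairs vs) i j) → ∀ i j → cycAdj vs i j ≡ cycAdj ws i j
cycAdj-cong vs ws f g i j = bool-ext (cycAdj⁺ ws ∘ f ∘ cycAdj⁻ vs) (cycAdj⁺ vs ∘ g ∘ cycAdj⁻ ws)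

pairs-split : {q : List A} {i j : A} → (i , j) ∈ pairs q → ∃[ as ] ∃[ bs ] q ≡ as ++ i ∷ j ∷ bs
pairs-split {q = x ∷ y ∷ q} (here refl) = [] , q , refl
pairs-split {q = x ∷ y ∷ q} (there p) = let (as , bs , e) = pairs-split p in x ∷ as , bs , cong (x ∷_) e

pairs-mid : (as : List A) {i j : A} {bs : List A} → (i , j) ∈ pairs (as ++ i ∷ j ∷ bs)
pairs-mid []           = here refl
pairs-mid (a ∷ [])     = there (here refl)
pairs-mid (a ∷ b ∷ as) = there (pairs-mid (b ∷ as))

pairs-fst∈ : (q : List A) {i j : A} → (i , j) ∈ pairs q → i ∈ q
pairs-fst∈ (x ∷ y ∷ q) (here refl) = here refl
pairs-fst∈ (x ∷ y ∷ q) (there p)   = there (pairs-fst∈ (y ∷ q) p)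

pairs-snd∈ : (x : A) (q : List A) {i j : A} → (i , j) ∈ pairs (x ∷ q) → j ∈ q
pairs-snd∈ x (y ∷ q) (here refl) = here refl
pairs-snd∈ x (y ∷ q) (there p)   = there (pairs-snd∈ y q p)

pairs-fst∈-∷ʳ : (q : List A) {x i j : A} → (i , j) ∈ pairs (q ∷ʳ x) → i ∈ q
pairs-fst∈-∷ʳ (a ∷ [])    (here refl) = here refl
pairs-fst∈-∷ʳ (a ∷ b ∷ q) (here refl) = here refl
pairs-fst∈-∷ʳ (a ∷ b ∷ q) (there p)   = there (pairs-fst∈-∷ʳ (b ∷ q) p)

edge-ends∈ : (x : A) (q : List A) {i j : A} → EdgeIn (pairs (x ∷ q)) i j → i ∈ x ∷ q
edge-ends∈ x q (inj₁ p) = pairs-fst∈ (x ∷ q) p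
edge-ends∈ x q (inj₂ p) = there (pairs-snd∈ x q p)

pairs-∷ʳ : (s : List A) (u x : A) → pairs (s ++ u ∷ x ∷ []) ≡ pairs (s ∷ʳ u) ∷ʳ (u , x)
pairs-∷ʳ []          u x = refl
pairs-∷ʳ (a ∷ [])    u x = refl
pairs-∷ʳ (a ∷ b ∷ s) u x = cong ((a , b) ∷_) (pairs-∷ʳ (b ∷ s) u x)

pairs-reverse : {q : List A} {i j : A} → (i , j) ∈ pairs q → (j , i) ∈ pairs (reverse q)
pairs-reverse {i = i} {j} p with pairs-split p
... | as , bs , refl = subst (λ l → (j , i) ∈ pairs l) (≡-sym eq) (pairs-mid (reverse bs))
  where
  eq : reverse (as ++ i ∷ j ∷ bs) ≡ reverse bs ++ j ∷ i ∷ reverse as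
  eq = begin
    reverse (as ++ i ∷ j ∷ bs)              ≡⟨ reverse-++ as (i ∷ j ∷ bs) ⟩
    reverse (i ∷ j ∷ bs) ++ reverse as      ≡⟨ cong (_++ reverse as) (trans (unfold-reverse i (j ∷ bs)) (cong (_∷ʳ i) (unfold-reverse j bs))) ⟩
    ((reverse bs ∷ʳ j) ∷ʳ i) ++ reverse as  ≡⟨ ++-assoc (reverse bs ∷ʳ j) [ i ] (reverse as) ⟩
    (reverse bs ∷ʳ j) ++ i ∷ reverse as     ≡⟨ ++-assoc (reverse bs) [ j ] (i ∷ reverse as) ⟩
    reverse bs ++ j ∷ i ∷ reverse as        ∎
    where open ≡-Reasoning

reverse-closed : (x : A) (l : List A) → reverse (x ∷ l ∷ʳ x) ≡ x ∷ reverse l ∷ʳ x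
reverse-closed x l = trans (unfold-reverse x (l ∷ʳ x)) (cong (_∷ʳ x) (reverse-++ l [ x ]))

edge-reverse : (x : A) (l : List A) {i j : A} → EdgeIn (cycPairs (x ∷ l)) i j → EdgeIn (cycPairs (x ∷ reverse l)) i j
edge-reverse x l (inj₁ p) = inj₂ (subst (λ q → _ ∈ pairs q) (reverse-closed x l) (pairs-reverse p))
edge-reverse x l (inj₂ p) = inj₁ (subst (λ q → _ ∈ pairs q) (reverse-closed x l) (pairs-reverse p))

edge-reverse⁻ : (x : A) (l : List A) {i j : A} → EdgeIn (cycPairs (x ∷ reverse l)) i j → EdgeIn (cycPairs (x ∷ l)) i j
edge-reverse⁻ x l e = subst (λ k → EdgeIn (cycPairs (x ∷ k)) _ _) (reverse-involutive l) (edge-reverse x (reverse l) e)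

cycPairs-rotate : (a : A) (r : List A) {p : A × A} → p ∈ cycPairs (a ∷ r) → p ∈ cycPairs (r ∷ʳ a)
cycPairs-rotate a []      p = p
cycPairs-rotate a (b ∷ s) p = subst (_ ∈_) (≡-sym (trans (cong pairs (++-assoc (b ∷ s) [ a ] [ b ])) (pairs-∷ʳ (b ∷ s) a b))) (move p)
  where
  move : ∀ {p} → p ∈ (a , b) ∷ pairs (b ∷ s ∷ʳ a) → p ∈ pairs (b ∷ s ∷ʳ a) ∷ʳ (a , b)
  move (here refl) = ∈-++⁺ʳ (pairs (b ∷ s ∷ʳ a)) (here refl)
  move (there p)   = ∈-++⁺ˡ p

cycPairs-rotate⁻ : (a : A) (r : List A) {p : A × A} → p ∈ cycPairs (r ∷ʳ a) → p ∈ cycPairs (a ∷ r)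
cycPairs-rotate⁻ a []      p = p
cycPairs-rotate⁻ a (b ∷ s) p = move (∈-++⁻ (pairs (b ∷ s ∷ʳ a))
    (subst (_ ∈_) (trans (cong pairs (++-assoc (b ∷ s) [ a ] [ b ])) (pairs-∷ʳ (b ∷ s) a b)) p))
  where
  move : ∀ {p} → p ∈ pairs (b ∷ s ∷ʳ a) ⊎ p ∈ [ a , b ] → p ∈ (a , b) ∷ pairs (b ∷ s ∷ʳ a)
  move (inj₁ p)           = there p
  move (inj₂ (here refl)) = here refl

unique-rotate : {a : A} {r : List A} → Unique (a ∷ r) → Unique (r ∷ʳ a)
unique-rotate (a ∷ u) = Unique.++⁺ u ([] ∷ []) λ { (p , here refl) → All⇒∉ a p }

record SameCycle (vs ws : List (Fin n)) : Set where
  field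
    same-length : length ws ≡ length vs
    same-unique : Unique vs → Unique ws
    same-edges  : ∀ i j → cycAdj ws i j ≡ cycAdj vs i j
open SameCycle public

-- Used to let the vertex list of a cycle start at a prescribed vertex. Each single rotation moves
-- the first vertex behind `bs`.
rotate-to : (as : List (Fin n)) (x : Fin n) (bs : List (Fin n)) → SameCycle (as ++ x ∷ bs) (x ∷ bs ++ as)
rotate-to []       x bs = record
  { same-length = cong (suc ∘ length) (++-identityʳ bs)
  ; same-unique = subst (λ l → Unique (x ∷ l)) (≡-sym (++-identityʳ bs))
  ; same-edges  = λ i j → cong (λ l → cycAdj (x ∷ l) i j) (++-identityʳ bs) }
rotate-to (a ∷ as) x bs = record
  { same-length = trans len (trans (same-length rec) (trans (cong length (≡-sym assoc₁)) (length-++-comm (as ++ x ∷ bs) [ a ])))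
  ; same-unique = λ u → subst Unique assoc₂ (same-unique rec (subst Unique assoc₁ (unique-rotate u)))
  ; same-edges  = λ i j → trans (cong (λ l → cycAdj l i j) (≡-sym assoc₂)) (trans (same-edges rec i j)
      (trans (cong (λ l → cycAdj l i j) (≡-sym assoc₁))
        (cycAdj-cong ((as ++ x ∷ bs) ∷ʳ a) (a ∷ as ++ x ∷ bs)
          (λ { (inj₁ p) → inj₁ (cycPairs-rotate⁻ a (as ++ x ∷ bs) p) ; (inj₂ p) → inj₂ (cycPairs-rotate⁻ a (as ++ x ∷ bs) p) })
          (λ { (inj₁ p) → inj₁ (cycPairs-rotate a (as ++ x ∷ bs) p) ; (inj₂ p) → inj₂ (cycPairs-rotate a (as ++ x ∷ bs) p) }) i j))) }
  where
  rec = rotate-to as x (bs ∷ʳ a)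
  assoc₁ : (as ++ x ∷ bs) ∷ʳ a ≡ as ++ x ∷ bs ∷ʳ a
  assoc₁ = ++-assoc as (x ∷ bs) [ a ]
  assoc₂ : x ∷ (bs ∷ʳ a) ++ as ≡ x ∷ bs ++ a ∷ as
  assoc₂ = cong (x ∷_) (++-assoc bs [ a ] as)
  len : length (x ∷ bs ++ a ∷ as) ≡ length (x ∷ (bs ∷ʳ a) ++ as)
  len = cong length (≡-sym assoc₂)

private
  later : ∀ {v w i j : A} {t : List A} → EdgeIn (pairs (w ∷ t)) i j → EdgeIn (pairs (v ∷ w ∷ t)) i j
  later (inj₁ p) = inj₁ (there p)
  later (inj₂ p) = inj₂ (there p)

  head-edge : {v w w' : A} {s : List A} → v ∉ w ∷ s → EdgeIn (pairs (v ∷ w ∷ s)) v w' → w' ≡ w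
  head-edge nv (inj₁ (here refl)) = refl
  head-edge {w = w} {s = s} nv (inj₁ (there p)) = ⊥-elim (nv (pairs-fst∈ (w ∷ s) p))
  head-edge nv (inj₂ (here refl)) = ⊥-elim (nv (here refl))
  head-edge {w = w} {s = s} nv (inj₂ (there p)) = ⊥-elim (nv (there (pairs-snd∈ w s p)))

  tail-edge : {v w i j : A} {s s' : List A} → v ∉ w ∷ s → EdgeIn (pairs (w ∷ s)) i j →
    EdgeIn (pairs (v ∷ w ∷ s')) i j → EdgeIn (pairs (w ∷ s')) i j
  tail-edge nv q (inj₁ (there p)) = inj₁ p
  tail-edge nv q (inj₂ (there p)) = inj₂ p
  tail-edge {w = w} {s = s} nv q (inj₁ (here refl)) = ⊥-elim (nv (edge-ends∈ w s q))
  tail-edge {w = w} {s = s} nv q (inj₂ (here refl)) = ⊥-elim (nv (edge-ends∈ w s (swap q)))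

-- A path is determined by its first vertex and its edge set: peel off the only edge at the first vertex.
path-unique : {v : A} (r r' : List A) → Unique (v ∷ r) → Unique (v ∷ r') →
  (∀ {i j} → EdgeIn (pairs (v ∷ r)) i j → EdgeIn (pairs (v ∷ r')) i j) →
  (∀ {i j} → EdgeIn (pairs (v ∷ r')) i j → EdgeIn (pairs (v ∷ r)) i j) → r ≡ r'
path-unique []      []        u u' f g = refl
path-unique []      (w' ∷ s') u u' f g with g (inj₁ (here refl))
... | inj₁ ()
... | inj₂ ()
path-unique (w ∷ s) []        u u' f g with f (inj₁ (here refl))
... | inj₁ ()
... | inj₂ ()
path-unique (w ∷ s) (w' ∷ s') (a ∷ u) (a' ∷ u') f g with head-edge (All⇒∉ a) (g (inj₁ (here refl)))
... | refl = cong (w ∷_) (path-unique s s' u u'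
  (λ e → tail-edge (All⇒∉ a) e (f (later e))) (λ e → tail-edge (All⇒∉ a') e (g (later e))))

private
  -- The path leaves `y` only towards the first vertex of `t`, which is not `x`. With `t` empty, `y`
  -- and `x` would be consecutive.
  no-closing-edge : {x y : A} {t : List A} → x ∉ y ∷ t → 1 ≤ length t → Unique (y ∷ t) →
    ¬ EdgeIn (pairs (y ∷ t ∷ʳ x)) y x
  no-closing-edge {x = x} {y} {w ∷ s} nx _ (a ∷ u) e = nx (there (here (head-edge y∉ e)))
    where
    y∉ : y ∉ w ∷ s ∷ʳ x
    y∉ p with ∈-++⁻ (w ∷ s) p
    ... | inj₁ r = All⇒∉ a r
    ... | inj₂ (here refl) = nx (here refl)

  drop-first : {x y i j : A} {t t' : List A} → x ∉ y ∷ t → 1 ≤ length t → Unique (y ∷ t) →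
    EdgeIn (pairs (y ∷ t ∷ʳ x)) i j → EdgeIn (pairs (x ∷ y ∷ t' ∷ʳ x)) i j → EdgeIn (pairs (y ∷ t' ∷ʳ x)) i j
  drop-first nx l u q (inj₁ (there p)) = inj₁ p
  drop-first nx l u q (inj₂ (there p)) = inj₂ p
  drop-first nx l u q (inj₁ (here refl)) = ⊥-elim (no-closing-edge nx l u (swap q))
  drop-first nx l u q (inj₂ (here refl)) = ⊥-elim (no-closing-edge nx l u q)

  unique-∷ʳ : {x : A} {l : List A} → Unique l → x ∉ l → Unique (l ∷ʳ x)
  unique-∷ʳ u nx = Unique.++⁺ u ([] ∷ []) λ { (p , here refl) → nx p }

  -- Deleting the edge between `x` and `y` turns both cycles into paths from `y` to `x` with the
  -- same edges, and `path-unique` applies.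
  same-start : {x y : A} (t t' : List A) → x ∉ y ∷ t → x ∉ y ∷ t' → Unique (y ∷ t) → Unique (y ∷ t') →
    1 ≤ length t → 1 ≤ length t' →
    (∀ {i j} → EdgeIn (cycPairs (x ∷ y ∷ t)) i j → EdgeIn (cycPairs (x ∷ y ∷ t')) i j) →
    (∀ {i j} → EdgeIn (cycPairs (x ∷ y ∷ t')) i j → EdgeIn (cycPairs (x ∷ y ∷ t)) i j) → t ≡ t'
  same-start t t' nx nx' u u' l l' f g = ∷ʳ-injectiveˡ t t'
    (path-unique (t ∷ʳ _) (t' ∷ʳ _) (unique-∷ʳ u nx) (unique-∷ʳ u' nx')
      (λ e → drop-first {t' = t'} nx l u e (f (later e))) (λ e → drop-first {t' = t} nx' l' u' e (g (later e))))

-- What follows `x` on a cycle; two further vertices make the cycle length at least 3.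
record Tail (x : A) (l : List A) : Set where
  constructor mkTail
  field
    tail-unique : Unique l
    tail-avoids : x ∉ l
    tail-length : 2 ≤ length l
open Tail public

unique-reverse : {l : List A} → Unique l → Unique (reverse l)
unique-reverse [] = []
unique-reverse {l = x ∷ l} (a ∷ u) = subst Unique (≡-sym (unfold-reverse x l))
  (unique-∷ʳ (unique-reverse u) (All⇒∉ a ∘ reverse⁻))

tail-reverse : {x : A} {l : List A} → Tail x l → Tail x (reverse l)
tail-reverse {l = l} (mkTail u a le) = mkTail (unique-reverse u) (a ∘ reverse⁻) (≤-trans le (≤-reflexive (≡-sym (length-reverse l))))

-- A palindrome of length at least 2 begins and ends with the same element.
reverse-≢ : {x : A} {l : List A} → Tail x l → reverse l ≢ l
reverse-≢ {l = y ∷ t} (mkTail (a ∷ u) _ (s≤s le)) e with initLast t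
... | s ∷ʳ′ z with ∷-injectiveˡ (trans (≡-sym e) (reverse-++ (y ∷ s) [ z ]))
...   | refl = All⇒∉ a (∈-++⁺ʳ s (here refl))

-- The second vertex of one list is a neighbour of x on the cycle, so it is the second or the last
-- vertex of the other one.
tails-of-cycle : {x : A} (l l' : List A) → Tail x l → Tail x l' →
  (∀ {i j} → EdgeIn (cycPairs (x ∷ l)) i j → EdgeIn (cycPairs (x ∷ l')) i j) →
  (∀ {i j} → EdgeIn (cycPairs (x ∷ l')) i j → EdgeIn (cycPairs (x ∷ l)) i j) → l' ≡ l ⊎ l' ≡ reverse l
tails-of-cycle {x = x} l l'@(y' ∷ t') tl tl' f g = first-neighbour l tl f g (g (inj₁ (here refl)))
  where
  aligned : ∀ k t → k ≡ y' ∷ t → Tail x k → (∀ {i j} → EdgeIn (cycPairs (x ∷ k)) i j → EdgeIn (cycPairs (x ∷ l')) i j) →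
    (∀ {i j} → EdgeIn (cycPairs (x ∷ l')) i j → EdgeIn (cycPairs (x ∷ k)) i j) → l' ≡ k
  aligned k t refl (mkTail u a (s≤s le)) f g =
    cong (y' ∷_) (≡-sym (same-start t t' a (tail-avoids tl') u (tail-unique tl') le (≤-pred (tail-length tl')) f g))
  first-neighbour : ∀ l → Tail x l → (∀ {i j} → EdgeIn (cycPairs (x ∷ l)) i j → EdgeIn (cycPairs (x ∷ l')) i j) →
    (∀ {i j} → EdgeIn (cycPairs (x ∷ l')) i j → EdgeIn (cycPairs (x ∷ l)) i j) →
    EdgeIn (cycPairs (x ∷ l)) x y' → l' ≡ l ⊎ l' ≡ reverse l
  first-neighbour l tl f g e with initLast l
  first-neighbour .(s ∷ʳ z) tl f g e | s ∷ʳ′ z = by-edge e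
    where
    -- Traversed backwards, the cycle has `z` as its first vertex after `x`.
    last-case : z ≡ y' → l' ≡ reverse (s ∷ʳ z)
    last-case refl = aligned (reverse (s ∷ʳ z)) (reverse s) (reverse-++ s [ z ]) (tail-reverse tl)
      (λ e → f (edge-reverse⁻ x (s ∷ʳ z) e)) (λ e → edge-reverse x (s ∷ʳ z) (g e))
    head-case : ∀ q → q ≡ s ∷ʳ z → (x , y') ∈ pairs (x ∷ q ∷ʳ x) → l' ≡ s ∷ʳ z
    head-case [] e p with () ← trans (cong length e) (length-++-comm s [ z ])
    head-case (y ∷ t) eq (here refl) = aligned (s ∷ʳ z) t (≡-sym eq) tl f g
    head-case (y ∷ t) eq (there p) = ⊥-elim (tail-avoids tl (subst (x ∈_) eq (pairs-fst∈-∷ʳ (y ∷ t) p)))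
    by-edge : EdgeIn (cycPairs (x ∷ s ∷ʳ z)) x y' → l' ≡ s ∷ʳ z ⊎ l' ≡ reverse (s ∷ʳ z)
    by-edge (inj₁ p) = inj₁ (head-case (s ∷ʳ z) refl p)
    by-edge (inj₂ p) = inj₂ (last-case (last-edge (∈-++⁻ (pairs (x ∷ s ∷ʳ z))
      (subst (_ ∈_) (trans (cong (λ q → pairs (x ∷ q)) (++-assoc s [ z ] [ x ])) (pairs-∷ʳ (x ∷ s) z x)) p))))
      where
      last-edge : (y' , x) ∈ pairs (x ∷ s ∷ʳ z) ⊎ (y' , x) ∈ [ z , x ] → z ≡ y'
      last-edge (inj₁ q)           = ⊥-elim (tail-avoids tl (pairs-snd∈ x (s ∷ʳ z) q))
      last-edge (inj₂ (here refl)) = refl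

-- Cycles through a vertex

eqB⁻ : ∀ {a b} → eqB a b ≡ true → a ≡ b
eqB⁻ {true}  {true}  _ = refl
eqB⁻ {false} {false} _ = refl

eqB⁺ : ∀ {a b} → a ≡ b → eqB a b ≡ true
eqB⁺ {true}  refl = refl
eqB⁺ {false} refl = refl

record CycleOn (H : Matrix n) (vs : List (Fin n)) : Set where
  constructor mkCycleOn
  field
    cyc-length : 3 ≤ length vs
    cyc-unique : Unique vs
    cyc-edges  : ∀ i j → entry H i j ≡ cycAdj vs i j
open CycleOn

unique≤n : {l : List (Fin n)} → Unique l → length l ≤ n
unique≤n {n} u = ≤-trans (unique-length≤ (allFin n) u (λ {x} _ → ∈-allFin x)) (≤-reflexive (length-tabulate id))

isCycleB⁻ : (H : Matrix n) → isCycleB H ≡ true → ∃[ vs ] CycleOn H vs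
isCycleB⁻ {n} H e =
  let (m , m∈ , p) = any⁻ (λ m → (3 ≤ᵇ m) ∧ any (isCycleOn H) (allLists m (allFin n))) (upTo (suc n)) e
      (vs , vs∈ , q) = any⁻ (isCycleOn H) (allLists m (allFin n)) (∧-snd {3 ≤ᵇ m} p)
  in vs , mkCycleOn
       (≤-trans (≤ᵇ⇒≤ 3 m (Equivalence.from T-≡ (∧-fst p))) (≤-reflexive (≡-sym (allLists-length m vs∈))))
       (distinctB⁻ vs (∧-fst q))
       (λ i j → eqB⁻ (allPairsB⁻ _ (∧-snd {distinctB vs} q) i j))

isCycleB⁺ : (H : Matrix n) (vs : List (Fin n)) → CycleOn H vs → isCycleB H ≡ true
isCycleB⁺ {n} H vs (mkCycleOn l u e) = any⁺ (λ m → (3 ≤ᵇ m) ∧ any (isCycleOn H) (allLists m (allFin n))) (∈-upTo⁺ (s≤s (unique≤n u)))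
  (∧-intro (Equivalence.to T-≡ (≤⇒≤ᵇ l))
    (any⁺ (isCycleOn H) (∈-allLists vs (λ {x} _ → ∈-allFin x))
      (∧-intro (distinctB⁺ u) (allPairsB⁺ _ (λ i j → eqB⁺ (e i j))))))

subB⁻ : (H : Matrix n) (G : SimpleGraph n) → subB H G ≡ true → ∀ i j → entry H i j ≡ true → adj G i j ≡ true
subB⁻ H G e i j h with allPairsB⁻ _ e i j
... | q rewrite h = q

subB⁺ : (H : Matrix n) (G : SimpleGraph n) → (∀ i j → entry H i j ≡ true → adj G i j ≡ true) → subB H G ≡ true
subB⁺ H G h = allPairsB⁺ _ λ i j → aux i j (entry H i j) refl
  where
  aux : ∀ i j b → entry H i j ≡ b → not b ∨ adj G i j ≡ true
  aux i j true  e = h i j e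
  aux i j false e = refl

touchB : Matrix n → Fin n → Bool
touchB {n} H x = any (entry H x) (allFin n)

-- Deletion keeps `x` as an isolated vertex, so that all graphs share one vertex set and their
-- cycles remain matrices of one size.
_⊝_ : SimpleGraph n → Fin n → SimpleGraph n
G ⊝ x = record
  { adj    = λ i j → adj G i j ∧ (not (eqF i x) ∧ not (eqF j x))
  ; sym    = λ i j → cong₂ _∧_ (SimpleGraph.sym G i j) (∧-comm (not (eqF i x)) (not (eqF j x)))
  ; irrefl = λ i → cong (_∧ (not (eqF i x) ∧ not (eqF i x))) (irrefl G i) }

⊝-adj⁻ : (G : SimpleGraph n) {x i j : Fin n} → adj (G ⊝ x) i j ≡ true → adj G i j ≡ true × i ≢ x × j ≢ x
⊝-adj⁻ G {x} {i} {j} e = ∧-fst e , eqF-false⁻ (not-true⁻ (∧-fst {not (eqF i x)} (∧-snd {adj G i j} e))) ,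
  eqF-false⁻ (not-true⁻ (∧-snd {not (eqF i x)} (∧-snd {adj G i j} e)))

⊝-adj⁺ : (G : SimpleGraph n) {x i j : Fin n} → adj G i j ≡ true → i ≢ x → j ≢ x → adj (G ⊝ x) i j ≡ true
⊝-adj⁺ G a i≢ j≢ = ∧-intro a (∧-intro (not-true (eqF-false i≢)) (not-true (eqF-false j≢)))

cyc-sym : {H : Matrix n} {vs : List (Fin n)} → CycleOn H vs → ∀ {i j} → entry H i j ≡ true → entry H j i ≡ true
cyc-sym {vs = vs} c {i} {j} e = trans (cyc-edges c j i)
  (cycAdj⁺ vs (swap (cycAdj⁻ vs (trans (≡-sym (cyc-edges c i j)) e))))

-- The matrix of a cycle is symmetric, so an empty row of `x` keeps `x` away from both ends of every
-- edge.
cycles-avoiding : (G : SimpleGraph n) (x : Fin n) (H : Matrix n) →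
  (subB H G ∧ isCycleB H) ∧ not (touchB H x) ≡ subB H (G ⊝ x) ∧ isCycleB H
cycles-avoiding {n} G x H = bool-ext to from
  where
  to : (subB H G ∧ isCycleB H) ∧ not (touchB H x) ≡ true → subB H (G ⊝ x) ∧ isCycleB H ≡ true
  to e = ∧-intro (subB⁺ H (G ⊝ x) λ i j h → ⊝-adj⁺ G (subB⁻ H G (∧-fst sc) i j h) (free h) (free (cyc-sym (proj₂ c) h)))
                 (∧-snd {subB H G} sc)
    where
    sc = ∧-fst {subB H G ∧ isCycleB H} e
    c = isCycleB⁻ H (∧-snd {subB H G} sc)
    free : ∀ {i j} → entry H i j ≡ true → i ≢ x
    free {i} {j} h refl = true≢false (any⁺ (entry H x) (∈-allFin j) h) (not-true⁻ (∧-snd {subB H G ∧ isCycleB H} e))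
  from : subB H (G ⊝ x) ∧ isCycleB H ≡ true → (subB H G ∧ isCycleB H) ∧ not (touchB H x) ≡ true
  from e = ∧-intro (∧-intro (subB⁺ H G λ i j h → proj₁ (⊝-adj⁻ G (s i j h))) (∧-snd {subB H (G ⊝ x)} e)) (not-true untouched)
    where
    s = subB⁻ H (G ⊝ x) (∧-fst e)
    untouched : touchB H x ≡ false
    untouched with touchB H x in t
    ... | false = refl
    ... | true  = let (j , _ , h) = any⁻ (entry H x) (allFin n) t in ⊥-elim (proj₁ (proj₂ (⊝-adj⁻ G (s x j h))) refl)

branch : VSet n → (Fin n → List (List (Fin n))) → List (List (Fin n))
branch {n} P g = concatMap (λ w → if P w then map (w ∷_) (g w) else []) (allFin n)

∈-branch⁺ : (P : VSet n) (g : Fin n → List (List (Fin n))) {w : Fin n} {l : List (Fin n)} →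
  P w ≡ true → l ∈ g w → w ∷ l ∈ branch P g
∈-branch⁺ P g {w} {l} p l∈ = ∈-concatMap⁺ _ (∈-allFin w)
  (subst (λ b → w ∷ l ∈ (if b then map (w ∷_) (g w) else [])) (≡-sym p) (∈-map⁺ (w ∷_) l∈))

∈-branch⁻ : (P : VSet n) (g : Fin n → List (List (Fin n))) {l : List (Fin n)} →
  l ∈ branch P g → ∃[ w ] ∃[ l' ] (l ≡ w ∷ l' × P w ≡ true × l' ∈ g w)
∈-branch⁻ {n} P g l∈ with ∈-concatMap⁻ _ (allFin n) l∈
... | w , _ , q with P w in p
...   | true = let (l' , m , e) = ∈-map⁻ (w ∷_) q in w , l' , e , p , m

unique-branch : (P : VSet n) (g : Fin n → List (List (Fin n))) → (∀ w → Unique (g w)) → Unique (branch P g)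
unique-branch {n} P g u = unique-concatMap _ (Unique.allFin⁺ n) each
    λ {x} {x'} p q → heads (shape x p) (shape x' q)
  where
  each : ∀ w → Unique (if P w then map (w ∷_) (g w) else [])
  each w with P w
  ... | true  = Unique.map⁺ (λ { refl → refl }) (u w)
  ... | false = []
  shape : ∀ w {l : List (Fin n)} → l ∈ (if P w then map (w ∷_) (g w) else []) → ∃[ l' ] l ≡ w ∷ l'
  shape w l∈ with P w
  ... | true = let (l' , _ , e) = ∈-map⁻ (w ∷_) l∈ in l' , e
  heads : {x x' : Fin n} {l : List (Fin n)} → ∃[ k ] l ≡ x ∷ k → ∃[ k ] l ≡ x' ∷ k → x ≡ x'
  heads (_ , refl) (_ , refl) = refl

length-branch : (P : VSet n) (g : Fin n → List (List (Fin n))) → length (branch P g) ≡ (Σ[ P ] λ w → length (g w))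
length-branch {n} P g = trans (go n (λ i → i)) (≡-sym (Σ-sum P _))
  where
  h : Fin n → List (List (Fin n))
  h w = if P w then map (w ∷_) (g w) else []
  aux : ∀ w → length (h w) ≡ (if P w then length (g w) else 0)
  aux w with P w
  ... | true  = length-map (w ∷_) (g w)
  ... | false = refl
  go : ∀ m (f : Fin m → Fin n) → length (concatMap h (List.tabulate f)) ≡ sum (λ i → if P (f i) then length (g (f i)) else 0)
  go zero    f = refl
  go (suc m) f = trans (length-++ (h (f zero))) (cong₂ _+_ (aux (f zero)) (go m (f ∘ suc)))

-- The interiors of the paths counted by `paths`, listed by the same recursion.
ext : SimpleGraph n → Fin n → ℕ → Fin n → VSet n → List (List (Fin n))
ext G z zero    v U = if adj G v z then [ [] ] else []
ext G z (suc k) v U = (if adj G v z then [ [] ] else []) ++ branch (U ∩ adj G v) (λ w → ext G z k w (U ∖ w))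

length-ext : (G : SimpleGraph n) (z : Fin n) (k : ℕ) (v : Fin n) (U : VSet n) → length (ext G z k v U) ≡ paths G z k v U
length-ext G z zero v U with adj G v z
... | true  = refl
... | false = refl
length-ext G z (suc k) v U = trans (length-++ (if adj G v z then [ [] ] else []))
  (cong₂ _+_ (length-ext G z zero v U) (trans (length-branch (U ∩ adj G v) _)
    (Σ-cong (U ∩ adj G v) (λ w _ → length-ext G z k w (U ∖ w)))))

unique-ext : (G : SimpleGraph n) (z : Fin n) (k : ℕ) (v : Fin n) (U : VSet n) → Unique (ext G z k v U)
unique-ext G z zero v U with adj G v z
... | true  = [] ∷ []
... | false = []
unique-ext G z (suc k) v U = Unique.++⁺ (unique-ext G z zero v U)
  (unique-branch (U ∩ adj G v) _ (λ w → unique-ext G z k w (U ∖ w)))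
  λ (p , q) → empty≢branch (nil (adj G v z) p) (∈-branch⁻ (U ∩ adj G v) _ q)
  where
  nil : ∀ b {l : List (Fin _)} → l ∈ (if b then [ [] ] else []) → l ≡ []
  nil true (here e) = e
  empty≢branch : ∀ {P Q : Fin _ → List (Fin _) → Set} {l} → l ≡ [] → ∃[ w ] ∃[ l' ] (l ≡ w ∷ l' × P w l' × Q w l') → ⊥
  empty≢branch refl (_ , _ , () , _)

IsPath : SimpleGraph n → Fin n → Fin n → VSet n → List (Fin n) → Set
IsPath G z v U []      = adj G v z ≡ true
IsPath G z v U (w ∷ l) = (U ∩ adj G v) w ≡ true × IsPath G z w (U ∖ w) l

∈-ext⁻ : (G : SimpleGraph n) (z : Fin n) (k : ℕ) (v : Fin n) (U : VSet n) {l : List (Fin n)} → l ∈ ext G z k v U → IsPath G z v U l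
∈-ext⁻ G z zero v U l∈ with adj G v z in e
∈-ext⁻ G z zero v U (here refl) | true = e
∈-ext⁻ G z (suc k) v U l∈ with ∈-++⁻ (if adj G v z then [ [] ] else []) l∈
... | inj₁ p = ∈-ext⁻ G z zero v U p
... | inj₂ p with ∈-branch⁻ (U ∩ adj G v) _ p
...   | w , l' , refl , q , r = q , ∈-ext⁻ G z k w (U ∖ w) r

∈-ext⁺ : (G : SimpleGraph n) (z : Fin n) (k : ℕ) (v : Fin n) (U : VSet n) (l : List (Fin n)) → length l ≤ k → IsPath G z v U l → l ∈ ext G z k v U
∈-ext⁺ G z zero v U [] _ e rewrite e = here refl
∈-ext⁺ G z (suc k) v U [] _ e = ∈-++⁺ˡ (∈-ext⁺ G z zero v U [] z≤n e)
∈-ext⁺ G z (suc k) v U (w ∷ l) (s≤s le) (p , q) = ∈-++⁺ʳ (if adj G v z then [ [] ] else [])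
  (∈-branch⁺ (U ∩ adj G v) _ p (∈-ext⁺ G z k w (U ∖ w) l le q))

path-inside : (G : SimpleGraph n) (z v : Fin n) (U : VSet n) (l : List (Fin n)) → IsPath G z v U l → ∀ {i} → i ∈ l → U i ≡ true
path-inside G z v U (w ∷ l) (p , q) (here refl) = ∧-fst p
path-inside G z v U (w ∷ l) (p , q) (there i∈) = ∖-⊆ U (path-inside G z w (U ∖ w) l q i∈)

path-distinct : (G : SimpleGraph n) (z v : Fin n) (U : VSet n) (l : List (Fin n)) → IsPath G z v U l → Unique l
path-distinct G z v U []      p = []
path-distinct G z v U (w ∷ l) (p , q) =
  ∉⇒All (λ w∈ → ∖-≢ U (path-inside G z w (U ∖ w) l q w∈) refl) ∷ path-distinct G z w (U ∖ w) l q

path-edges : (G : SimpleGraph n) (z v : Fin n) (U : VSet n) (l : List (Fin n)) → IsPath G z v U l →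
  ∀ {i j} → (i , j) ∈ pairs (v ∷ l ∷ʳ z) → adj G i j ≡ true
path-edges G z v U []      p (here refl) = p
path-edges G z v U (w ∷ l) (p , q) (here refl) = ∧-snd {U w} p
path-edges G z v U (w ∷ l) (p , q) (there r)   = path-edges G z w (U ∖ w) l q r

mkPath : (G : SimpleGraph n) (z v : Fin n) (U : VSet n) (l : List (Fin n)) → Unique l →
  (∀ {i} → i ∈ l → U i ≡ true) → (∀ {i j} → (i , j) ∈ pairs (v ∷ l ∷ʳ z) → adj G i j ≡ true) → IsPath G z v U l
mkPath G z v U []      u h e = e (here refl)
mkPath G z v U (w ∷ l) (a ∷ u) h e = ∧-intro (h (here refl)) (e (here refl)) ,
  mkPath G z w (U ∖ w) l u (λ i∈ → ∖-in U (h (there i∈)) λ { refl → All⇒∉ a i∈ }) (λ p → e (there p))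

pred-edge : (v : A) (l r : List A) {w : A} → w ∈ l → ∃[ i ] (i , w) ∈ pairs (v ∷ l ++ r)
pred-edge v (x ∷ l) r (here refl) = v , here refl
pred-edge v (x ∷ l) r (there w∈) = let (i , p) = pred-edge x l r w∈ in i , there p

-- The sequences y, w, … closing up with x to a cycle inside V; every cycle through x arises from
-- exactly two of them, one for each direction.
tails : SimpleGraph n → Fin n → ℕ → VSet n → List (List (Fin n))
tails G x k V = branch (V ∖ x ∩ adj G x) λ y → branch (V ∖ x ∖ y ∩ adj G y) λ w → ext G x k w (V ∖ x ∖ y ∖ w)

-- Two vertices are chosen before `paths` takes over, since `paths` started at `y` would also count
-- the degenerate walk `x`, `y`, `x`.
closed : SimpleGraph n → Fin n → ℕ → VSet n → ℕ
closed G x k V = Σ[ V ∖ x ∩ adj G x ] λ y → Σ[ V ∖ x ∖ y ∩ adj G y ] λ w → paths G x k w (V ∖ x ∖ y ∖ w)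

length-tails : (G : SimpleGraph n) (x : Fin n) (k : ℕ) (V : VSet n) → length (tails G x k V) ≡ closed G x k V
length-tails G x k V = trans (length-branch (V ∖ x ∩ adj G x) _) (Σ-cong (V ∖ x ∩ adj G x) λ y _ →
  trans (length-branch (V ∖ x ∖ y ∩ adj G y) _) (Σ-cong (V ∖ x ∖ y ∩ adj G y) λ w _ → length-ext G x k w (V ∖ x ∖ y ∖ w)))

unique-tails : (G : SimpleGraph n) (x : Fin n) (k : ℕ) (V : VSet n) → Unique (tails G x k V)
unique-tails G x k V = unique-branch _ _ λ y → unique-branch _ _ λ w → unique-ext G x k w (V ∖ x ∖ y ∖ w)

∈-tails⁻ : (G : SimpleGraph n) (x : Fin n) (k : ℕ) (V : VSet n) {l : List (Fin n)} → l ∈ tails G x k V →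
  2 ≤ length l × IsPath G x x (V ∖ x) l
∈-tails⁻ G x k V l∈ with ∈-branch⁻ (V ∖ x ∩ adj G x) _ l∈
... | y , _ , refl , p , m with ∈-branch⁻ (V ∖ x ∖ y ∩ adj G y) _ m
...   | w , l' , refl , q , r = s≤s (s≤s z≤n) , p , q , ∈-ext⁻ G x k w _ r

∈-tails⁺ : (G : SimpleGraph n) (x : Fin n) (k : ℕ) (V : VSet n) (l : List (Fin n)) → 2 ≤ length l → length l ≤ k →
  IsPath G x x (V ∖ x) l → l ∈ tails G x k V
∈-tails⁺ G x k V (y ∷ w ∷ l) _ le (p , q , r) = ∈-branch⁺ (V ∖ x ∩ adj G x) _ p
  (∈-branch⁺ (V ∖ x ∖ y ∩ adj G y) _ q (∈-ext⁺ G x k w _ l (≤-trans (n≤1+n _) (≤-trans (n≤1+n _) le)) r))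
∈-tails⁺ G x k V (y ∷ []) (s≤s ()) _ _

cycleMatrix : List (Fin n) → Matrix n
cycleMatrix vs = tabulate λ i → tabulate λ j → cycAdj vs i j

entry-cycleMatrix : (vs : List (Fin n)) (i j : Fin n) → entry (cycleMatrix vs) i j ≡ cycAdj vs i j
entry-cycleMatrix vs i j = trans (cong (λ r → lookup r j) (lookup∘tabulate (λ i → tabulate λ j → cycAdj vs i j) i)) (lookup∘tabulate _ j)

-- `V` holds every vertex that still has an edge, so sequences restricted to `V` miss no cycle.
module CyclesThrough (G : SimpleGraph n) (x : Fin n) (V : VSet n)
  (alive : ∀ {i j} → adj G i j ≡ true → V j ≡ true) where

  private
    cyclesThrough : List (Matrix n)
    cyclesThrough = filterᵇ (λ H → (subB H G ∧ isCycleB H) ∧ touchB H x) (allMatrices n)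

    Ts = tails G x n V

    tail-of : ∀ {l} → l ∈ Ts → Tail x l
    tail-of {l} l∈ = let (le , p) = ∈-tails⁻ G x n V l∈ in
      mkTail (path-distinct G x x (V ∖ x) l p) (λ x∈ → ∖-≢ V (path-inside G x x (V ∖ x) l p x∈) refl) le

    tail-edges : ∀ {l} → l ∈ Ts → ∀ {i j} → EdgeIn (cycPairs (x ∷ l)) i j → adj G i j ≡ true
    tail-edges {l} l∈ (inj₁ e) = path-edges G x x (V ∖ x) l (proj₂ (∈-tails⁻ G x n V l∈)) e
    tail-edges {l} l∈ (inj₂ e) = adj-sym G (path-edges G x x (V ∖ x) l (proj₂ (∈-tails⁻ G x n V l∈)) e)

    into : ∀ {l} → l ∈ Ts → cycleMatrix (x ∷ l) ∈ cyclesThrough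
    into {l} l∈ = ∈-filterᵇ⁺ _ (∈-allMatrices _) (∧-intro (∧-intro
        (subB⁺ H G λ i j h → tail-edges l∈ (cycAdj⁻ (x ∷ l) (trans (≡-sym (entry-cycleMatrix (x ∷ l) i j)) h)))
        (isCycleB⁺ H (x ∷ l) (mkCycleOn (s≤s (tail-length t)) (∉⇒All (tail-avoids t) ∷ tail-unique t) (entry-cycleMatrix (x ∷ l)))))
        (touch l (tail-length t)))
      where
      H = cycleMatrix (x ∷ l)
      t = tail-of l∈
      touch : ∀ l → 2 ≤ length l → touchB (cycleMatrix (x ∷ l)) x ≡ true
      touch (y ∷ l) _ = any⁺ (entry (cycleMatrix (x ∷ y ∷ l)) x) (∈-allFin y)
        (trans (entry-cycleMatrix (x ∷ y ∷ l) x y) (cycAdj⁺ (x ∷ y ∷ l) (inj₁ (here refl))))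

    tail∈ : ∀ {l} → Tail x l → (∀ {i j} → EdgeIn (cycPairs (x ∷ l)) i j → adj G i j ≡ true) → l ∈ Ts
    tail∈ {l} t h = ∈-tails⁺ G x n V l (tail-length t) (unique≤n (tail-unique t))
      (mkPath G x x (V ∖ x) l (tail-unique t)
        -- Each vertex of `l` has a predecessor on the cycle, so it is the end of an edge and lies
        -- in `V`.
        (λ {i} i∈ → ∖-in V (alive (h (inj₁ (proj₂ (pred-edge x l [ x ] i∈))))) λ { refl → tail-avoids t i∈ })
        (λ p → h (inj₁ p)))

    onto : ∀ {H} → H ∈ cyclesThrough → ∃[ l ] (l ∈ Ts × cycleMatrix (x ∷ l) ≡ H)
    onto {H} H∈ = from-split (∈-∃++ x∈vs)
      where
      e = proj₂ (∈-filterᵇ⁻ _ {allMatrices n} H∈)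
      sc = ∧-fst {subB H G ∧ isCycleB H} e
      vs = proj₁ (isCycleB⁻ H (∧-snd {subB H G} sc))
      c = proj₂ (isCycleB⁻ H (∧-snd {subB H G} sc))
      in-cycle : ∀ vs {i j} → EdgeIn (cycPairs vs) i j → i ∈ vs
      in-cycle (v ∷ vs) (inj₁ p) = pairs-fst∈-∷ʳ (v ∷ vs) p
      in-cycle (v ∷ vs) (inj₂ p) with ∈-++⁻ vs (pairs-snd∈ v (vs ∷ʳ v) p)
      ... | inj₁ q           = there q
      ... | inj₂ (here refl) = here refl
      in-cycle [] (inj₁ ())
      in-cycle [] (inj₂ ())
      x∈vs : x ∈ vs
      x∈vs = let (j , _ , h) = any⁻ (entry H x) (allFin n) (∧-snd {subB H G ∧ isCycleB H} e)
             in in-cycle vs (cycAdj⁻ vs (trans (≡-sym (cyc-edges c x j)) h))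
      from-split : ∃[ as ] ∃[ bs ] vs ≡ as ++ [ x ] ++ bs → ∃[ l ] (l ∈ Ts × cycleMatrix (x ∷ l) ≡ H)
      from-split (as , bs , eq) = l , tail∈ tl (λ p → subB⁻ H G (∧-fst sc) _ _ (trans (ent _ _) (cycAdj⁺ (x ∷ l) p))) ,
          matrix-ext (λ i j → trans (entry-cycleMatrix (x ∷ l) i j) (≡-sym (ent i j)))
        where
        l = bs ++ as
        rot = rotate-to as x bs
        ent : ∀ i j → entry H i j ≡ cycAdj (x ∷ l) i j
        ent i j = trans (cyc-edges c i j) (trans (cong (λ k → cycAdj k i j) eq) (≡-sym (same-edges rot i j)))
        tl : Tail x l
        tl with same-unique rot (subst Unique eq (cyc-unique c))
        ... | a ∷ u = mkTail u (All⇒∉ a) (≤-pred (≤-trans (cyc-length c) (≤-reflexive (trans (cong length eq) (≡-sym (same-length rot))))))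

    same-matrix : ∀ {l l'} → cycleMatrix (x ∷ l) ≡ cycleMatrix (x ∷ l') → ∀ {i j} →
      EdgeIn (cycPairs (x ∷ l)) i j → EdgeIn (cycPairs (x ∷ l')) i j
    same-matrix {l} {l'} e {i} {j} p = cycAdj⁻ (x ∷ l') (trans (≡-sym (entry-cycleMatrix (x ∷ l') i j))
      (trans (cong (λ M → entry M i j) (≡-sym e)) (trans (entry-cycleMatrix (x ∷ l) i j) (cycAdj⁺ (x ∷ l) p))))

    reversed : ∀ {l} → l ∈ Ts → reverse l ∈ Ts × cycleMatrix (x ∷ reverse l) ≡ cycleMatrix (x ∷ l) × reverse l ≢ l
    reversed {l} l∈ = tail∈ (tail-reverse t) (λ e → tail-edges l∈ (edge-reverse⁻ x l e)) ,
        matrix-ext (λ i j → trans (entry-cycleMatrix (x ∷ reverse l) i j)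
          (trans (cycAdj-cong (x ∷ reverse l) (x ∷ l) (edge-reverse⁻ x l) (edge-reverse x l) i j)
            (≡-sym (entry-cycleMatrix (x ∷ l) i j)))) ,
        reverse-≢ t
      where
      t = tail-of l∈

    count : closed G x n V ≡ 2 * length cyclesThrough
    count = trans (≡-sym (length-tails G x n V)) (two-to-one (λ l → cycleMatrix (x ∷ l)) reverse Ts cyclesThrough
      (unique-tails G x n V) (Unique.filter⁺ _ (unique-allMatrices n)) into onto reversed
      (λ l∈ l'∈ e → tails-of-cycle _ _ (tail-of l∈) (tail-of l'∈) (same-matrix e) (same-matrix (≡-sym e))))

  -- Cycles are split by whether they meet `x`; each one that does is traversed in two directions.
  numCycles-remove : 2 * numCycles G ≡ closed G x n V + 2 * numCycles (G ⊝ x)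
  numCycles-remove = begin
    2 * numCycles G
      ≡⟨ cong (2 *_) (trans (filterᵇ-split _ (λ H → touchB H x) (allMatrices n))
           (cong (length cyclesThrough +_) (filterᵇ-cong (cycles-avoiding G x) (allMatrices n)))) ⟩
    2 * (length cyclesThrough + numCycles (G ⊝ x))
      ≡⟨ *-distribˡ-+ 2 (length cyclesThrough) _ ⟩
    2 * length cyclesThrough + 2 * numCycles (G ⊝ x)
      ≡⟨ cong (_+ 2 * numCycles (G ⊝ x)) (≡-sym count) ⟩
    closed G x n V + 2 * numCycles (G ⊝ x) ∎
    where open ≡-Reasoning

-- Numerical estimates

-- T k bounds twice the number of cycles of a triangle-free graph on k vertices: remove a vertex of
-- degree at most k/2, count the cycles through it by its two neighbours on them, and iterate.
T : ℕ → ℕ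
T zero    = 0
T (suc k) = ⌊ suc k /2⌋ * ((⌊ suc k /2⌋ ∸ 1) * F (suc k ∸ 3)) + T k

-- S a b counts the paths between two vertices of one class of a complete bipartite graph, through
-- a vertices of the other class and b of the same class.
S : ℕ → ℕ → ℕ
S zero    b       = 0
S (suc a) zero    = suc a
S (suc a) (suc b) = suc a + suc a * suc b * S a b

double : ℕ → ℕ
double zero    = zero
double (suc m) = suc (suc (double m))

⌊double/2⌋ : ∀ m → ⌊ double m /2⌋ ≡ m
⌊double/2⌋ zero    = refl
⌊double/2⌋ (suc m) = cong suc (⌊double/2⌋ m)

⌈double/2⌉ : ∀ m → ⌈ double m /2⌉ ≡ m
⌈double/2⌉ zero    = refl
⌈double/2⌉ (suc m) = cong suc (⌈double/2⌉ m)

T-odd : ∀ j → T (suc (double (1 + j))) ≡ (1 + j) * (j * F (double j)) + T (double (1 + j))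
T-odd j = cong (λ h → suc h * (h * F (double j)) + T (double (1 + j))) (⌈double/2⌉ j)

T-even : ∀ j → T (double (2 + j)) ≡ (2 + j) * ((1 + j) * F (suc (double j))) + T (suc (double (1 + j)))
T-even j = cong (λ h → (2 + h) * ((1 + h) * F (suc (double j))) + T (suc (double (1 + j)))) (⌊double/2⌋ j)

F-even : ∀ j → F (double (3 + j)) ≡ (3 + j) * (3 + j) * F (double (2 + j)) + (3 + j)
F-even zero    = refl
F-even (suc j) rewrite ⌊double/2⌋ j | ⌈double/2⌉ j = refl

F-odd : ∀ j → F (suc (double (1 + j))) ≡ (1 + j) * (2 + j) * F (suc (double j)) + (2 + j)
F-odd zero    = refl
F-odd (suc j) rewrite ⌊double/2⌋ j | ⌈double/2⌉ j = refl

-- With class sizes `suc j` and `j` the maximum in the recurrence of `F` is attained at every step.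
S≡F : ∀ j → S (suc j) j ≡ F (suc (double j))
S≡F zero    = refl
S≡F (suc j) = trans (cong (λ s → 2 + j + (2 + j) * (1 + j) * s) (S≡F j))
  (trans (swap-terms j (F (suc (double j)))) (≡-sym (F-odd j)))
  where
  swap-terms : ∀ j f → 2 + j + (2 + j) * (1 + j) * f ≡ (1 + j) * (2 + j) * f + (2 + j)
  swap-terms = solve-∀

-- Passing from `f` to `f + 1` absorbs the additive term: `q * f + r + 1` is at most `q * (f + 1)`.
-- An upper bound on the ratio of `f + 1` to `P` therefore persists when `P` is multiplied by `q`.
growth : ∀ c e q f r P → c * (f + 1) ≤ e * P → r + 1 ≤ q → c * (q * f + r + 1) ≤ e * (q * P)
growth c e q f r P h l = begin
  c * (q * f + r + 1)      ≡⟨ cong (c *_) (+-assoc (q * f) r 1) ⟩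
  c * (q * f + (r + 1))    ≤⟨ *-monoʳ-≤ c (+-monoʳ-≤ (q * f) l) ⟩
  c * (q * f + q)          ≡⟨ e₁ c q f ⟩
  q * (c * (f + 1))        ≤⟨ *-monoʳ-≤ q h ⟩
  q * (e * P)              ≡⟨ e₂ q e P ⟩
  e * (q * P)              ∎
  where
  open ≤-Reasoning
  e₁ : ∀ c q f → c * (q * f + q) ≡ q * (c * (f + 1))
  e₁ = solve-∀
  e₂ : ∀ q e P → q * (e * P) ≡ e * (q * P)
  e₂ = solve-∀

-- The ratio does not increase, so its first value decides: `F 6` is 84, and 36 is the square of 3!.
F-even-upper : ∀ m → 36 * (F (double (3 + m)) + 1) ≤ 85 * ((3 + m) ! * (3 + m) !)
F-even-upper zero    = ≤-refl
F-even-upper (suc m) = ≤-trans (≤-reflexive (cong (λ f → 36 * (f + 1)) (F-even (suc m)))) (≤-trans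
  (growth 36 85 ((4 + m) * (4 + m)) (F (double (3 + m))) (4 + m) ((3 + m) ! * (3 + m) !) (F-even-upper m) small)
  (≤-reflexive (cong (85 *_) (square (4 + m) ((3 + m) !)))))
  where
  small : 4 + m + 1 ≤ (4 + m) * (4 + m)
  small = ≤-trans (m≤m+n _ (m * m + 7 * m + 11)) (≤-reflexive (eq m))
    where
    eq : ∀ m → 4 + m + 1 + (m * m + 7 * m + 11) ≡ (4 + m) * (4 + m)
    eq = solve-∀
  square : ∀ a p → a * a * (p * p) ≡ a * p * (a * p)
  square = solve-∀

-- The first value is `F 5 = 27`, over 2! * 3! = 12.
F-odd-upper : ∀ m → 12 * (F (suc (double (2 + m))) + 1) ≤ 28 * ((2 + m) ! * (3 + m) !)
F-odd-upper zero    = ≤-refl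
F-odd-upper (suc m) = ≤-trans (≤-reflexive (cong (λ f → 12 * (f + 1)) (F-odd (2 + m)))) (≤-trans
  (growth 12 28 ((3 + m) * (4 + m)) (F (suc (double (2 + m)))) (4 + m) ((2 + m) ! * (3 + m) !) (F-odd-upper m) small)
  (≤-reflexive (cong (28 *_) (regroup (3 + m) (4 + m) ((2 + m) !) ((3 + m) !)))))
  where
  small : 4 + m + 1 ≤ (3 + m) * (4 + m)
  small = ≤-trans (m≤m+n _ (m * m + 6 * m + 7)) (≤-reflexive (eq m))
    where
    eq : ∀ m → 4 + m + 1 + (m * m + 6 * m + 7) ≡ (3 + m) * (4 + m)
    eq = solve-∀
  regroup : ∀ a b p q → a * b * (p * q) ≡ a * p * (b * q)
  regroup = solve-∀

F-odd-lower : ∀ m → 27 * ((2 + m) ! * (3 + m) !) ≤ 12 * F (suc (double (2 + m)))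
F-odd-lower zero    = ≤-refl
F-odd-lower (suc m) = begin
  27 * ((3 + m) * P * ((4 + m) * R))        ≡⟨ e₁ (3 + m) (4 + m) P R ⟩
  (3 + m) * (4 + m) * (27 * (P * R))        ≤⟨ *-monoʳ-≤ ((3 + m) * (4 + m)) (F-odd-lower m) ⟩
  (3 + m) * (4 + m) * (12 * f)              ≡⟨ e₂ ((3 + m) * (4 + m)) f ⟩
  12 * ((3 + m) * (4 + m) * f)              ≤⟨ *-monoʳ-≤ 12 (m≤m+n ((3 + m) * (4 + m) * f) (4 + m)) ⟩
  12 * ((3 + m) * (4 + m) * f + (4 + m))    ≡⟨ cong (12 *_) (≡-sym (F-odd (2 + m))) ⟩
  12 * F (suc (double (3 + m)))             ∎
  where
  open ≤-Reasoning
  P = (2 + m) !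
  R = (3 + m) !
  f = F (suc (double (2 + m)))
  e₁ : ∀ a b p q → 27 * (a * p * (b * q)) ≡ a * b * (27 * (p * q))
  e₁ = solve-∀
  e₂ : ∀ a f → a * (12 * f) ≡ 12 * (a * f)
  e₂ = solve-∀

-- Dropping the additive term keeps the initial ratio, where `S 3 3` is 57.
S-lower : ∀ m → 57 * ((3 + m) ! * (3 + m) !) ≤ 36 * S (3 + m) (3 + m)
S-lower zero    = ≤-refl
S-lower (suc m) = begin
  57 * ((4 + m) * P * ((4 + m) * P))          ≡⟨ e₁ (4 + m) P ⟩
  (4 + m) * (4 + m) * (57 * (P * P))          ≤⟨ *-monoʳ-≤ ((4 + m) * (4 + m)) (S-lower m) ⟩
  (4 + m) * (4 + m) * (36 * s)                ≡⟨ e₂ ((4 + m) * (4 + m)) s ⟩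
  36 * ((4 + m) * (4 + m) * s)                ≤⟨ *-monoʳ-≤ 36 (m≤n+m ((4 + m) * (4 + m) * s) (4 + m)) ⟩
  36 * (4 + m + (4 + m) * (4 + m) * s)        ∎
  where
  open ≤-Reasoning
  P = (3 + m) !
  s = S (3 + m) (3 + m)
  e₁ : ∀ a p → 57 * (a * p * (a * p)) ≡ a * a * (57 * (p * p))
  e₁ = solve-∀
  e₂ : ∀ a f → a * (36 * f) ≡ 36 * (a * f)
  e₂ = solve-∀

F-even-upper₃ : ∀ m → F (double (3 + m)) ≤ 3 * ((3 + m) ! * (3 + m) !)
F-even-upper₃ m = *-cancelˡ-≤ 36 (begin
  36 * f                ≤⟨ *-monoʳ-≤ 36 (m≤m+n f 1) ⟩
  36 * (f + 1)          ≤⟨ F-even-upper m ⟩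
  85 * P                ≤⟨ *-monoˡ-≤ P (m≤m+n 85 23) ⟩
  108 * P               ≡⟨ *-assoc 36 3 P ⟩
  36 * (3 * P)          ∎)
  where
  open ≤-Reasoning
  f = F (double (3 + m))
  P = (3 + m) ! * (3 + m) !

-- With the constant 3 the new term and the old bound add up exactly to the new bound.
T-odd-step : ∀ a p f t → f ≤ 3 * (p * p) → t ≤ 3 * (suc a * p * p) →
  suc a * (a * f) + t ≤ 3 * (suc a * p * (suc a * p))
T-odd-step a p f t hf ht = begin
  suc a * (a * f) + t
    ≤⟨ +-mono-≤ (*-monoʳ-≤ (suc a) (*-monoʳ-≤ a hf)) ht ⟩
  suc a * (a * (3 * (p * p))) + 3 * (suc a * p * p)
    ≡⟨ eq a p ⟩
  3 * (suc a * p * (suc a * p)) ∎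
  where
  open ≤-Reasoning
  eq : ∀ a p → suc a * (a * (3 * (p * p))) + 3 * (suc a * p * p) ≡ 3 * (suc a * p * (suc a * p))
  eq = solve-∀

T-even-step : ∀ m p g t → 12 * (g + 1) ≤ 28 * (p * ((4 + m) * p)) → t ≤ 3 * ((4 + m) * p * ((4 + m) * p)) →
  (5 + m) * ((4 + m) * g) + t ≤ 3 * ((5 + m) * ((4 + m) * p) * ((4 + m) * p))
T-even-step m p g t hg ht = *-cancelˡ-≤ 12 (begin
  12 * ((5 + m) * ((4 + m) * g) + t)
    ≡⟨ e₁ (5 + m) (4 + m) g t ⟩
  (5 + m) * (4 + m) * (12 * g) + 12 * t
    ≤⟨ +-mono-≤ (*-monoʳ-≤ ((5 + m) * (4 + m)) (≤-trans (*-monoʳ-≤ 12 (m≤m+n g 1)) hg)) (*-monoʳ-≤ 12 ht) ⟩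
  (5 + m) * (4 + m) * (28 * (p * ((4 + m) * p))) + 12 * (3 * ((4 + m) * p * ((4 + m) * p)))
    -- The slack left by 28/12 being less than 3; it raises the sum to exactly 36 (5 + m) X.
    ≤⟨ m≤m+n _ (8 * m * X + 4 * X) ⟩
  (5 + m) * (4 + m) * (28 * (p * ((4 + m) * p))) + 12 * (3 * ((4 + m) * p * ((4 + m) * p))) + (8 * m * X + 4 * X)
    ≡⟨ e₂ m (4 + m) p ⟩
  12 * (3 * ((5 + m) * ((4 + m) * p) * ((4 + m) * p))) ∎)
  where
  open ≤-Reasoning
  X = (4 + m) * (4 + m) * (p * p)
  e₁ : ∀ a b g t → 12 * (a * (b * g) + t) ≡ a * b * (12 * g) + 12 * t
  e₁ = solve-∀
  e₂ : ∀ m b p → (5 + m) * b * (28 * (p * (b * p))) + 12 * (3 * (b * p * (b * p))) + (8 * m * (b * b * (p * p)) + 4 * (b * b * (p * p)))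
       ≡ 12 * (3 * ((5 + m) * (b * p) * (b * p)))
  e₂ = solve-∀

-- The two parities are proved together, starting from `T 8 = 408` against 3 * 4! * 3! = 432.
T-even-upper : ∀ m → T (double (4 + m)) ≤ 3 * ((4 + m) ! * (3 + m) !)
T-odd-upper : ∀ m → T (suc (double (4 + m))) ≤ 3 * ((4 + m) ! * (4 + m) !)
T-odd-upper m = ≤-trans (≤-reflexive (T-odd (3 + m)))
  (T-odd-step (3 + m) ((3 + m) !) (F (double (3 + m))) (T (double (4 + m))) (F-even-upper₃ m) (T-even-upper m))
T-even-upper zero    = m≤m+n 408 24
T-even-upper (suc m) = ≤-trans (≤-reflexive (T-even (3 + m)))
  (T-even-step m ((3 + m) !) (F (suc (double (3 + m)))) (T (suc (double (4 + m)))) (F-odd-upper (1 + m)) (T-odd-upper m))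

-- For `d = suc e` the hypothesis reads `5 * e + 3 ≤ 4 * M`; the square of the left-hand side is at
-- least 25 times `suc e * e`.
deg-odd : ∀ d M → 5 * d ≤ 4 * M + 2 → 25 * (d * (d ∸ 1)) ≤ 16 * (M * M)
deg-odd zero    M h = z≤n
deg-odd (suc e) M h = begin
  25 * (suc e * e)               ≤⟨ m≤m+n _ (5 * e + 9) ⟩
  25 * (suc e * e) + (5 * e + 9) ≡⟨ e₁ e ⟩
  (5 * e + 3) * (5 * e + 3)      ≤⟨ *-mono-≤ l l ⟩
  4 * M * (4 * M)                ≡⟨ e₂ M ⟩
  16 * (M * M)                   ∎
  where
  open ≤-Reasoning
  e₁ : ∀ e → 25 * (suc e * e) + (5 * e + 9) ≡ (5 * e + 3) * (5 * e + 3)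
  e₁ = solve-∀
  e₂ : ∀ M → 4 * M * (4 * M) ≡ 16 * (M * M)
  e₂ = solve-∀
  e₃ : ∀ e → 5 * e + 3 + 2 ≡ 5 * suc e
  e₃ = solve-∀
  l : 5 * e + 3 ≤ 4 * M
  l = +-cancelʳ-≤ 2 _ _ (≤-trans (≤-reflexive (e₃ e)) h)

-- For `d = suc e` the hypothesis also gives `5 * e ≤ 4 * a`; the two inequalities are multiplied.
deg-even : ∀ d a → 5 * d ≤ 4 * suc a → 25 * (d * (d ∸ 1)) ≤ 16 * (suc a * a)
deg-even zero    a h = z≤n
deg-even (suc e) a h = begin
  25 * (suc e * e)      ≡⟨ e₁ e ⟩
  5 * suc e * (5 * e)   ≤⟨ *-mono-≤ h l ⟩
  4 * suc a * (4 * a)   ≡⟨ e₂ a ⟩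
  16 * (suc a * a)      ∎
  where
  open ≤-Reasoning
  e₁ : ∀ e → 25 * (suc e * e) ≡ 5 * suc e * (5 * e)
  e₁ = solve-∀
  e₂ : ∀ a → 4 * suc a * (4 * a) ≡ 16 * (suc a * a)
  e₂ = solve-∀
  e₃ : ∀ e → 5 * e + 4 + 1 ≡ 5 * suc e
  e₃ = solve-∀
  e₄ : ∀ a → 4 * suc a ≡ 4 * a + 4
  e₄ = solve-∀
  l : 5 * e ≤ 4 * a
  l = +-cancelʳ-≤ 4 _ _ (≤-trans (m≤m+n (5 * e + 4) 1) (≤-trans (≤-reflexive (e₃ e)) (≤-trans h (≤-reflexive (e₄ a)))))

-- The constant 57/36 exceeds 16/25 · 85/36, where 16/25 stems from the degree d ≤ 2n/5.
odd-gap : ∀ m d → 42 ≤ 4 + m → 5 * d ≤ 4 * (4 + m) + 2 →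
  d * ((d ∸ 1) * F (double (3 + m))) + T (double (4 + m)) < (4 + m) * ((4 + m) * S (3 + m) (3 + m))
odd-gap m d M≥42 h = arithmetic (4 + m) ((3 + m) !) d (d ∸ 1) (F (double (3 + m))) (T (double (4 + m))) (S (3 + m) (3 + m))
  M≥42 (1≤n! (3 + m)) (deg-odd d (4 + m) h) (≤-trans (*-monoʳ-≤ 36 (m≤m+n (F (double (3 + m))) 1)) (F-even-upper m)) (T-even-upper m) (S-lower m)
  where
  scale : ∀ u v d c f t → u * v * (d * (c * f) + t) ≡ u * (d * c) * (v * f) + u * v * t
  scale = solve-∀
  scale₂ : ∀ u v w M p → u * v * (w * (M * p * p)) ≡ u * v * w * (M * (p * p))
  scale₂ = solve-∀
  collect : ∀ a b c M Y → a * (M * M) * (b * Y) + c * M * (M * Y) ≡ (a * b + c) * (M * M * Y)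
  collect = solve-∀
  scale₃ : ∀ a b M Y → a * b * (M * M * Y) ≡ a * (M * M) * (b * Y)
  scale₃ = solve-∀
  scale₄ : ∀ a b M s → a * (M * M) * (b * s) ≡ a * b * (M * (M * s))
  scale₄ = solve-∀
  arithmetic : ∀ M p d c f t s → 42 ≤ M → 1 ≤ p → 25 * (d * c) ≤ 16 * (M * M) → 36 * f ≤ 85 * (p * p) →
    t ≤ 3 * (M * p * p) → 57 * (p * p) ≤ 36 * s → d * (c * f) + t < M * (M * s)
  arithmetic M p d c f t s M≥42 p≥1 hd hf ht hs = *-cancelˡ-< (25 * 36) _ _ (begin-strict
    25 * 36 * (d * (c * f) + t)
      ≡⟨ scale 25 36 d c f t ⟩
    25 * (d * c) * (36 * f) + 25 * 36 * t
      ≤⟨ +-mono-≤ (*-mono-≤ hd hf) (*-monoʳ-≤ (25 * 36) ht) ⟩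
    16 * (M * M) * (85 * Y) + 25 * 36 * (3 * (M * p * p))
      ≡⟨ cong (16 * (M * M) * (85 * Y) +_) (scale₂ 25 36 3 M p) ⟩
    16 * (M * M) * (85 * Y) + 25 * 36 * 3 * (M * Y)
      -- 25 * 57 exceeds 16 * 85 by 65, and 65 * 42 = 2730 exceeds the 2700 = 25 * 36 * 3 due to
      -- `T`.
      <⟨ +-monoʳ-< (16 * (M * M) * (85 * Y)) (*-monoˡ-< (M * Y) {{>-nonZero MY>0}} (<-≤-trans (m<m+n 2700 {30} (s≤s z≤n)) (*-monoʳ-≤ 65 M≥42))) ⟩
    16 * (M * M) * (85 * Y) + 65 * M * (M * Y)
      ≡⟨ collect 16 85 65 M Y ⟩
    25 * 57 * (M * M * Y)
      ≡⟨ scale₃ 25 57 M Y ⟩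
    25 * (M * M) * (57 * Y)
      ≤⟨ *-monoʳ-≤ (25 * (M * M)) hs ⟩
    25 * (M * M) * (36 * s)
      ≡⟨ scale₄ 25 36 M s ⟩
    25 * 36 * (M * (M * s)) ∎)
    where
    open ≤-Reasoning
    Y = p * p
    MY>0 : 1 ≤ M * Y
    MY>0 = *-mono-≤ (≤-trans (m≤m+n 1 41) M≥42) (*-mono-≤ p≥1 p≥1)

-- By `S≡F` the path counts on both sides agree, so the degree alone decides: it costs 16 parts of
-- 25, and the other 9 exceed the contribution of `T`.
even-gap : ∀ m d → 4 ≤ 3 + m → 5 * d ≤ 4 * (4 + m) →
  d * ((d ∸ 1) * F (suc (double (2 + m)))) + T (suc (double (3 + m))) < (4 + m) * ((3 + m) * S (3 + m) (2 + m))
even-gap zero d (s≤s (s≤s (s≤s ()))) h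
even-gap (suc m) d l h = arithmetic (5 + m) (4 + m) ((3 + m) !) d (d ∸ 1) (F (suc (double (3 + m)))) (T (suc (double (4 + m))))
    (S (4 + m) (3 + m)) (S≡F (3 + m)) (s≤s (m≤m+n 4 m)) (*-mono-≤ {1} {4 + m} (s≤s z≤n) (1≤n! (3 + m)))
    (deg-even d (4 + m) h) (T-odd-upper m) (F-odd-lower (1 + m))
  where
  scale : ∀ u v d c f t → u * v * (d * (c * f) + t) ≡ u * (d * c) * (v * f) + u * v * t
  scale = solve-∀
  shape : ∀ u v w b p → u * v * (w * (b * p * (b * p))) ≡ u * v * w * b * (p * (b * p))
  shape = solve-∀
  shape′ : ∀ u v M b p → u * v * M * b * (p * (b * p)) ≡ u * (M * b) * (v * (p * (b * p)))
  shape′ = solve-∀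
  merge : ∀ u v w a f → u * a * (v * f) + w * a * (v * f) ≡ (u + w) * v * (a * f)
  merge = solve-∀
  arithmetic : ∀ M b p d c f t s → s ≡ f → 5 ≤ M → 1 ≤ b * p → 25 * (d * c) ≤ 16 * (M * b) →
    t ≤ 3 * (b * p * (b * p)) → 27 * (p * (b * p)) ≤ 12 * f → d * (c * f) + t < M * (b * s)
  arithmetic M b p d c f t .f refl M≥5 bp≥1 hd ht hf = *-cancelˡ-< (25 * 12) _ _ (begin-strict
    25 * 12 * (d * (c * f) + t)
      ≡⟨ scale 25 12 d c f t ⟩
    25 * (d * c) * (12 * f) + 25 * 12 * t
      ≤⟨ +-mono-≤ (*-monoˡ-≤ (12 * f) hd) (*-monoʳ-≤ (25 * 12) ht) ⟩
    16 * (M * b) * (12 * f) + 25 * 12 * (3 * (b * p * (b * p)))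
      ≡⟨ cong (16 * (M * b) * (12 * f) +_) (shape 25 12 3 b p) ⟩
    16 * (M * b) * (12 * f) + 25 * 12 * 3 * b * (p * (b * p))
      <⟨ +-monoʳ-< (16 * (M * b) * (12 * f)) gap ⟩
    16 * (M * b) * (12 * f) + 9 * 27 * M * b * (p * (b * p))
      ≡⟨ cong (16 * (M * b) * (12 * f) +_) (shape′ 9 27 M b p) ⟩
    16 * (M * b) * (12 * f) + 9 * (M * b) * (27 * (p * (b * p)))
      ≤⟨ +-monoʳ-≤ (16 * (M * b) * (12 * f)) (*-monoʳ-≤ (9 * (M * b)) hf) ⟩
    16 * (M * b) * (12 * f) + 9 * (M * b) * (12 * f)
      ≡⟨ merge 16 12 9 (M * b) f ⟩
    25 * 12 * (M * b * f)
      ≡⟨ cong (25 * 12 *_) (*-assoc M b f) ⟩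
    25 * 12 * (M * (b * f)) ∎)
    where
    open ≤-Reasoning
    positive : ∀ b p → 1 ≤ b * p → 1 ≤ b * (p * (b * p))
    positive b p h = ≤-trans (*-mono-≤ h h) (≤-reflexive (*-assoc b p (b * p)))
    regroup : ∀ c b q → c * b * q ≡ c * (b * q)
    regroup = solve-∀
    gap : 25 * 12 * 3 * b * (p * (b * p)) < 9 * 27 * M * b * (p * (b * p))
    gap = begin-strict
      25 * 12 * 3 * b * (p * (b * p))
        ≡⟨ regroup (25 * 12 * 3) b (p * (b * p)) ⟩
      25 * 12 * 3 * (b * (p * (b * p)))
        -- 9 * 27 * 5 = 1215 exceeds 25 * 12 * 3 = 900.
        <⟨ *-monoˡ-< (b * (p * (b * p))) {{>-nonZero (positive b p bp≥1)}} (<-≤-trans (m<m+n 900 {315} (s≤s z≤n)) (*-monoʳ-≤ (9 * 27) M≥5)) ⟩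
      9 * 27 * M * (b * (p * (b * p)))
        ≡⟨ ≡-sym (regroup (9 * 27 * M) b (p * (b * p))) ⟩
      9 * 27 * M * b * (p * (b * p)) ∎

-- Degrees and complete bipartite graphs

deg : SimpleGraph n → Fin n → ℕ
deg G x = # (adj G x)

-- Summing over the last vertex z of the cycle instead of the vertex w after y.
closed-by-ends : (G : SimpleGraph n) (x : Fin n) (k : ℕ) (V : VSet n) →
  closed G x k V ≡ (Σ[ V ∖ x ∩ adj G x ] λ y → Σ[ V ∖ x ∖ y ∩ adj G x ] λ z → paths G z k y (V ∖ x ∖ y ∖ z))
closed-by-ends G x k V = Σ-cong (V ∖ x ∩ adj G x) λ y _ →
  -- Together with the edge from `y` to `x`, both inner sums equal `paths G x (suc k) y`, read from
  -- the front and from the end.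
  +-cancelˡ-≡ ⟦ adj G y x ⟧ _ _ (paths-last G x k y (V ∖ x ∖ y))

-- The first and the last vertex are two different neighbours of `x`, and the path between them has
-- all but three vertices of `V` at its disposal.
closed≤ : (G : SimpleGraph n) → TriangleFree G → (x : Fin n) (k : ℕ) (V : VSet n) → V x ≡ true →
  closed G x k V ≤ deg G x * ((deg G x ∸ 1) * F (# V ∸ 3))
closed≤ G tf x k V Vx = begin
  closed G x k V
    ≡⟨ closed-by-ends G x k V ⟩
  (Σ[ V ∖ x ∩ adj G x ] λ y → Σ[ V ∖ x ∖ y ∩ adj G x ] λ z → paths G z k y (V ∖ x ∖ y ∖ z))
    ≤⟨ Σ-≤-const (V ∖ x ∩ adj G x) per-y ⟩
  # (V ∖ x ∩ adj G x) * ((deg G x ∸ 1) * F (# V ∸ 3))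
    ≤⟨ *-monoˡ-≤ _ (#-mono {U = V ∖ x ∩ adj G x} (λ i → ∧-snd {(V ∖ x) i})) ⟩
  deg G x * ((deg G x ∸ 1) * F (# V ∸ 3)) ∎
  where
  open ≤-Reasoning
  size : ∀ y z → (V ∖ x) y ≡ true → (V ∖ x ∖ y) z ≡ true → # (V ∖ x ∖ y ∖ z) ≡ # V ∸ 3
  size y z p q = ≡-sym (cong (_∸ 3) (trans (#-remove V Vx) (cong suc (trans (#-remove (V ∖ x) p) (cong suc (#-remove (V ∖ x ∖ y) q))))))
  per-y : ∀ y → (V ∖ x ∩ adj G x) y ≡ true →
    (Σ[ V ∖ x ∖ y ∩ adj G x ] λ z → paths G z k y (V ∖ x ∖ y ∖ z)) ≤ (deg G x ∸ 1) * F (# V ∸ 3)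
  per-y y p = ≤-trans
    (Σ-≤-const (V ∖ x ∖ y ∩ adj G x) λ z q →
      paths≤F G tf z (# V ∸ 3) k y _ (size y z (∧-fst {(V ∖ x) y} p) (∧-fst {(V ∖ x ∖ y) z} q)))
    (*-monoˡ-≤ (F (# V ∸ 3)) (≤-trans
      (#-mono {U = V ∖ x ∖ y ∩ adj G x} {V = adj G x ∖ y} λ z q →
        ∖-in (adj G x) (∧-snd {(V ∖ x ∖ y) z} q) (∖-≢ (V ∖ x) (∧-fst {(V ∖ x ∖ y) z} q)))
      (≤-reflexive (≡-sym (cong (_∸ 1) (#-remove (adj G x) (∧-snd {(V ∖ x) y} p)))))))

numCycles-edgeless : (G : SimpleGraph n) → (∀ i j → adj G i j ≡ true → ⊥) → numCycles G ≡ 0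
numCycles-edgeless {n} G none = empty (filterᵇ (λ H → subB H G ∧ isCycleB H) (allMatrices n)) λ {H} H∈ →
  let e = proj₂ (∈-filterᵇ⁻ _ {allMatrices n} H∈)
      (vs , c) = isCycleB⁻ H (∧-snd {subB H G} e)
      (i , j , p) = has-edge vs (CycleOn.cyc-length c)
  in none i j (subB⁻ H G (∧-fst e) i j (trans (CycleOn.cyc-edges c i j) (cycAdj⁺ vs (inj₁ p))))
  where
  empty : (Hs : List (Matrix n)) → (∀ {H} → H ∈ Hs → ⊥) → length Hs ≡ 0
  empty []      h = refl
  empty (H ∷ _) h = ⊥-elim (h (here refl))
  has-edge : (vs : List (Fin n)) → 3 ≤ length vs → ∃[ i ] ∃[ j ] (i , j) ∈ cycPairs vs
  has-edge (i ∷ j ∷ vs) _ = i , j , here refl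
  has-edge (i ∷ []) (s≤s ())

-- Vertices outside `V` are the deleted ones, now isolated; by symmetry of adjacency the condition
-- covers both ends.
Alive : SimpleGraph n → VSet n → Set
Alive {n} G V = ∀ {i j : Fin n} → adj G i j ≡ true → V j ≡ true

alive-⊝ : (G : SimpleGraph n) (V : VSet n) (x : Fin n) → Alive G V → Alive (G ⊝ x) (V ∖ x)
alive-⊝ G V x a e = let (p , _ , q) = ⊝-adj⁻ G e in ∖-in V (a p) q

triangleFree-⊝ : (G : SimpleGraph n) (x : Fin n) → TriangleFree G → TriangleFree (G ⊝ x)
triangleFree-⊝ G x tf (a , b , c , p , q , r) =
  tf (a , b , c , proj₁ (⊝-adj⁻ G p) , proj₁ (⊝-adj⁻ G q) , proj₁ (⊝-adj⁻ G r))

-- The neighbourhoods of two adjacent vertices are disjoint, so one of them has at most half the vertices.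
small-degree : (G : SimpleGraph n) → TriangleFree G → (V : VSet n) → Alive G V → ∀ {k} → # V ≡ suc k →
  ∃[ x ] (V x ≡ true × deg G x ≤ ⌊ suc k /2⌋)
small-degree G tf V al {k} e with #-pos V (≤-trans (s≤s z≤n) (≤-reflexive (≡-sym e)))
... | x , Vx with deg G x in d
...   | zero = x , Vx , ≤-trans (≤-reflexive d) z≤n
...   | suc _ with #-pos (adj G x) (≤-trans (s≤s z≤n) (≤-reflexive (≡-sym d)))
...     | y , xy = [ (λ l → x , Vx , halve (≤-trans (+-monoʳ-≤ (deg G x) l) both)) ,
                     (λ l → y , al xy , halve (≤-trans (+-monoˡ-≤ (deg G y) l) both)) ]′ (≤-total (deg G x) (deg G y))
  where
  both : deg G x + deg G y ≤ suc k
  both = ≤-trans (#-disjoint {U = adj G x} {V = adj G y} {W = V} (λ i → al) (λ i → al)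
    (λ i p q → true≢false q (no-triangle G tf xy p))) (≤-reflexive e)
  halve : ∀ {d} → d + d ≤ suc k → d ≤ ⌊ suc k /2⌋
  halve {d} h = ≤-trans (≤-reflexive (n≡⌊n+n/2⌋ d)) (⌊n/2⌋-mono h)

numCycles≤T : ∀ k (G : SimpleGraph n) (V : VSet n) → TriangleFree G → Alive G V → # V ≡ k → 2 * numCycles G ≤ T k
numCycles≤T zero    G V tf al e = ≤-trans (≤-reflexive (cong (2 *_) (numCycles-edgeless G
  (λ i j p → true≢false (al p) (#-zero V e j))))) z≤n
numCycles≤T {n} (suc k) G V tf al e = let (x , Vx , d≤) = small-degree G tf V al e in begin
  2 * numCycles G
    ≡⟨ CyclesThrough.numCycles-remove G x V al ⟩
  closed G x n V + 2 * numCycles (G ⊝ x)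
    ≤⟨ +-mono-≤ (≤-trans (closed≤ G tf x n V Vx)
         (≤-trans (*-mono-≤ d≤ (*-monoˡ-≤ (F (# V ∸ 3)) (∸-monoˡ-≤ 1 d≤)))
           (≤-reflexive (cong (λ s → ⌊ suc k /2⌋ * ((⌊ suc k /2⌋ ∸ 1) * F (s ∸ 3))) e))))
         (numCycles≤T k (G ⊝ x) (V ∖ x) (triangleFree-⊝ G x tf) (alive-⊝ G V x al) (#-remove′ V Vx e)) ⟩
  T (suc k) ∎
  where open ≤-Reasoning

numCycles-cong : (G H : SimpleGraph n) → (∀ i j → adj G i j ≡ adj H i j) → numCycles G ≡ numCycles H
numCycles-cong {n} G H e = filterᵇ-cong (λ M → cong (_∧ isCycleB M) (bool-ext
  (λ s → subB⁺ M H λ i j h → trans (≡-sym (e i j)) (subB⁻ M G s i j h))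
  (λ s → subB⁺ M G λ i j h → trans (e i j) (subB⁻ M H s i j h)))) (allMatrices n)

xorB-comm : ∀ a b → xorB a b ≡ xorB b a
xorB-comm true  true  = refl
xorB-comm true  false = refl
xorB-comm false true  = refl
xorB-comm false false = refl

xorB-self : ∀ a → xorB a a ≡ false
xorB-self true  = refl
xorB-self false = refl

-- The complete bipartite graph on `V` whose classes are the colours of `f`; vertices outside `V`
-- stay isolated, in accordance with `_⊝_`.
K : VSet n → VSet n → SimpleGraph n
K f V = record
  { adj    = λ i j → (V i ∧ V j) ∧ xorB (f i) (f j)
  ; sym    = λ i j → cong₂ _∧_ (∧-comm (V i) (V j)) (xorB-comm (f i) (f j))
  ; irrefl = λ i → trans (cong ((V i ∧ V i) ∧_) (xorB-self (f i))) (∧-zeroʳ (V i ∧ V i)) }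

#-∖-in : (U P : VSet n) {w : Fin n} → U w ≡ true → P w ≡ true → # (U ∩ P) ≡ suc (# ((U ∖ w) ∩ P))
#-∖-in U P {w} u p = trans (#-remove (U ∩ P) (∧-intro u p)) (cong suc (#-cong λ i →
  trans (∧-assoc (U i) (P i) _) (trans (cong (U i ∧_) (∧-comm (P i) _)) (≡-sym (∧-assoc (U i) _ (P i))))))

#-∖-out : (U P : VSet n) {w : Fin n} → P w ≡ false → # ((U ∖ w) ∩ P) ≡ # (U ∩ P)
#-∖-out U P {w} p = #-cong λ i → bool-ext
  (λ e → ∧-intro (∖-⊆ U (∧-fst {(U ∖ w) i} e)) (∧-snd {(U ∖ w) i} e))
  (λ e → ∧-intro (∖-in U (∧-fst e) (λ { refl → true≢false (∧-snd {U i} e) p })) (∧-snd {U i} e))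

-- The analogue of S for end vertices in opposite classes.
W : ℕ → ℕ → ℕ
W a zero    = 1
W a (suc b) = 1 + suc b * S a b

S-W : ∀ a b → S (suc a) b ≡ suc a * W a b
S-W a zero    = ≡-sym (*-identityʳ (suc a))
S-W a (suc b) = expand (suc a) (suc b) (S a b)
  where
  expand : ∀ a b s → a + a * b * s ≡ a * (1 + b * s)
  expand = solve-∀

-- Twice the number of cycles through a vertex with a vertices in the opposite and b others in its own class.
Q : ℕ → ℕ → ℕ
Q zero    b       = 0
Q (suc a) zero    = 0
Q (suc a) (suc b) = suc a * (suc b * S a b)

module Complete (f : VSet n) (V : VSet n) (x : Fin n) (Vx : V x ≡ true) where

  opp same : VSet n
  opp i  = xorB (f x) (f i)
  same i = not (opp i)

  private
    G = K f V

    adj-same : ∀ v w → V v ≡ true → opp v ≡ false → V w ≡ true → adj G v w ≡ opp w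
    adj-same v w Vv o Vw rewrite Vv | Vw = lemma (f x) (f v) (f w) o
      where
      lemma : ∀ a b c → xorB a b ≡ false → xorB b c ≡ xorB a c
      lemma true  true  c _ = refl
      lemma false false c _ = refl

    adj-opp : ∀ v w → V v ≡ true → opp v ≡ true → V w ≡ true → adj G v w ≡ same w
    adj-opp v w Vv o Vw rewrite Vv | Vw = lemma (f x) (f v) (f w) o
      where
      lemma : ∀ a b c → xorB a b ≡ true → xorB b c ≡ not (xorB a c)
      lemma true  false c _ = ≡-sym (not-involutive c)
      lemma false true  c _ = refl

    opp-x : opp x ≡ false
    opp-x = xorB-self (f x)

    nbrs-same : ∀ v (U : VSet n) → (∀ i → U i ≡ true → V i ≡ true) → V v ≡ true → opp v ≡ false → ∀ i → (U ∩ adj G v) i ≡ (U ∩ opp) i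
    nbrs-same v U s Vv o i with U i in u
    ... | false = refl
    ... | true  = adj-same v i Vv o (s i u)

    nbrs-opp : ∀ v (U : VSet n) → (∀ i → U i ≡ true → V i ≡ true) → V v ≡ true → opp v ≡ true → ∀ i → (U ∩ adj G v) i ≡ (U ∩ same) i
    nbrs-opp v U s Vv o i with U i in u
    ... | false = refl
    ... | true  = adj-opp v i Vv o (s i u)

  -- The two statements alternate as the path changes class; `a + b ≤ k` ensures that the length
  -- bound cuts off no path.
  paths-same : ∀ k v (U : VSet n) a b → (∀ i → U i ≡ true → V i ≡ true) → V v ≡ true → opp v ≡ false →
    # (U ∩ opp) ≡ a → # (U ∩ same) ≡ b → a + b ≤ k → paths G x k v U ≡ S a b
  paths-opp : ∀ k v (U : VSet n) a b → (∀ i → U i ≡ true → V i ≡ true) → V v ≡ true → opp v ≡ true →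
    # (U ∩ opp) ≡ a → # (U ∩ same) ≡ b → a + b ≤ k → paths G x k v U ≡ W a b

  paths-same zero v U zero b s Vv o _ _ _ = cong ⟦_⟧ (trans (adj-same v x Vv o Vx) opp-x)
  paths-same (suc k) v U zero b s Vv o ea eb l = cong₂ _+_ (cong ⟦_⟧ (trans (adj-same v x Vv o Vx) opp-x))
    (trans (Σ-congˡ (nbrs-same v U s Vv o) _) (Σ-zero (U ∩ opp) ea _))
  paths-same (suc k) v U (suc a) b s Vv o ea eb (s≤s l) = begin
    ⟦ adj G v x ⟧ + (Σ[ U ∩ adj G v ] λ w → paths G x k w (U ∖ w))
      ≡⟨ cong₂ _+_ (cong ⟦_⟧ (trans (adj-same v x Vv o Vx) opp-x)) (Σ-congˡ (nbrs-same v U s Vv o) _) ⟩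
    (Σ[ U ∩ opp ] λ w → paths G x k w (U ∖ w))
      ≡⟨ Σ-≡-const (U ∩ opp) (λ w p → paths-opp k w (U ∖ w) a b (λ i q → s i (∖-⊆ U q)) (s w (∧-fst p)) (∧-snd {U w} p)
           (suc-injective (trans (≡-sym (#-∖-in U opp (∧-fst p) (∧-snd {U w} p))) ea))
           (trans (#-∖-out U same (cong not (∧-snd {U w} p))) eb) l) ⟩
    # (U ∩ opp) * W a b
      ≡⟨ cong (_* W a b) ea ⟩
    suc a * W a b
      ≡⟨ ≡-sym (S-W a b) ⟩
    S (suc a) b ∎
    where open ≡-Reasoning

  paths-opp zero v U zero zero s Vv o _ _ _ = cong ⟦_⟧ (trans (adj-opp v x Vv o Vx) (cong not opp-x))
  paths-opp (suc k) v U a zero s Vv o ea eb l = cong₂ _+_ (cong ⟦_⟧ (trans (adj-opp v x Vv o Vx) (cong not opp-x)))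
    (trans (Σ-congˡ (nbrs-opp v U s Vv o) _) (Σ-zero (U ∩ same) eb _))
  paths-opp zero v U a (suc b) s Vv o ea eb l = contradiction (≤-trans (m≤n+m (suc b) a) l) λ ()
  paths-opp (suc k) v U a (suc b) s Vv o ea eb l = cong₂ _+_ (cong ⟦_⟧ (trans (adj-opp v x Vv o Vx) (cong not opp-x))) (begin
    (Σ[ U ∩ adj G v ] λ w → paths G x k w (U ∖ w))
      ≡⟨ Σ-congˡ (nbrs-opp v U s Vv o) _ ⟩
    (Σ[ U ∩ same ] λ w → paths G x k w (U ∖ w))
      ≡⟨ Σ-≡-const (U ∩ same) (λ w p → paths-same k w (U ∖ w) a b (λ i q → s i (∖-⊆ U q)) (s w (∧-fst p)) (not-true⁻ (∧-snd {U w} p))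
           (trans (#-∖-out U opp (not-true⁻ (∧-snd {U w} p))) ea)
           (suc-injective (trans (≡-sym (#-∖-in U same (∧-fst p) (∧-snd {U w} p))) eb))
           (≤-pred (≤-trans (≤-reflexive (≡-sym (+-suc a b))) l))) ⟩
    # (U ∩ same) * S a b
      ≡⟨ cong (_* S a b) eb ⟩
    suc b * S a b ∎)
    where open ≡-Reasoning

  closed-K : ∀ k a b → # (V ∩ opp) ≡ a → # (V ∩ same) ≡ suc b → a + b ≤ k → closed G x k V ≡ Q a b
  closed-K k a b ea eb l = begin
    (Σ[ V ∖ x ∩ adj G x ] λ y → Σ[ V ∖ x ∖ y ∩ adj G y ] λ w → paths G x k w (V ∖ x ∖ y ∖ w))
      ≡⟨ Σ-congˡ (nbrs-same x (V ∖ x) (λ i → ∖-⊆ V) Vx opp-x) _ ⟩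
    (Σ[ V ∖ x ∩ opp ] λ y → Σ[ V ∖ x ∖ y ∩ adj G y ] λ w → paths G x k w (V ∖ x ∖ y ∖ w))
      ≡⟨ outer a ea′ l ⟩
    Q a b ∎
    where
    open ≡-Reasoning
    ea′ : # (V ∖ x ∩ opp) ≡ a
    ea′ = trans (#-∖-out V opp opp-x) ea
    eb′ : # (V ∖ x ∩ same) ≡ b
    eb′ = suc-injective (trans (≡-sym (#-∖-in V same Vx (cong not opp-x))) eb)
    -- For `b` equal to 0 the range of `w` is empty and both sides vanish, so `b ∸ 1` needs no case
    -- distinction.
    inner-sum : ∀ a b y → (V ∖ x ∩ opp) y ≡ true → # (V ∖ x ∩ opp) ≡ suc a → # (V ∖ x ∩ same) ≡ b → suc a + b ≤ k →
      (Σ[ V ∖ x ∖ y ∩ adj G y ] λ w → paths G x k w (V ∖ x ∖ y ∖ w)) ≡ # (V ∖ x ∖ y ∩ same) * S a (b ∸ 1)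
    inner-sum a b y p ea eb l = trans
      (Σ-congˡ (nbrs-opp y (V ∖ x ∖ y) (λ i q → ∖-⊆ V (∖-⊆ (V ∖ x) q)) (∖-⊆ V (∧-fst {(V ∖ x) y} p)) (∧-snd {(V ∖ x) y} p)) _)
      (Σ-≡-const (V ∖ x ∖ y ∩ same) λ w q →
        paths-same k w (V ∖ x ∖ y ∖ w) a (b ∸ 1) (λ i r → ∖-⊆ V (∖-⊆ (V ∖ x) (∖-⊆ (V ∖ x ∖ y) r)))
          (∖-⊆ V (∖-⊆ (V ∖ x) (∧-fst {(V ∖ x ∖ y) w} q))) (not-true⁻ (∧-snd {(V ∖ x ∖ y) w} q))
          (trans (#-∖-out (V ∖ x ∖ y) opp (not-true⁻ (∧-snd {(V ∖ x ∖ y) w} q)))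
            (suc-injective (trans (≡-sym (#-∖-in (V ∖ x) opp (∧-fst {(V ∖ x) y} p) (∧-snd {(V ∖ x) y} p))) ea)))
          (≡-sym (cong (_∸ 1) (trans (≡-sym (trans (#-∖-out (V ∖ x) same (cong not (∧-snd {(V ∖ x) y} p))) eb))
            (#-∖-in (V ∖ x ∖ y) same (∧-fst {(V ∖ x ∖ y) w} q) (∧-snd {(V ∖ x ∖ y) w} q)))))
          (≤-trans (+-monoʳ-≤ a (m∸n≤m b 1)) (≤-trans (n≤1+n _) l)))
    outer : ∀ a → # (V ∖ x ∩ opp) ≡ a → a + b ≤ k →
      (Σ[ V ∖ x ∩ opp ] λ y → Σ[ V ∖ x ∖ y ∩ adj G y ] λ w → paths G x k w (V ∖ x ∖ y ∖ w)) ≡ Q a b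
    outer zero    ea l = Σ-zero (V ∖ x ∩ opp) ea _
    outer (suc a) ea l = trans
      (Σ-≡-const (V ∖ x ∩ opp) (λ y p → trans (inner-sum a b y p ea eb′ l)
        (cong (_* S a (b ∸ 1)) (trans (#-∖-out (V ∖ x) same (cong not (∧-snd {(V ∖ x) y} p))) eb′))))
      (trans (cong (_* (b * S a (b ∸ 1))) ea) (as-Q a b))
      where
      as-Q : ∀ a b → suc a * (b * S a (b ∸ 1)) ≡ Q (suc a) b
      as-Q a zero    = *-zeroʳ a
      as-Q a (suc b) = refl

-- Comparison of complete bipartite graphs

-- Twice the number of cycles of the complete bipartite graph with classes of sizes a and b.
C : ℕ → ℕ → ℕ
C zero    b = 0
C (suc a) b = Q b a + C a b

K-alive : (f V : VSet n) → Alive (K f V) V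
K-alive f V {i} {j} e = ∧-snd {V i} (∧-fst e)

K-⊝ : (f V : VSet n) (x : Fin n) → ∀ i j → adj (K f V ⊝ x) i j ≡ adj (K f (V ∖ x)) i j
K-⊝ f V x i j = rearrange (V i) (V j) (xorB (f i) (f j)) (not (eqF i x)) (not (eqF j x))
  where
  rearrange : ∀ a b c p q → ((a ∧ b) ∧ c) ∧ (p ∧ q) ≡ ((a ∧ p) ∧ (b ∧ q)) ∧ c
  rearrange false b     c p     q = refl
  rearrange true  false c false q = refl
  rearrange true  false c true  q = refl
  rearrange true  true  false false q = refl
  rearrange true  true  false true  false = refl
  rearrange true  true  false true  true = refl
  rearrange true  true  true  false q = refl
  rearrange true  true  true  true  false = refl
  rearrange true  true  true  true  true = refl

cycles-K : (f V : VSet n) (x : Fin n) (a b : ℕ) → V x ≡ true →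
  # (V ∩ (λ i → xorB (f x) (f i))) ≡ a → # (V ∩ (λ i → not (xorB (f x) (f i)))) ≡ suc b →
  2 * numCycles (K f V) ≡ Q a b + 2 * numCycles (K f (V ∖ x))
cycles-K {n} f V x a b Vx ea eb = trans (CyclesThrough.numCycles-remove (K f V) x V (K-alive f V))
  (cong₂ _+_ (Complete.closed-K f V x Vx n a b ea eb (≤-trans (n≤1+n _) (≤-trans (≤-reflexive total) (#-≤n V))))
    (cong (2 *_) (numCycles-cong (K f V ⊝ x) (K f (V ∖ x)) (K-⊝ f V x))))
  where
  total : suc (a + b) ≡ # V
  total = trans (≡-sym (+-suc a b)) (≡-sym (trans (#-split V _) (cong₂ _+_ ea eb)))

cycles-C : (a b : ℕ) (f V : VSet n) → # (V ∩ f) ≡ a → # (V ∩ (not ∘ f)) ≡ b → 2 * numCycles (K f V) ≡ C a b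
cycles-C zero b f V ea eb = cong (2 *_) (numCycles-edgeless (K f V) λ i j e →
  let none = λ k → #-zero (V ∩ f) ea k
      Vi = ∧-fst {V i} (∧-fst {V i ∧ V j} e)
      Vj = ∧-snd {V i} (∧-fst {V i ∧ V j} e)
  in same-colour (colour i Vi (none i)) (colour j Vj (none j)) (∧-snd {V i ∧ V j} e))
  where
  colour : ∀ i → V i ≡ true → (V ∩ f) i ≡ false → f i ≡ false
  colour i Vi e rewrite Vi = e
  same-colour : ∀ {p q} → p ≡ false → q ≡ false → xorB p q ≡ true → ⊥
  same-colour refl refl ()
cycles-C (suc a) b f V ea eb with #-pos (V ∩ f) (≤-trans (s≤s z≤n) (≤-reflexive (≡-sym ea)))
... | x , p = trans
  (cycles-K f V x b a (∧-fst p)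
    (trans (#-cong λ i → cong (λ c → V i ∧ xorB c (f i)) fx) eb)
    (trans (#-cong λ i → trans (cong (λ c → V i ∧ not (xorB c (f i))) fx) (cong (V i ∧_) (not-involutive (f i)))) ea))
  (cong (Q b a +_) (cycles-C a b f (V ∖ x) (suc-injective (trans (≡-sym (#-∖-in V f (∧-fst p) fx)) ea))
    (trans (#-∖-out V (not ∘ f) (cong not fx)) eb)))
  where fx = ∧-snd {V x} p

cycles-full : (f : VSet n) → 2 * numCycles (K f full) ≡ C (# f) (# (not ∘ f))
cycles-full f = cycles-C _ _ f full refl refl

threshold : ℕ → VSet n
threshold a i = toℕ i <ᵇ a

#-threshold : ∀ a b → # (threshold {a + b} a) ≡ a
#-threshold zero    b = n≤0⇒n≡0 (≮⇒≥ λ l → let (i , p) = #-pos _ l in true≢false p refl)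
#-threshold (suc a) b = trans (#-suc (threshold (suc a))) (cong suc (#-threshold a b))

#-not : (f : VSet n) {a b : ℕ} → a + b ≡ n → # f ≡ a → # (not ∘ f) ≡ b
#-not f {a} {b} s e = +-cancelˡ-≡ a _ _ (trans (cong (_+ # (not ∘ f)) (≡-sym e))
  (trans (≡-sym (#-split full f)) (trans #-full (≡-sym s))))

-- The recursion for C removes vertices of the first class; on the graph itself one may equally well
-- remove a vertex of the second class.
C-step : ∀ a b → C a (suc b) ≡ Q a b + C a b
C-step a b = begin
  C a (suc b)
    ≡⟨ ≡-sym (cong₂ C ea eb) ⟩
  C (# f) (# (not ∘ f))
    ≡⟨ ≡-sym (cycles-full f) ⟩
  2 * numCycles (K f full)
    ≡⟨ cycles-K f full x a b refl
         (trans (#-cong (λ i → cong (λ c → xorB c (f i)) fx)) ea)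
         (trans (#-cong (λ i → cong (λ c → not (xorB c (f i))) fx)) eb) ⟩
  Q a b + 2 * numCycles (K f (full ∖ x))
    ≡⟨ cong (Q a b +_) (cycles-C a b f (full ∖ x) (trans (#-∖-out full f fx) ea)
         (suc-injective (trans (≡-sym (#-∖-in full (not ∘ f) refl (not-true fx))) eb))) ⟩
  Q a b + C a b ∎
  where
  open ≡-Reasoning
  f : VSet (a + suc b)
  f = threshold a
  ea : # f ≡ a
  ea = #-threshold a (suc b)
  eb : # (not ∘ f) ≡ suc b
  eb = #-not f refl ea
  picked = #-pos (not ∘ f) (≤-trans (s≤s z≤n) (≤-reflexive (≡-sym eb)))
  x = proj₁ picked
  fx : f x ≡ false
  fx = not-true⁻ (proj₂ picked)

-- The factor `suc a * suc b` is symmetric; the difference comes from the additive terms, the paths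
-- with one interior vertex.
S-swap-< : ∀ a b → a < b → S a b < S b a
S-swap-< zero    (suc b) _       = s≤s z≤n
S-swap-< (suc a) (suc b) (s≤s l) = +-mono-<-≤ (s≤s l)
  (≤-trans (≤-reflexive (cong (_* S a b) (*-comm (suc a) (suc b)))) (*-monoʳ-≤ (suc b * suc a) (<⇒≤ (S-swap-< a b l))))

-- Both sides contain the same two factors, which leaves `S` with its arguments exchanged.
Q-swap-< : ∀ a b → suc a < b → Q (suc a) b < Q b (suc a)
Q-swap-< a (suc b) (s≤s l) = begin-strict
  suc a * (suc b * S a b)    ≡⟨ swap-factors (suc a) (suc b) (S a b) ⟩
  suc b * (suc a * S a b)    <⟨ *-monoʳ-< (suc b) (*-monoʳ-< (suc a) (S-swap-< a b l)) ⟩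
  suc b * (suc a * S b a)    ∎
  where
  open ≤-Reasoning
  swap-factors : ∀ a b s → a * (b * s) ≡ b * (a * s)
  swap-factors = solve-∀

Q-swap-≤ : ∀ a b → a ≤ b → Q a b ≤ Q b a
Q-swap-≤ zero    b l = z≤n
Q-swap-≤ (suc a) b l with m≤n⇒m<n∨m≡n l
... | inj₁ lt   = <⇒≤ (Q-swap-< a b lt)
... | inj₂ refl = ≤-refl

-- Both graphs arise from the one with classes `a` and `b` by adding a vertex, to the second class
-- or to the first, so only the cycles through it are compared.
C-balance-≤ : ∀ a b → a ≤ b → C a (suc b) ≤ C (suc a) b
C-balance-≤ a b l = ≤-trans (≤-reflexive (C-step a b)) (+-monoˡ-≤ (C a b) (Q-swap-≤ a b l))

C-balance-< : ∀ a b → suc a < b → C (suc a) (suc b) < C (suc (suc a)) b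
C-balance-< a b l = ≤-<-trans (≤-reflexive (C-step (suc a) b)) (+-monoˡ-< (C (suc a) b) (Q-swap-< a b l))

-- Vertices move one at a time, and strictness is asked only of the last move: a move into an empty
-- class creates no cycle. `1 ≤ a + j` says that the last move finds the class non-empty.
C-unbalanced : ∀ j a b → 1 ≤ a + j → suc a + j ≤ b → C a (suc j + b) < C (suc a + j) b
C-unbalanced zero    a b h l rewrite +-identityʳ a = last-step a h l
  where
  last-step : ∀ a → 1 ≤ a → suc a ≤ b → C a (suc b) < C (suc a) b
  last-step (suc a) _ l = C-balance-< a b l
C-unbalanced (suc j) a b h l rewrite +-suc a j = ≤-<-trans
  (C-balance-≤ a (suc j + b) (≤-trans (≤-trans (m≤m+n a j) (≤-trans (n≤1+n _) (≤-trans (n≤1+n _) l))) (m≤n+m b (suc j))))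
  (C-unbalanced j (suc a) b (s≤s z≤n) l)

-- Every missing edge i j of the complete bipartite graph lies on a 4-cycle i j k l of it.
module MissingEdge (G : SimpleGraph n) (f : VSet n) (proper : ∀ i j → adj G i j ≡ true → xorB (f i) (f j) ≡ true) where

  numCycles≤K : numCycles G ≤ numCycles (K f full)
  numCycles≤K = filterᵇ-mono (λ H e → ∧-intro (subB⁺ H (K f full) λ i j h → proper i j (subB⁻ H G (∧-fst e) i j h)) (∧-snd {subB H G} e))
    (allMatrices n)

  numCycles<K : 2 ≤ # f → 2 ≤ # (not ∘ f) → ∀ {i j} → f i ≡ true → f j ≡ false → adj G i j ≡ false →
    numCycles G < numCycles (K f full)
  numCycles<K hf hg {i} {j} fi fj nij = filterᵇ-mono-<
    (λ H e → ∧-intro (subB⁺ H (K f full) λ i j h → proper i j (subB⁻ H G (∧-fst e) i j h)) (∧-snd {subB H G} e))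
    (allMatrices n) (∈-allMatrices H)
    (∧-intro (subB⁺ H (K f full) λ a b h → edge (cycAdj⁻ vs (trans (≡-sym (entry-cycleMatrix vs a b)) h)))
             (isCycleB⁺ H vs (mkCycleOn (s≤s (s≤s (s≤s z≤n))) distinct (entry-cycleMatrix vs))))
    (λ e → true≢false (subB⁻ H G (∧-fst e) i j (trans (entry-cycleMatrix vs i j) (cycAdj⁺ vs (inj₁ (here refl))))) nij)
    where
    another : (g : VSet n) {x : Fin n} → g x ≡ true → 2 ≤ # g → ∃[ y ] (g ∖ x) y ≡ true
    another g gx h = #-pos _ (≤-pred (≤-trans h (≤-reflexive (#-remove g gx))))
    k' = another f fi hf
    k = proj₁ k'
    l' = another (not ∘ f) (not-true fj) hg
    l = proj₁ l'
    fk : f k ≡ true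
    fk = ∖-⊆ f (proj₂ k')
    fl : f l ≡ false
    fl = not-true⁻ (∖-⊆ (not ∘ f) (proj₂ l'))
    vs = i ∷ j ∷ k ∷ l ∷ []
    H = cycleMatrix vs
    differ : ∀ {a b} → f a ≡ true → f b ≡ false → a ≢ b
    differ p q refl = true≢false p q
    distinct : Unique vs
    distinct = (differ fi fj ∷ (λ e → ∖-≢ f (proj₂ k') (≡-sym e)) ∷ differ fi fl ∷ []) ∷
      ((λ e → differ fk fj (≡-sym e)) ∷ (λ e → ∖-≢ (not ∘ f) (proj₂ l') (≡-sym e)) ∷ []) ∷
      (differ fk fl ∷ []) ∷ [] ∷ []
    tf : ∀ {p q} → p ≡ true → q ≡ false → xorB p q ≡ true
    tf refl refl = refl
    ft : ∀ {p q} → p ≡ false → q ≡ true → xorB p q ≡ true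
    ft refl refl = refl
    arc : ∀ {a b} → (a , b) ∈ cycPairs vs → xorB (f a) (f b) ≡ true
    arc (here refl)                         = tf fi fj
    arc (there (here refl))                 = ft fj fk
    arc (there (there (here refl)))         = tf fk fl
    arc (there (there (there (here refl)))) = ft fl fi
    edge : ∀ {a b} → EdgeIn (cycPairs vs) a b → xorB (f a) (f b) ≡ true
    edge (inj₁ p) = arc p
    edge {a} {b} (inj₂ p) = trans (xorB-comm (f a) (f b)) (arc p)

  complete-or-fewer : 2 ≤ # f → 2 ≤ # (not ∘ f) → numCycles G ≡ numCycles (K f full) →
    ∀ i j → adj G i j ≡ xorB (f i) (f j)
  complete-or-fewer hf hg e i j with adj G i j in a
  ... | true = ≡-sym (proper i j a)
  ... | false with f i in fi | f j in fj
  ...   | true  | true  = refl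
  ...   | false | false = refl
  ...   | true  | false = contradiction e (<⇒≢ (numCycles<K hf hg fi fj a))
  ...   | false | true  = contradiction e (<⇒≢ (numCycles<K hf hg fj fi (trans (SimpleGraph.sym G j i) a)))

-- Vertex `zero` is matched with some vertex of its own colour, which exists since the colour counts
-- agree; the remaining vertices are matched by induction.
relabel : (f g : VSet n) → # f ≡ # g → Σ (Permutation′ n) λ σ → ∀ i → f i ≡ g (σ ⟨$⟩ʳ i)
relabel {zero}  f g e = Perm.id , λ ()
relabel {suc n} f g e with partner (f zero) refl
  where
  partner : ∀ c → f zero ≡ c → ∃[ j ] g j ≡ f zero
  partner true  fz = let (j , p) = #-pos g (≤-trans (s≤s z≤n) (≤-reflexive (trans (≡-sym (#-remove f fz)) e)))
                     in j , trans p (≡-sym fz)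
  partner false fz = let (j , p) = #-pos (not ∘ g) (≤-trans (s≤s z≤n) (≤-reflexive (trans
                           (≡-sym (#-remove (not ∘ f) (not-true fz))) (≡-sym (#-not g (trans (≡-sym (#-split full f)) #-full) (≡-sym e))))))
                     in j , trans (not-true⁻ p) (≡-sym fz)
... | j , gj with relabel (f ∘ suc) (g ∘ punchIn j) (+-cancelˡ-≡ ⟦ f zero ⟧ _ _ (trans (≡-sym (#-suc f))
                    (trans e (trans (#-punchIn g j) (cong (λ b → ⟦ b ⟧ + # (g ∘ punchIn j)) gj)))))
...   | σ , h = Perm.insert zero j σ , λ where
          zero    → ≡-sym gj
          (suc i) → trans (h i) (cong g (≡-sym (Perm.insert-punchIn zero j σ i)))

-- Graphs of large minimum degree

-- An independent set of a 5-cycle has at most two vertices.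
five-cycle-bools : ∀ a b c d e → (a ≡ true → b ≡ false) → (b ≡ true → c ≡ false) → (c ≡ true → d ≡ false) →
  (d ≡ true → e ≡ false) → (e ≡ true → a ≡ false) → ⟦ a ⟧ + (⟦ b ⟧ + (⟦ c ⟧ + (⟦ d ⟧ + ⟦ e ⟧))) ≤ 2
five-cycle-bools true  b c d e ab bc cd de ea with ab refl | e | ea
... | refl | true  | ea′ = contradiction (ea′ refl) λ ()
... | refl | false | _ with c | d | cd
...   | true  | true  | cd′ = contradiction (cd′ refl) λ ()
...   | true  | false | _   = ≤-refl
...   | false | true  | _   = ≤-refl
...   | false | false | _   = s≤s z≤n
five-cycle-bools false true  c d e ab bc cd de ea with bc refl | d | e | de
... | refl | true  | true  | de′ = contradiction (de′ refl) λ ()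
... | refl | true  | false | _   = ≤-refl
... | refl | false | true  | _   = ≤-refl
... | refl | false | false | _   = s≤s z≤n
five-cycle-bools false false true  d e ab bc cd de ea with cd refl
... | refl = s≤s (⟦⟧≤1 e)
five-cycle-bools false false false d e ab bc cd de ea = +-mono-≤ (⟦⟧≤1 d) (⟦⟧≤1 e)

disjoint-bools : ∀ a b c → (a ≡ true → b ≡ false) → (b ≡ true → c ≡ false) → (a ≡ true → c ≡ false) → ⟦ a ⟧ + (⟦ b ⟧ + ⟦ c ⟧) ≤ 1
disjoint-bools true  b c ab bc ac rewrite ab refl | ac refl = ≤-refl
disjoint-bools false true c ab bc ac rewrite bc refl = ≤-refl
disjoint-bools false false c ab bc ac = ⟦⟧≤1 c

module LargeMinDegree (G : SimpleGraph n) (tf : TriangleFree G) (large : ∀ x → 2 * n < 5 * deg G x) where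

  private
    deg-Σ : ∀ x → deg G x ≡ (Σ[ full ] λ u → ⟦ adj G x u ⟧)
    deg-Σ x = ≡-sym (Σ-⟦⟧ full (adj G x))

    avoid : ∀ {a b} → adj G a b ≡ true → ∀ u → adj G a u ≡ true → adj G b u ≡ false
    avoid ab u au = no-triangle G tf ab au

  -- Consecutive vertices of the walk have no common neighbour, so every vertex is adjacent to at
  -- most two of the five positions. The five degrees would add up to at most 2n, yet each exceeds
  -- 2n/5.
  no-5-walk : ∀ {a b c d e} → adj G a b ≡ true → adj G b c ≡ true → adj G c d ≡ true → adj G d e ≡ true →
    adj G e a ≡ true → ⊥
  no-5-walk {a} {b} {c} {d} {e} ab bc cd de ea = <-irrefl refl (begin-strict
    2 * n + (2 * n + (2 * n + (2 * n + 2 * n)))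
      <⟨ +-mono-< (large a) (+-mono-< (large b) (+-mono-< (large c) (+-mono-< (large d) (large e)))) ⟩
    5 * deg G a + (5 * deg G b + (5 * deg G c + (5 * deg G d + 5 * deg G e)))
      ≡⟨ factor (deg G a) (deg G b) (deg G c) (deg G d) (deg G e) ⟩
    5 * (deg G a + (deg G b + (deg G c + (deg G d + deg G e))))
      ≤⟨ *-monoʳ-≤ 5 total ⟩
    5 * (n * 2)
      ≡⟨ five n ⟩
    2 * n + (2 * n + (2 * n + (2 * n + 2 * n))) ∎)
    where
    open ≤-Reasoning
    factor : ∀ a b c d e → 5 * a + (5 * b + (5 * c + (5 * d + 5 * e))) ≡ 5 * (a + (b + (c + (d + e))))
    factor = solve-∀
    five : ∀ n → 5 * (n * 2) ≡ 2 * n + (2 * n + (2 * n + (2 * n + 2 * n)))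
    five = solve-∀
    total : deg G a + (deg G b + (deg G c + (deg G d + deg G e))) ≤ n * 2
    total = begin
      deg G a + (deg G b + (deg G c + (deg G d + deg G e)))
        ≡⟨ cong₂ _+_ (deg-Σ a) (cong₂ _+_ (deg-Σ b) (cong₂ _+_ (deg-Σ c) (cong₂ _+_ (deg-Σ d) (deg-Σ e)))) ⟩
      (Σ[ full ] _) + ((Σ[ full ] _) + ((Σ[ full ] _) + ((Σ[ full ] λ u → ⟦ adj G d u ⟧) + (Σ[ full ] λ u → ⟦ adj G e u ⟧))))
        ≡⟨ cong (λ t → (Σ[ full ] _) + ((Σ[ full ] _) + ((Σ[ full ] _) + t))) (≡-sym (Σ-+ full _ _)) ⟩
      (Σ[ full ] _) + ((Σ[ full ] _) + ((Σ[ full ] λ u → ⟦ adj G c u ⟧) + (Σ[ full ] λ u → ⟦ adj G d u ⟧ + ⟦ adj G e u ⟧)))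
        ≡⟨ cong (λ t → (Σ[ full ] _) + ((Σ[ full ] _) + t)) (≡-sym (Σ-+ full _ _)) ⟩
      (Σ[ full ] _) + ((Σ[ full ] λ u → ⟦ adj G b u ⟧) + (Σ[ full ] λ u → ⟦ adj G c u ⟧ + (⟦ adj G d u ⟧ + ⟦ adj G e u ⟧)))
        ≡⟨ cong ((Σ[ full ] _) +_) (≡-sym (Σ-+ full _ _)) ⟩
      (Σ[ full ] λ u → ⟦ adj G a u ⟧) + (Σ[ full ] λ u → ⟦ adj G b u ⟧ + (⟦ adj G c u ⟧ + (⟦ adj G d u ⟧ + ⟦ adj G e u ⟧)))
        ≡⟨ ≡-sym (Σ-+ full _ _) ⟩
      (Σ[ full ] λ u → ⟦ adj G a u ⟧ + (⟦ adj G b u ⟧ + (⟦ adj G c u ⟧ + (⟦ adj G d u ⟧ + ⟦ adj G e u ⟧))))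
        ≤⟨ Σ-≤-const full (λ u _ → five-cycle-bools (adj G a u) _ _ _ (adj G e u)
             (avoid ab u) (avoid bc u) (avoid cd u) (avoid de u) (avoid ea u)) ⟩
      # (full {n}) * 2
        ≡⟨ cong (_* 2) #-full ⟩
      n * 2 ∎

  -- The candidate for lying in the same class of a bipartition; being Boolean, it serves directly
  -- as a colouring once one argument is fixed.
  share : Fin n → Fin n → Bool
  share x y = any (λ c → adj G x c ∧ adj G y c) (allFin n)

  share⁺ : ∀ {x y c} → adj G x c ≡ true → adj G y c ≡ true → share x y ≡ true
  share⁺ {x} {y} {c} p q = any⁺ (λ c → adj G x c ∧ adj G y c) (∈-allFin c) (∧-intro p q)

  share⁻ : ∀ x y → share x y ≡ true → ∃[ c ] (adj G x c ≡ true × adj G y c ≡ true)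
  share⁻ x y e = let (c , _ , p) = any⁻ (λ c → adj G x c ∧ adj G y c) (allFin n) e in c , ∧-fst p , ∧-snd {adj G x c} p

  adjacent-not-share : ∀ {x y} → adj G x y ≡ true → share x y ≡ true → ⊥
  adjacent-not-share {x} {y} xy s = let (c , p , q) = share⁻ x y s in true≢false q (no-triangle G tf xy p)

  -- Three pairwise disjoint neighbourhoods would contain more than 6n/5 vertices.
  two-share : ∀ x y z → share x y ≡ false → share y z ≡ false → share x z ≡ false → ⊥
  two-share x y z xy yz xz = <-irrefl refl (begin-strict
    5 * n
      ≤⟨ m≤m+n _ n ⟩
    5 * n + n
      ≡⟨ six n ⟩
    2 * n + (2 * n + 2 * n)
      <⟨ +-mono-< (large x) (+-mono-< (large y) (large z)) ⟩
    5 * deg G x + (5 * deg G y + 5 * deg G z)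
      ≡⟨ factor (deg G x) (deg G y) (deg G z) ⟩
    5 * (deg G x + (deg G y + deg G z))
      ≤⟨ *-monoʳ-≤ 5 total ⟩
    5 * n ∎)
    where
    open ≤-Reasoning
    six : ∀ n → 5 * n + n ≡ 2 * n + (2 * n + 2 * n)
    six = solve-∀
    factor : ∀ a b c → 5 * a + (5 * b + 5 * c) ≡ 5 * (a + (b + c))
    factor = solve-∀
    apart : ∀ {x y} → share x y ≡ false → ∀ u → adj G x u ≡ true → adj G y u ≡ false
    apart {x} {y} s u p with adj G y u in q
    ... | false = refl
    ... | true  = contradiction (share⁺ p q) λ t → true≢false t s
    total : deg G x + (deg G y + deg G z) ≤ n
    total = begin
      deg G x + (deg G y + deg G z)
        ≡⟨ cong₂ _+_ (deg-Σ x) (cong₂ _+_ (deg-Σ y) (deg-Σ z)) ⟩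
      (Σ[ full ] _) + ((Σ[ full ] λ u → ⟦ adj G y u ⟧) + (Σ[ full ] λ u → ⟦ adj G z u ⟧))
        ≡⟨ cong ((Σ[ full ] _) +_) (≡-sym (Σ-+ full _ _)) ⟩
      (Σ[ full ] λ u → ⟦ adj G x u ⟧) + (Σ[ full ] λ u → ⟦ adj G y u ⟧ + ⟦ adj G z u ⟧)
        ≡⟨ ≡-sym (Σ-+ full _ _) ⟩
      (Σ[ full ] λ u → ⟦ adj G x u ⟧ + (⟦ adj G y u ⟧ + ⟦ adj G z u ⟧))
        ≤⟨ Σ-≤-const full (λ u _ → disjoint-bools (adj G x u) _ (adj G z u) (apart xy u) (apart yz u) (apart xz u)) ⟩
      # (full {n}) * 1
        ≡⟨ trans (*-identityʳ _) #-full ⟩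
      n ∎

  -- For a walk x a y b z, the vertex a shares a neighbour neither with x nor with z, so x and z share one.
  share-trans : ∀ x y z → share x y ≡ true → share y z ≡ true → share x z ≡ true
  share-trans x y z xy yz with share x z in xz
  ... | true  = refl
  ... | false = ⊥-elim (two-share x a z (not-share λ s → adjacent-not-share (proj₁ (proj₂ (share⁻ x y xy))) s) (not-share far) xz)
    where
    a = proj₁ (share⁻ x y xy)
    not-share : ∀ {p q} → (share p q ≡ true → ⊥) → share p q ≡ false
    not-share {p} {q} h with share p q
    ... | true  = ⊥-elim (h refl)
    ... | false = refl
    far : share a z ≡ true → ⊥
    far s = let (_ , _ , ya) = share⁻ x y xy
                (b , yb , zb) = share⁻ y z yz
                (c , ac , zc) = share⁻ a z s
            in no-5-walk (adj-sym G ya) yb (adj-sym G zb) zc (adj-sym G ac)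

  share-sym : ∀ x y → share x y ≡ true → share y x ≡ true
  share-sym x y s = let (_ , p , q) = share⁻ x y s in share⁺ q p

  -- If both ends share a neighbour with `v`, they share one with each other, which closes a
  -- triangle on their edge. If neither does, then `i`, `j`, `v` contradict `two-share`.
  share-proper : ∀ v i j → adj G i j ≡ true → xorB (share i v) (share j v) ≡ true
  share-proper v i j ij with share i v in iv | share j v in jv
  ... | true  | false = refl
  ... | false | true  = refl
  ... | true  | true  = ⊥-elim (adjacent-not-share ij (share-trans i v j iv (share-sym j v jv)))
  ... | false | false with share i j in s
  ...   | true  = ⊥-elim (adjacent-not-share ij s)
  ...   | false = ⊥-elim (two-share i j v s jv iv)

-- Parity of n and the final case distinction

double≡+ : ∀ m → double m ≡ m + m
double≡+ zero    = refl
double≡+ (suc m) = cong suc (trans (cong suc (double≡+ m)) (≡-sym (+-suc m m)))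

parity : ∀ n → ∃[ m ] (n ≡ double m ⊎ n ≡ suc (double m))
parity zero    = 0 , inj₁ refl
parity (suc n) with parity n
... | m , inj₁ e = m , inj₂ (cong suc e)
... | m , inj₂ e = suc m , inj₁ (cong suc e)

half-double : ∀ m → double m / 2 ≡ m
half-double m = trans (cong (_/ 2) (trans (double≡+ m) (trans (cong (m +_) (≡-sym (+-identityʳ m))) (*-comm 2 m)))) (m*n/n≡m m 2)

half-suc-double : ∀ m → suc (double m) / 2 ≡ m
half-suc-double zero    = refl
half-suc-double (suc m) = trans (m/n≡1+[m∸n]/n {suc (double (suc m))} {2} (s≤s (s≤s z≤n))) (cong suc (half-suc-double m))

record Halves (n h b : ℕ) : Set where
  field
    sum-halves : h + b ≡ n
    floor-half : n / 2 ≡ h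
    h≤b        : h ≤ b
    b≤1+h      : b ≤ suc h
    70≤h       : 70 ≤ h
    -- The left-hand side bounds twice the number of cycles if some vertex has degree d.
    gap        : ∀ d → 5 * d ≤ 2 * n → d * ((d ∸ 1) * F (n ∸ 3)) + T (n ∸ 1) < C h b

halves : ∀ n → 141 ≤ n → ∃[ h ] ∃[ b ] Halves n h b
halves n l with parity n
... | m , inj₁ refl = m , m , record
  { sum-halves = ≡-sym (double≡+ m) ; floor-half = half-double m ; h≤b = ≤-refl ; b≤1+h = n≤1+n m ; 70≤h = 70≤m
  ; gap = λ d h → even-case m 70≤m d (≤-trans h (≤-reflexive (trans (cong (2 *_) (double≡+ m)) (four m)))) }
  where
  70≤m : 70 ≤ m
  70≤m = ≤-trans (⌊n/2⌋-mono l) (≤-reflexive (⌊double/2⌋ m))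
  four : ∀ m → 2 * (m + m) ≡ 4 * m
  four = solve-∀
  even-case : ∀ m → 70 ≤ m → ∀ d → 5 * d ≤ 4 * m → d * ((d ∸ 1) * F (double m ∸ 3)) + T (double m ∸ 1) < C m m
  even-case m l d h with m≤n⇒∃[o]m+o≡n (≤-trans (m≤m+n 4 66) l)
  -- The first summand of `C`, the cycles through a single vertex of the balanced graph, already
  -- exceeds the bound.
  ... | r , refl = <-≤-trans (even-gap r d (≤-pred (≤-trans (m≤m+n 5 65) l)) h) (m≤m+n (Q (4 + r) (3 + r)) _)
... | m , inj₂ refl = m , suc m , record
  { sum-halves = trans (+-suc m m) (cong suc (≡-sym (double≡+ m))) ; floor-half = half-suc-double m ; h≤b = n≤1+n m ; b≤1+h = ≤-refl
  ; 70≤h = 70≤m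
  ; gap = λ d h → odd-case m 70≤m d (≤-trans h (≤-reflexive (trans (cong (λ k → 2 * suc k) (double≡+ m)) (four m)))) }
  where
  70≤m : 70 ≤ m
  70≤m = ≤-trans (⌊n/2⌋-mono l) (≤-reflexive (⌈double/2⌉ m))
  four : ∀ m → 2 * suc (m + m) ≡ 4 * m + 2
  four = solve-∀
  odd-case : ∀ m → 70 ≤ m → ∀ d → 5 * d ≤ 4 * m + 2 → d * ((d ∸ 1) * F (suc (double m) ∸ 3)) + T (double m) < C m (suc m)
  odd-case m l d h with m≤n⇒∃[o]m+o≡n (≤-trans (m≤m+n 4 66) l)
  -- Here the vertex is taken from the larger class, which leaves `4 + r` vertices in either class;
  -- `C-step` permits this.
  ... | r , refl = <-≤-trans (odd-gap r d (≤-trans (m≤m+n 42 28) l) h)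
    (≤-trans (m≤m+n (Q (4 + r) (4 + r)) _) (≤-reflexive (≡-sym (C-step (4 + r) (4 + r)))))

Extremal : SimpleGraph n → Set
Extremal {n} G = (numCycles G ≤ numCycles (balancedK n)) × (numCycles G ≡ numCycles (balancedK n) → G ≅ balancedK n)

fewer : (G : SimpleGraph n) → 2 * numCycles G < 2 * numCycles (balancedK n) → Extremal G
fewer G l = <⇒≤ l′ , λ e → contradiction e (<⇒≢ l′)
  where l′ = *-cancelˡ-< 2 _ _ l

module _ {n h b : ℕ} (H : Halves n h b) where
  open Halves H

  #-inA : # (threshold {n} (n / 2)) ≡ h
  #-inA = trans (cong (λ k → # (threshold {n} k)) floor-half)
    (subst (λ k → # (threshold {k} h) ≡ h) sum-halves (#-threshold h b))

  cycles-balanced : 2 * numCycles (balancedK n) ≡ C h b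
  cycles-balanced = trans (cong (2 *_) (numCycles-cong (balancedK n) (K (threshold (n / 2)) full) (λ i j → refl)))
    (trans (cycles-full (threshold (n / 2))) (cong₂ C #-inA (#-not (threshold (n / 2)) sum-halves #-inA)))

  -- Only the first deleted vertex has to have low degree; the cycles avoiding it fall under `T`.
  low-degree : (G : SimpleGraph n) → TriangleFree G → ∀ x → 5 * deg G x ≤ 2 * n → Extremal G
  low-degree G tf x l = fewer G (begin-strict
    2 * numCycles G
      ≡⟨ CyclesThrough.numCycles-remove G x full (λ _ → refl) ⟩
    closed G x n full + 2 * numCycles (G ⊝ x)
      ≤⟨ +-mono-≤ (closed≤ G tf x n full refl)
           (numCycles≤T (# (full ∖ x)) (G ⊝ x) (full ∖ x) (triangleFree-⊝ G x tf) (alive-⊝ G full x (λ _ → refl)) refl) ⟩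
    deg G x * ((deg G x ∸ 1) * F (# (full {n}) ∸ 3)) + T (# (full ∖ x))
      ≡⟨ cong₂ (λ s t → deg G x * ((deg G x ∸ 1) * F (s ∸ 3)) + T t) #-full
           (cong (_∸ 1) (trans (≡-sym (#-remove full {x} refl)) #-full)) ⟩
    deg G x * ((deg G x ∸ 1) * F (n ∸ 3)) + T (n ∸ 1)
      <⟨ gap (deg G x) l ⟩
    C h b
      ≡⟨ ≡-sym cycles-balanced ⟩
    2 * numCycles (balancedK n) ∎)
    where open ≤-Reasoning

  -- If the smaller class has fewer than `h` vertices, even the complete bipartite graph on these
  -- classes has fewer cycles than the balanced one. Otherwise that graph is the balanced one up to
  -- relabelling, and equality excludes missing edges.
  bipartite : (G : SimpleGraph n) (f : VSet n) → (∀ i j → adj G i j ≡ true → xorB (f i) (f j) ≡ true) →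
    # f ≤ # (not ∘ f) → Extremal G
  bipartite G f proper l with m≤n⇒m<n∨m≡n #f≤h
    where
    sizes : # f + # (not ∘ f) ≡ n
    sizes = trans (≡-sym (#-split full f)) #-full
    #f≤h : # f ≤ h
    -- Otherwise the smaller class has more than `h` vertices and the larger one at least `b`, more
    -- than n in total.
    #f≤h = ≮⇒≥ λ lt → <-irrefl (trans sum-halves (≡-sym sizes))
      (+-mono-<-≤ lt (≤-trans b≤1+h (≤-trans lt l)))
  ... | inj₁ lt = fewer G (begin-strict
    2 * numCycles G                    ≤⟨ *-monoʳ-≤ 2 (MissingEdge.numCycles≤K G f proper) ⟩
    2 * numCycles (K f full)           ≡⟨ cycles-full f ⟩
    C (# f) (# (not ∘ f))              <⟨ unbalanced (# f) (m≤n⇒∃[o]m+o≡n lt) (trans (≡-sym (#-split full f)) #-full) ⟩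
    C h b                              ≡⟨ ≡-sym cycles-balanced ⟩
    2 * numCycles (balancedK n)        ∎)
    where
    open ≤-Reasoning
    unbalanced : ∀ a {c} → ∃[ j ] suc a + j ≡ h → a + c ≡ n → C a c < C h b
    unbalanced a {c} (j , e) s = subst (λ c → C a c < C h b) (≡-sym c≡)
      (subst (λ k → C a (suc j + b) < C k b) e (C-unbalanced j a b
        (≤-pred (≤-trans (≤-trans (m≤m+n 2 68) 70≤h) (≤-reflexive (≡-sym e)))) (≤-trans (≤-reflexive e) h≤b)))
      where
      c≡ : c ≡ suc j + b
      c≡ = +-cancelˡ-≡ a _ _ (trans s (trans (≡-sym sum-halves) (trans (cong (_+ b) (≡-sym e))
        (trans (cong (_+ b) (≡-sym (+-suc a j))) (+-assoc a (suc j) b)))))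
  ... | inj₂ eq = ≤-trans (MissingEdge.numCycles≤K G f proper) (≤-reflexive same-count) , λ e →
      let (σ , σ-colours) = relabel f (threshold (n / 2)) (trans eq (≡-sym #-inA))
      in σ , λ i j → trans (MissingEdge.complete-or-fewer G f proper (≤-trans 2≤h (≤-reflexive (≡-sym eq)))
           (≤-trans 2≤h (≤-trans (≤-reflexive (≡-sym eq)) l)) (trans e (≡-sym same-count)) i j)
           (cong₂ xorB (σ-colours i) (σ-colours j))
    where
    2≤h : 2 ≤ h
    2≤h = ≤-trans (m≤m+n 2 68) 70≤h
    same-count : numCycles (K f full) ≡ numCycles (balancedK n)
    same-count = *-cancelˡ-≡ _ _ 2 (trans (cycles-full f) (trans (cong₂ C eq (#-not f sum-halves eq)) (≡-sym cycles-balanced)))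

  bipartite-extremal : (G : SimpleGraph n) (f : VSet n) → (∀ i j → adj G i j ≡ true → xorB (f i) (f j) ≡ true) → Extremal G
  bipartite-extremal G f proper with ≤-total (# f) (# (not ∘ f))
  ... | inj₁ l = bipartite G f proper l
  ... | inj₂ l = bipartite G (not ∘ f) (λ i j e → trans (xorB-not (f i) (f j)) (proper i j e))
    (≤-trans l (≤-reflexive (#-cong (λ i → ≡-sym (not-involutive (f i))))))
    where
    xorB-not : ∀ p q → xorB (not p) (not q) ≡ xorB p q
    xorB-not true  q = refl
    xorB-not false q = not-involutive q

theorem11 : (n : ℕ) → 141 ≤ n → (G : SimpleGraph n) → TriangleFree G →
    (numCycles G ≤ numCycles (balancedK n))
    × (numCycles G ≡ numCycles (balancedK n) → G ≅ balancedK n)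
-- Matching on `suc` provides the vertex `zero`, the reference point of the colouring by `share`.
theorem11 n@(suc _) l G tf with halves n l | any? (λ x → 5 * deg G x ≤? 2 * n)
... | _ , _ , H | yes (x , d) = low-degree H G tf x d
... | _ , _ , H | no none = bipartite-extremal H G (λ x → share x zero) (share-proper zero)
  where open LargeMinDegree G tf (λ x → ≰⇒> (λ d → none (x , d)))
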